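{- Consider the following game. Two players, Maker and Breaker, play in timesteps $t=1,2,3,\dots$; in timestep $t$ Maker first claims $t$ previously unclaimed points of $\mathbb{Z}^2$, and then Breaker claims $t$ previously unclaimed points of $\mathbb{Z}^2$. Fix $n$. Maker wins as soon as he has a winning line segment: $n$ points claimed by Maker lying on a common straight line (of any direction), such that no point claimed by Breaker lies on that line between the first and the last of these $n$ points (the $n$ points need not be consecutive, and other points of either player may lie on the line). Then Breaker can stop Maker from winning before time $(1-o(1))n$; that is, for every $\delta>0$ and all sufficiently large $n$, Breaker has a strategy guaranteeing that Maker has no winning line segment before timestep $(1-\delta)n$.
   Context: A timestep consists of one turn of Maker followed by one turn of Breaker. Maker's winning condition depends on Breaker's points, so this is not a standard Maker-Breaker game. -}

module Defs where

open import Data.Nat using (ℕ; zero; suc)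
open import Data.Integer as ℤ using (ℤ)
open import Data.Product using (_×_; _,_; ∃-syntax; proj₁; proj₂)
open import Data.Sum using (_⊎_)
open import Data.List using (List; []; _∷_; _++_; concat; length)
open import Data.List.Relation.Unary.All using (All)
open import Data.List.Relation.Unary.Unique.Propositional using (Unique)
open import Data.List.Membership.Propositional using (_∈_; _∉_)
open import Relation.Binary.PropositionalEquality using (_≡_)
open import Relation.Nullary using (¬_)

Pt : Set
Pt = ℤ × ℤ

Move : Set
Move = List Pt

Between : ℤ → ℤ → ℤ → Set
Between a b x = (a ℤ.≤ x × x ℤ.≤ b) ⊎ (b ℤ.≤ x × x ℤ.≤ a)

-- x lies on the closed straight-line segment [p , q] in ℤ²:
-- x is collinear with p, q (cross product zero) and lies in the
-- bounding box of p and q.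
OnSegment : Pt → Pt → Pt → Set
OnSegment (p₁ , p₂) (q₁ , q₂) (x₁ , x₂) =
  ((q₁ ℤ.- p₁) ℤ.* (x₂ ℤ.- p₂) ≡ (q₂ ℤ.- p₂) ℤ.* (x₁ ℤ.- p₁))
  × Between p₁ q₁ x₁ × Between p₂ q₂ x₂

WinningSegment : ℕ → List Pt → List Pt → Set
WinningSegment n M B =
  ∃[ S ] ∃[ p ] ∃[ q ]
    ( Unique S × length S ≡ n × All (_∈ M) S
    × p ∈ S × q ∈ S
    × All (OnSegment p q) S
    × All (λ b → ¬ OnSegment p q b) B )

-- Maker's strategy: given Breaker's moves so far (in order), Maker's next move.
MakerStrategy : Set
MakerStrategy = List Move → Move

-- Breaker's strategy: given Maker's moves so far (in order, including the
-- move Maker just made in the current timestep), Breaker's reply.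
BreakerStrategy : Set
BreakerStrategy = List Move → Move

play : MakerStrategy → BreakerStrategy → ℕ → List Move × List Move
play τ σ zero = [] , []
play τ σ (suc k) with play τ σ k
... | ms , bs = let m = τ bs in (ms ++ (m ∷ [])) , (bs ++ (σ (ms ++ (m ∷ [])) ∷ []))

LegalMove : ℕ → List Pt → Move → Set
LegalMove t C m = length m ≡ t × Unique m × All (_∉ C) m

MakerLegalAt : MakerStrategy → BreakerStrategy → ℕ → Set
MakerLegalAt τ σ k =
  let ms = proj₁ (play τ σ k) ; bs = proj₂ (play τ σ k)
  in LegalMove (suc k) (concat ms ++ concat bs) (τ bs)

BreakerLegalAt : MakerStrategy → BreakerStrategy → ℕ → Set
BreakerLegalAt τ σ k =
  let ms = proj₁ (play τ σ k) ; bs = proj₂ (play τ σ k) ; m = τ bs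
  in LegalMove (suc k) (concat ms ++ m ++ concat bs) (σ (ms ++ (m ∷ [])))

-- right after Maker's move in timestep (suc k), Maker has no winning segment
NoWinAt : ℕ → MakerStrategy → BreakerStrategy → ℕ → Set
NoWinAt n τ σ k =
  let ms = proj₁ (play τ σ k) ; bs = proj₂ (play τ σ k)
  in ¬ WinningSegment n (concat ms ++ τ bs) (concat bs)

{-# OPTIONS --safe #-}
module Submission where

open import Defs
open import Data.Bool using (Bool; true; false)
open import Data.Empty using (⊥; ⊥-elim)
open import Data.Integer as ℤ using (ℤ; 0ℤ; 1ℤ)
import Data.Integer.DivMod as ℤ-DivMod
import Data.Integer.Properties as ℤₚ
import Data.Integer.Tactic.RingSolver as ℤ-Ring
open import Data.List using (List; []; _∷_; _++_; applyUpTo; concat; filter; foldl; length)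
import Data.List.Membership.DecPropositional as DecMembership
open import Data.List.Membership.Propositional using (_∈_; _∉_; find; lose)
open import Data.List.Membership.Propositional.Properties using (∈-++⁺ˡ; ∈-++⁺ʳ; ∈-++⁻; ∈-applyUpTo⁺; ∈-applyUpTo⁻; ∈-filter⁺; ∈-filter⁻)
open import Data.List.Properties using (++-assoc; ++-identityʳ; concat-++; foldl-++; length-++; length-applyUpTo; length-take)
open import Data.List.Relation.Unary.All as All using (All; []; _∷_)
import Data.List.Relation.Unary.All.Properties as Allₚ
open import Data.List.Relation.Unary.AllPairs as AllPairs using (AllPairs; []; _∷_)
import Data.List.Relation.Unary.AllPairs.Properties as AllPairsₚ
open import Data.List.Relation.Unary.Any using (Any; any?; here; there)
open import Data.List.Relation.Unary.Unique.Propositional using (Unique)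
import Data.List.Relation.Unary.Unique.Propositional.Properties as Uniqueₚ
open import Data.Nat using (ℕ; zero; suc; _+_; _*_; _∸_; _^_; _≤_; _<_; z≤n; s≤s; >-nonZero; ⌊_/2⌋; ⌈_/2⌉)
import Data.Nat.DivMod as DivMod
open import Data.Nat.Induction using (<-wellFounded)
open import Data.Nat.Properties as ℕₚ using (≤-refl; ≤-trans; ≤-reflexive; +-mono-≤; *-mono-≤; m≤m+n; m≤n+m)
import Data.Nat.Tactic.RingSolver as ℕ-Ring
open import Data.Product using (Σ; _×_; _,_; ∃-syntax; proj₁; proj₂)
open import Data.Product.Properties using (≡-dec)
import Data.Rational.Properties as ℚₚ
import Data.Rational.Unnormalised as ℚᵘ
import Data.Rational.Unnormalised.Properties as ℚᵘₚ
open import Data.Sum using (_⊎_; inj₁; inj₂; [_,_]′)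
open import Function using (_∘_)
open import Induction.WellFounded using (Acc; acc)
open import Relation.Binary.Definitions using (Tri; tri<; tri≈; tri>)
open import Relation.Binary.PropositionalEquality using (_≡_; _≢_; refl; sym; trans; cong; cong₂; subst; subst₂; module ≡-Reasoning)
open import Relation.Nullary using (¬_; Dec; yes; no; contradiction; ¬?; _×-dec_; _⊎-dec_)
open import Relation.Nullary.Decidable using (map′)
open import Relation.Unary using (Decidable)

-- Breaker watches the stretches of lattice lines that contain none of his points and are not yet full
-- of Maker's points.  To win, Maker needs such a stretch with linearly many points before his last move.
-- For a stretch with many of Maker's points Breaker picks the middle one and claims the first points to its
-- left and right that are not Maker's; afterwards no threatening stretch contains this centre, and any two
-- centres on a line are separated by many of Maker's points.  Breaker serves large threats first.
--
-- Suppose a large threat survives a turn T.  If small threats survived each of the last w turns, then about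
-- w² / 4 centres were treated, which yields that many disjoint or almost disjoint collinear sets of Maker's
-- points of linear size.  A weak form of the Szemerédi–Trotter theorem shows that there are only o(n²) of them:
-- two lines cut a point set into four quarters, every other line misses one of these, and iterating this
-- gains a factor 3/4 per level over the trivial bound by pairs of points.  Otherwise there were no small
-- threats at some time within the last w turns, so all stretches treated in turn T consist mainly of new
-- points; but there are too few new points for T / 2 almost disjoint sets of linear size.

-- In the case of a loud window, counting pairs of points does not yet give a contradiction. Maker
-- has at most `n²` points, so the pairs allow about `n⁴ / n²` rays with linearly many points each,
-- and `w² / 4` is of this same order, because `w` is a fixed fraction of `n`. Any factor that can
-- be made arbitrarily small is enough, so a recursion whose depth depends only on `δ` replaces a
-- sharp incidence bound.
--
-- The window must also be short: its `w * T` new points have to be too few for the rays of a single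
-- turn, so the thresholds are large multiples of `w`.
--
-- Stretches full of Maker's points are no threats because Breaker cannot cut them. Nothing is lost,
-- since a win inside such a stretch existed before Maker's last move.
--
-- All rays of a family are measured by one fixed point set `Q` instead of Maker's current points.
-- Their sizes do not change while the game goes on, so a separation shown in one turn remains valid
-- in later ones.

private variable
  E E′ : Set

-- Finite sums, counting and pairs

indicator : Dec E → ℕ
indicator (yes _) = 1
indicator (no _) = 0

∑ : (E → ℕ) → List E → ℕ
∑ f [] = 0
∑ f (x ∷ xs) = f x + ∑ f xs

count : {P : E → Set} → Decidable P → List E → ℕ
count P? = ∑ (indicator ∘ P?)

indicator-≤1 : (d : Dec E) → indicator d ≤ 1
indicator-≤1 (yes _) = ≤-refl
indicator-≤1 (no _) = z≤n

indicator-mono : (d : Dec E) (e : Dec E′) → (E → E′) → indicator d ≤ indicator e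
indicator-mono (yes x) (yes y) f = ≤-refl
indicator-mono (yes x) (no ¬y) f = ⊥-elim (¬y (f x))
indicator-mono (no ¬x) e f = z≤n

∑-mono-∈ : {f g : E → ℕ} (xs : List E) → (∀ {x} → x ∈ xs → f x ≤ g x) → ∑ f xs ≤ ∑ g xs
∑-mono-∈ [] h = z≤n
∑-mono-∈ (x ∷ xs) h = +-mono-≤ (h (here refl)) (∑-mono-∈ xs (h ∘ there))

∑-mono : {f g : E → ℕ} (xs : List E) → (∀ x → f x ≤ g x) → ∑ f xs ≤ ∑ g xs
∑-mono xs h = ∑-mono-∈ xs (λ {x} _ → h x)

∑-cong : {f g : E → ℕ} (xs : List E) → (∀ x → f x ≡ g x) → ∑ f xs ≡ ∑ g xs
∑-cong [] h = refl
∑-cong (x ∷ xs) h = cong₂ _+_ (h x) (∑-cong xs h)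

∑-0 : (xs : List E) → ∑ (λ _ → 0) xs ≡ 0
∑-0 [] = refl
∑-0 (x ∷ xs) = ∑-0 xs

interchange : ∀ a b c d → (a + b) + (c + d) ≡ (a + c) + (b + d)
interchange = ℕ-Ring.solve-∀

∑-+ : (f g : E → ℕ) (xs : List E) → ∑ (λ x → f x + g x) xs ≡ ∑ f xs + ∑ g xs
∑-+ f g [] = refl
∑-+ f g (x ∷ xs) = trans (cong (f x + g x +_) (∑-+ f g xs)) (interchange (f x) (g x) (∑ f xs) (∑ g xs))

∑-* : (k : ℕ) (f : E → ℕ) (xs : List E) → ∑ (λ x → k * f x) xs ≡ k * ∑ f xs
∑-* k f [] = sym (ℕₚ.*-zeroʳ k)
∑-* k f (x ∷ xs) = trans (cong (k * f x +_) (∑-* k f xs)) (sym (ℕₚ.*-distribˡ-+ k (f x) (∑ f xs)))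

∑-swap : (f : E → E′ → ℕ) (xs : List E) (ys : List E′) →
         ∑ (λ x → ∑ (f x) ys) xs ≡ ∑ (λ y → ∑ (λ x → f x y) xs) ys
∑-swap f [] ys = sym (∑-0 ys)
∑-swap f (x ∷ xs) ys = trans (cong (∑ (f x) ys +_) (∑-swap f xs ys))
                             (sym (∑-+ (f x) (λ y → ∑ (λ x → f x y) xs) ys))

∑-++ : (f : E → ℕ) (xs ys : List E) → ∑ f (xs ++ ys) ≡ ∑ f xs + ∑ f ys
∑-++ f [] ys = refl
∑-++ f (x ∷ xs) ys = trans (cong (f x +_) (∑-++ f xs ys)) (sym (ℕₚ.+-assoc (f x) (∑ f xs) (∑ f ys)))

∑-const-≤ : {f : E → ℕ} {k : ℕ} (xs : List E) → All (λ x → f x ≤ k) xs → ∑ f xs ≤ length xs * k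
∑-const-≤ [] [] = z≤n
∑-const-≤ (x ∷ xs) (p ∷ ps) = +-mono-≤ p (∑-const-≤ xs ps)

∑-const-≥ : {f : E → ℕ} {k : ℕ} (xs : List E) → All (λ x → k ≤ f x) xs → length xs * k ≤ ∑ f xs
∑-const-≥ [] [] = z≤n
∑-const-≥ (x ∷ xs) (p ∷ ps) = +-mono-≤ p (∑-const-≥ xs ps)

∑-filter : {P : E → Set} (P? : Decidable P) (f : E → ℕ) (xs : List E) →
           ∑ f (filter P? xs) ≡ ∑ (λ x → indicator (P? x) * f x) xs
∑-filter P? f [] = refl
∑-filter P? f (x ∷ xs) with P? x
... | yes _ = cong₂ _+_ (sym (ℕₚ.+-identityʳ (f x))) (∑-filter P? f xs)
... | no _ = ∑-filter P? f xs

length-filter-≡ : {P : E → Set} (P? : Decidable P) (xs : List E) → length (filter P? xs) ≡ count P? xs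
length-filter-≡ P? [] = refl
length-filter-≡ P? (x ∷ xs) with P? x
... | yes _ = cong suc (length-filter-≡ P? xs)
... | no _ = length-filter-≡ P? xs

count-mono : {P : E → Set} {Q : E → Set} (P? : Decidable P) (Q? : Decidable Q) (xs : List E) →
             (∀ {x} → x ∈ xs → P x → Q x) → count P? xs ≤ count Q? xs
count-mono P? Q? xs h = ∑-mono-∈ xs (λ {x} i → indicator-mono (P? x) (Q? x) (h i))

count-none : {P : E → Set} (P? : Decidable P) (xs : List E) → (∀ {x} → x ∈ xs → ¬ P x) → count P? xs ≡ 0
count-none P? [] h = refl
count-none P? (x ∷ xs) h with P? x
... | yes p = ⊥-elim (h (here refl) p)
... | no _ = count-none P? xs (h ∘ there)

count-some : {P : E → Set} (P? : Decidable P) (xs : List E) → 1 ≤ count P? xs → ∃[ x ] x ∈ xs × P x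
count-some P? (x ∷ xs) h with P? x
... | yes p = x , here refl , p
... | no _ = let y , i , p = count-some P? xs h in y , there i , p

count-≤1 : {P : E → Set} (P? : Decidable P) {xs : List E} →
           AllPairs (λ x y → P x → ¬ P y) xs → count P? xs ≤ 1
count-≤1 P? [] = z≤n
count-≤1 P? {x ∷ xs} (p ∷ ps) with P? x
... | yes px = s≤s (≤-reflexive (count-none P? xs (λ i → All.lookup p i px)))
... | no _ = count-≤1 P? ps

count-cover : {P : E → Set} {Q : E → Set} (P? : Decidable P) (Q? : Decidable Q) (xs : List E) →
              (∀ {x} → x ∈ xs → ¬ P x → Q x) → length xs ≤ count P? xs + count Q? xs
count-cover P? Q? [] h = z≤n
count-cover P? Q? (x ∷ xs) h with P? x | Q? x
... | yes _ | yes _ = s≤s (≤-trans (count-cover P? Q? xs (h ∘ there)) (ℕₚ.+-monoʳ-≤ (count P? xs) (ℕₚ.n≤1+n _)))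
... | yes _ | no _ = s≤s (count-cover P? Q? xs (h ∘ there))
... | no _ | yes _ = ≤-trans (s≤s (count-cover P? Q? xs (h ∘ there))) (≤-reflexive (sym (ℕₚ.+-suc _ _)))
... | no ¬p | no ¬q = ⊥-elim (¬q (h (here refl) ¬p))

choose2 : ℕ → ℕ
choose2 zero = 0
choose2 (suc k) = k + choose2 k

choose2-+ : ∀ {a} k → a ≤ 1 → choose2 (a + k) ≡ a * k + choose2 k
choose2-+ k z≤n = refl
choose2-+ k (s≤s z≤n) = cong (_+ choose2 k) (sym (ℕₚ.+-identityʳ k))

n≤1+choose2 : ∀ n → n ≤ 1 + choose2 n
n≤1+choose2 zero = z≤n
n≤1+choose2 (suc zero) = ≤-refl
n≤1+choose2 (suc (suc n)) = s≤s (s≤s (m≤m+n n _))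

double-choose2 : ∀ n → 2 * choose2 n + n ≡ n * n
double-choose2 zero = refl
double-choose2 (suc n) = trans (lemma n (choose2 n)) (trans (cong (1 + 2 * n +_) (double-choose2 n)) (square n))
  where
  lemma : ∀ n c → 2 * (n + c) + suc n ≡ 1 + 2 * n + (2 * c + n)
  lemma = ℕ-Ring.solve-∀
  square : ∀ n → 1 + 2 * n + n * n ≡ suc n * suc n
  square = ℕ-Ring.solve-∀

-- Double counting: a pair of elements of `xs` contributes at most once, at its only common
-- neighbour in `ys`. The roles are exchanged between the two uses: two points lie on at most one
-- ray, and two rays meet in at most one point.
common-neighbours : (χ : E → E′ → ℕ) → (∀ x y → χ x y ≤ 1) → (xs : List E) (ys : List E′) →
  AllPairs (λ x x′ → ∑ (λ y → χ x y * χ x′ y) ys ≤ 1) xs →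
  ∑ (λ y → choose2 (∑ (λ x → χ x y) xs)) ys ≤ choose2 (length xs)
common-neighbours χ χ≤1 [] ys [] = ≤-reflexive (∑-0 ys)
common-neighbours χ χ≤1 (x ∷ xs) ys (p ∷ ps) = begin
  ∑ (λ y → choose2 (χ x y + deg y)) ys
    ≡⟨ ∑-cong ys (λ y → choose2-+ (deg y) (χ≤1 x y)) ⟩
  ∑ (λ y → χ x y * deg y + choose2 (deg y)) ys
    ≡⟨ ∑-+ _ _ ys ⟩
  ∑ (λ y → χ x y * deg y) ys + ∑ (λ y → choose2 (deg y)) ys
    ≡⟨ cong (_+ ∑ (choose2 ∘ deg) ys) (∑-cong ys (λ y → sym (∑-* (χ x y) (λ x′ → χ x′ y) xs))) ⟩
  ∑ (λ y → ∑ (λ x′ → χ x y * χ x′ y) xs) ys + ∑ (λ y → choose2 (deg y)) ys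
    ≡⟨ cong (_+ ∑ (choose2 ∘ deg) ys) (∑-swap (λ y x′ → χ x y * χ x′ y) ys xs) ⟩
  ∑ (λ x′ → ∑ (λ y → χ x y * χ x′ y) ys) xs + ∑ (λ y → choose2 (deg y)) ys
    ≤⟨ +-mono-≤ (∑-const-≤ xs p) (common-neighbours χ χ≤1 xs ys ps) ⟩
  length xs * 1 + choose2 (length xs)
    ≡⟨ cong (_+ choose2 (length xs)) (ℕₚ.*-identityʳ (length xs)) ⟩
  length xs + choose2 (length xs) ∎
  where
  open ℕₚ.≤-Reasoning
  deg = λ y → ∑ (λ x → χ x y) xs

-- Halving two point sets by a line

infixl 6 _⊝_
_⊝_ : Pt → Pt → Pt
(x₁ , x₂) ⊝ (y₁ , y₂) = x₁ ℤ.- y₁ , x₂ ℤ.- y₂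

infix 4 _≺_ _≼_ _≺?_
-- Comparison of the slopes `u₂ / u₁` and `w₂ / w₁` without division. It is an order on rightward
-- vectors only, which is why `Rightward` accompanies every use of transitivity.
_≺_ _≼_ : Pt → Pt → Set
(u₁ , u₂) ≺ (w₁ , w₂) = u₂ ℤ.* w₁ ℤ.< w₂ ℤ.* u₁
(u₁ , u₂) ≼ (w₁ , w₂) = u₂ ℤ.* w₁ ℤ.≤ w₂ ℤ.* u₁

_≺?_ : (u w : Pt) → Dec (u ≺ w)
(u₁ , u₂) ≺? (w₁ , w₂) = u₂ ℤ.* w₁ ℤ.<? w₂ ℤ.* u₁

Rightward : Pt → Set
Rightward (u₁ , _) = 0ℤ ℤ.< u₁

swap-right : ∀ a b c → a ℤ.* b ℤ.* c ≡ a ℤ.* c ℤ.* b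
swap-right = ℤ-Ring.solve-∀

≮⇒≼ : ∀ {u w} → ¬ u ≺ w → w ≼ u
≮⇒≼ h = ℤₚ.≮⇒≥ h

≺-≼-trans : ∀ {u w z} → Rightward u → Rightward w → Rightward z → u ≺ w → w ≼ z → u ≺ z
≺-≼-trans {u₁ , u₂} {w₁ , w₂} {z₁ , z₂} pu pw pz uw wz =
  ℤₚ.*-cancelʳ-<-nonNeg w₁ {{ℤ.nonNegative (ℤₚ.<⇒≤ pw)}} (begin-strict
    u₂ ℤ.* z₁ ℤ.* w₁ ≡⟨ swap-right u₂ z₁ w₁ ⟩
    u₂ ℤ.* w₁ ℤ.* z₁ <⟨ ℤₚ.*-monoʳ-<-pos z₁ {{ℤ.positive pz}} uw ⟩
    w₂ ℤ.* u₁ ℤ.* z₁ ≡⟨ swap-right w₂ u₁ z₁ ⟩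
    w₂ ℤ.* z₁ ℤ.* u₁ ≤⟨ ℤₚ.*-monoʳ-≤-nonNeg u₁ {{ℤ.nonNegative (ℤₚ.<⇒≤ pu)}} wz ⟩
    z₂ ℤ.* w₁ ℤ.* u₁ ≡⟨ swap-right z₂ w₁ u₁ ⟩
    z₂ ℤ.* u₁ ℤ.* w₁ ∎)
  where open ℤₚ.≤-Reasoning

≼-≺-trans : ∀ {u w z} → Rightward u → Rightward w → Rightward z → u ≼ w → w ≺ z → u ≺ z
≼-≺-trans {u₁ , u₂} {w₁ , w₂} {z₁ , z₂} pu pw pz uw wz =
  ℤₚ.*-cancelʳ-<-nonNeg w₁ {{ℤ.nonNegative (ℤₚ.<⇒≤ pw)}} (begin-strict
    u₂ ℤ.* z₁ ℤ.* w₁ ≡⟨ swap-right u₂ z₁ w₁ ⟩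
    u₂ ℤ.* w₁ ℤ.* z₁ ≤⟨ ℤₚ.*-monoʳ-≤-nonNeg z₁ {{ℤ.nonNegative (ℤₚ.<⇒≤ pz)}} uw ⟩
    w₂ ℤ.* u₁ ℤ.* z₁ ≡⟨ swap-right w₂ u₁ z₁ ⟩
    w₂ ℤ.* z₁ ℤ.* u₁ <⟨ ℤₚ.*-monoʳ-<-pos u₁ {{ℤ.positive pu}} wz ⟩
    z₂ ℤ.* w₁ ℤ.* u₁ ≡⟨ swap-right z₂ w₁ u₁ ⟩
    z₂ ℤ.* u₁ ℤ.* w₁ ∎)
  where open ℤₚ.≤-Reasoning

≺-trans : ∀ {u w z} → Rightward u → Rightward w → Rightward z → u ≺ w → w ≺ z → u ≺ z
≺-trans {u} {w} {z} pu pw pz uw wz = ≺-≼-trans {u} {w} {z} pu pw pz uw (ℤₚ.<⇒≤ wz)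

-- Strict counts on both sides allow for ties: many points may have the same slope, and no order
-- among them has to be chosen.
Ranked : (Pt → Pt) → List Pt → ℕ → Pt → Set
Ranked κ xs r m = count (λ x → κ x ≺? κ m) xs ≤ r × count (λ x → κ m ≺? κ x) xs + suc r ≤ length xs

count-∷-≤ : {A : Set} {P : A → Set} (P? : Decidable P) (x : A) (xs : List A) → count P? (x ∷ xs) ≤ suc (count P? xs)
count-∷-≤ P? x xs = ℕₚ.+-monoˡ-≤ (count P? xs) (indicator-≤1 (P? x))

count-∷-¬ : {A : Set} {P : A → Set} (P? : Decidable P) (x : A) (xs : List A) → ¬ P x → count P? (x ∷ xs) ≤ count P? xs
count-∷-¬ P? x xs ¬p with P? x
... | yes p = ⊥-elim (¬p p)
... | no _ = ≤-refl

count-≤-length : {A : Set} {P : A → Set} (P? : Decidable P) (xs : List A) → count P? xs ≤ length xs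
count-≤-length P? [] = z≤n
count-≤-length P? (x ∷ xs) = ≤-trans (count-∷-≤ P? x xs) (s≤s (count-≤-length P? xs))

≺-irrefl : ∀ {u} → ¬ u ≺ u
≺-irrefl h = ℤₚ.<-irrefl refl h

-- An element of rank r of x ∷ xs is one of rank r − 1 or r of xs, or x itself if it lies between these.
select : (κ : Pt → Pt) (xs : List Pt) → All (Rightward ∘ κ) xs → (r : ℕ) → r < length xs →
         ∃[ m ] m ∈ xs × Ranked κ xs r m
select κ (x ∷ xs) (px ∷ pxs) r (s≤s r≤) = go r r≤
  where
  keep-below : ∀ {m r} → m ∈ xs → ¬ κ x ≺ κ m → Ranked κ xs r m → ∃[ m ] m ∈ x ∷ xs × Ranked κ (x ∷ xs) r m
  keep-below {m} i h (p , q) = m , there i , ≤-trans (count-∷-¬ (λ y → κ y ≺? κ m) x xs h) p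
                                       , ≤-trans (ℕₚ.+-monoˡ-≤ _ (count-∷-≤ (λ y → κ m ≺? κ y) x xs)) (s≤s q)
  keep-above : ∀ {m r} → m ∈ xs → ¬ κ m ≺ κ x → Ranked κ xs r m → ∃[ m ] m ∈ x ∷ xs × Ranked κ (x ∷ xs) (suc r) m
  keep-above {m} {r} i h (p , q) = m , there i , ≤-trans (count-∷-≤ (λ y → κ y ≺? κ m) x xs) (s≤s p)
                                       , ≤-trans (ℕₚ.+-monoˡ-≤ _ (count-∷-¬ (λ y → κ m ≺? κ y) x xs h))
                                                 (≤-trans (≤-reflexive (ℕₚ.+-suc _ (suc r))) (s≤s q))
  below-x : ∀ {s} → count (λ y → κ y ≺? κ x) xs ≤ s → count (λ y → κ y ≺? κ x) (x ∷ xs) ≤ s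
  below-x h = ≤-trans (count-∷-¬ (λ y → κ y ≺? κ x) x xs (≺-irrefl {κ x})) h
  above-x : ∀ {s} → count (λ y → κ x ≺? κ y) xs + s ≤ length xs → count (λ y → κ x ≺? κ y) (x ∷ xs) + suc s ≤ suc
      (length xs)
  above-x {s} h = ≤-trans (ℕₚ.+-monoˡ-≤ (suc s) (count-∷-¬ (λ y → κ x ≺? κ y) x xs (≺-irrefl {κ x})))
                          (≤-trans (≤-reflexive (ℕₚ.+-suc _ s)) (s≤s h))
  via-upper : ∀ {m r} → m ∈ xs → κ x ≺ κ m → Ranked κ xs r m → count (λ y → κ y ≺? κ x) xs ≤ r
  via-upper {m} i h (p , _) = ≤-trans (count-mono (λ y → κ y ≺? κ x) (λ y → κ y ≺? κ m) xs
    (λ {y} j yx → ≺-trans {κ y} {κ x} {κ m} (All.lookup pxs j) px (All.lookup pxs i) yx h)) p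
  via-lower : ∀ {m r} → m ∈ xs → κ m ≺ κ x → Ranked κ xs r m → count (λ y → κ x ≺? κ y) xs + suc r ≤ length xs
  via-lower {m} {r} i h (_ , q) = ≤-trans (ℕₚ.+-monoˡ-≤ (suc r) (count-mono (λ y → κ x ≺? κ y) (λ y → κ m ≺? κ y) xs
    (λ {y} j xy → ≺-trans {κ m} {κ x} {κ y} (All.lookup pxs i) px (All.lookup pxs j) h xy))) q
  first : ∀ r → r < length xs → ∃[ m ] m ∈ xs × Ranked κ xs r m
  first = select κ xs pxs
  length-bound : count (λ y → κ x ≺? κ y) xs + 0 ≤ length xs
  length-bound = ≤-trans (≤-reflexive (ℕₚ.+-identityʳ _)) (count-≤-length (λ y → κ x ≺? κ y) xs)
  go : ∀ r → r ≤ length xs → ∃[ m ] m ∈ x ∷ xs × Ranked κ (x ∷ xs) r m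
  go zero _ with 0 ℕₚ.<? length xs
  ... | no h = x , here refl
             , below-x (≤-trans (count-≤-length (λ y → κ y ≺? κ x) xs) (ℕₚ.≮⇒≥ h)) , above-x length-bound
  ... | yes h with first 0 h
  ...   | m , i , rk with κ x ≺? κ m
  ...     | yes xm = x , here refl , below-x (via-upper i xm rk) , above-x length-bound
  ...     | no ¬xm = keep-below i ¬xm rk
  go (suc r) r< with first r r<
  ... | m , i , rk with κ m ≺? κ x
  ...   | no ¬mx = keep-above i ¬mx rk
  ...   | yes mx with suc r ℕₚ.<? length xs
  ...     | no h = x , here refl , below-x (≤-trans (count-≤-length (λ y → κ y ≺? κ x) xs) (ℕₚ.≮⇒≥ h))
                   , above-x (via-lower i mx rk)
  ...     | yes h with first (suc r) h
  ...       | m′ , i′ , rk′ with κ x ≺? κ m′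
  ...         | yes xm′ = x , here refl , below-x (via-upper i′ xm′ rk′) , above-x (via-lower i mx rk)
  ...         | no ¬xm′ = keep-below i′ ¬xm′ rk′

half< : ∀ n → 0 < n → ⌊ n /2⌋ < n
half< (suc n) _ = ℕₚ.⌊n/2⌋<n n

twice-half : ∀ n → 2 * ⌊ n /2⌋ ≤ n
twice-half n = ≤-trans (≤-reflexive (cong (⌊ n /2⌋ +_) (ℕₚ.+-identityʳ _)))
  (≤-trans (ℕₚ.+-monoʳ-≤ ⌊ n /2⌋ (ℕₚ.⌊n/2⌋≤⌈n/2⌉ n)) (≤-reflexive (ℕₚ.⌊n/2⌋+⌈n/2⌉≡n n)))

n≤2half+1 : ∀ n → n ≤ 2 * ⌊ n /2⌋ + 1
n≤2half+1 zero = z≤n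
n≤2half+1 (suc zero) = ≤-refl
n≤2half+1 (suc (suc n)) = ≤-trans (s≤s (s≤s (n≤2half+1 n))) (≤-reflexive (lemma ⌊ n /2⌋))
  where
  lemma : ∀ h → suc (suc (2 * h + 1)) ≡ 2 * suc h + 1
  lemma = ℕ-Ring.solve-∀

Halved : (Pt → Pt) → List Pt → Pt → Set
Halved κ xs m = 2 * count (λ x → κ x ≺? κ m) xs ≤ length xs × 2 * count (λ x → κ m ≺? κ x) xs ≤ length xs

ranked⇒halved : ∀ κ xs m → Ranked κ xs ⌊ length xs /2⌋ m → Halved κ xs m
ranked⇒halved κ xs m (p , q) = ≤-trans (ℕₚ.*-monoʳ-≤ 2 p) (twice-half (length xs)) , upper
  where
  h = ⌊ length xs /2⌋
  c = count (λ x → κ m ≺? κ x) xs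
  upper : 2 * c ≤ length xs
  upper = ℕₚ.+-cancelʳ-≤ (2 * suc h) _ _ (begin
    2 * c + 2 * suc h ≡⟨ sym (ℕₚ.*-distribˡ-+ 2 c (suc h)) ⟩
    2 * (c + suc h) ≤⟨ ℕₚ.*-monoʳ-≤ 2 q ⟩
    2 * length xs ≡⟨ cong (length xs +_) (ℕₚ.+-identityʳ _) ⟩
    length xs + length xs ≤⟨ ℕₚ.+-monoʳ-≤ (length xs) (n≤2half+1 (length xs)) ⟩
    length xs + (2 * h + 1) ≤⟨ ℕₚ.+-monoʳ-≤ (length xs) (≤-trans (ℕₚ.n≤1+n _) (≤-reflexive (lemma h))) ⟩
    length xs + 2 * suc h ∎)
    where
    open ℕₚ.≤-Reasoning
    lemma : ∀ h → suc (2 * h + 1) ≡ 2 * suc h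
    lemma = ℕ-Ring.solve-∀

⊝-split : ∀ a b o d → (b ℤ.- o) ℤ.* d ≡ (b ℤ.- a) ℤ.* d ℤ.+ (a ℤ.- o) ℤ.* d
⊝-split = ℤ-Ring.solve-∀

⊝-splitʳ : ∀ a b o d → d ℤ.* (b ℤ.- o) ≡ d ℤ.* (b ℤ.- a) ℤ.+ d ℤ.* (a ℤ.- o)
⊝-splitʳ = ℤ-Ring.solve-∀

cancel-right-< : ∀ {a b c d} → a ℤ.+ c ℤ.≤ b ℤ.+ d → d ℤ.< c → a ℤ.< b
cancel-right-< {a} {b} {c} {d} h lt = ℤₚ.≰⇒> (λ b≤a → ℤₚ.<⇒≱ (ℤₚ.+-mono-≤-< b≤a lt) h)

-- The cross product with `d` is additive and `b ⊝ o` is the sum of `b ⊝ a` and `a ⊝ o`; a point on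
-- or below a line is therefore seen below its direction from a point above it.
above-shift : ∀ o a b d → d ≺ a ⊝ o → b ⊝ o ≼ d → b ⊝ a ≺ d
above-shift (o₁ , o₂) (a₁ , a₂) (b₁ , b₂) (d₁ , d₂) h k =
  cancel-right-< {(b₂ ℤ.- a₂) ℤ.* d₁} {d₂ ℤ.* (b₁ ℤ.- a₁)} (subst₂ ℤ._≤_ (⊝-split a₂ b₂ o₂ d₁)
      (⊝-splitʳ a₁ b₁ o₁ d₂) k) h

below-shift : ∀ o a b d → a ⊝ o ≺ d → d ≼ b ⊝ o → d ≺ b ⊝ a
below-shift (o₁ , o₂) (a₁ , a₂) (b₁ , b₂) (d₁ , d₂) h k =
  cancel-right-< {d₂ ℤ.* (b₁ ℤ.- a₁)} {(b₂ ℤ.- a₂) ℤ.* d₁} (subst₂ ℤ._≤_ (⊝-splitʳ a₁ b₁ o₁ d₂)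
      (⊝-split a₂ b₂ o₂ d₁) k) h

⊝-Rightward : ∀ {x y} → proj₁ x ℤ.< proj₁ y → Rightward (y ⊝ x)
⊝-Rightward {x₁ , _} {y₁ , _} h = subst (ℤ._< y₁ ℤ.- x₁) (ℤₚ.+-inverseʳ x₁) (ℤₚ.+-monoˡ-< (ℤ.- x₁) h)

-- For a ∈ A let f a ∈ B be a point of median slope seen from a; the line through a and f a halves B.
-- A point of A above the line of o has a line of smaller slope, so a median slope halves A as well.
ham-sandwich : (v : ℤ) (A B : List Pt) → 0 < length A → 0 < length B →
  All (λ a → proj₁ a ℤ.< v) A → All (λ b → v ℤ.< proj₁ b) B →
  ∃[ o ] ∃[ d ] Rightward d
    × (2 * count (λ x → x ⊝ o ≺? d) A ≤ length A × 2 * count (λ x → d ≺? x ⊝ o) A ≤ length A)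
    × (2 * count (λ x → x ⊝ o ≺? d) B ≤ length B × 2 * count (λ x → d ≺? x ⊝ o) B ≤ length B)
ham-sandwich v A B A≠∅ B≠∅ left right = o , d , pd , (A-below , A-above) , ranked⇒halved (_⊝ o) B (f o)
    (proj₂ (proj₂ (f-spec o o-left)))
  where
  r = ⌊ length B /2⌋
  median-from : ∀ a → proj₁ a ℤ.< v → ∃[ b ] b ∈ B × Ranked (_⊝ a) B r b
  median-from a h = select (_⊝ a) B (All.map (λ {b} q → ⊝-Rightward {a} {b} (ℤₚ.<-trans h q)) right) r
      (half< (length B) B≠∅)
  f : Pt → Pt
  f a with proj₁ a ℤ.<? v
  ... | yes h = proj₁ (median-from a h)
  -- A default that makes `f` total; all points of `A` lie left of `v`.
  ... | no _ = a
  f-spec : ∀ a → proj₁ a ℤ.< v → Rightward (f a ⊝ a) × f a ∈ B × Ranked (_⊝ a) B r (f a)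
  f-spec a h with proj₁ a ℤ.<? v
  ... | yes h′ = let b , i , rk = median-from a h′ in ⊝-Rightward {a} {b} (ℤₚ.<-trans h′ (All.lookup right i)) , i , rk
  ... | no ¬h = ⊥-elim (¬h h)
  κ : Pt → Pt
  κ a = f a ⊝ a
  selected = select κ A (All.map (λ {a} h → proj₁ (f-spec a h)) left) ⌊ length A /2⌋ (half< (length A) A≠∅)
  o = proj₁ selected
  o-left : proj₁ o ℤ.< v
  o-left = All.lookup left (proj₁ (proj₂ selected))
  d = κ o
  pd : Rightward d
  pd = proj₁ (f-spec o o-left)
  κ-halved = ranked⇒halved κ A o (proj₂ (proj₂ selected))
  B-rank : Ranked (_⊝ o) B r (f o)
  B-rank = proj₂ (proj₂ (f-spec o o-left))
  from : ∀ {a b} → a ∈ A → b ∈ B → Rightward (b ⊝ a)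
  from {a} {b} i j = ⊝-Rightward {a} {b} (ℤₚ.<-trans (All.lookup left i) (All.lookup right j))
  -- Otherwise every point of `B` on or below the line of `o`, and there are at least `r + 1` of
  -- them, lies strictly below the median direction seen from `a`, where at most `r` points can lie.
  above⇒flatter : ∀ {a} → a ∈ A → d ≺ a ⊝ o → κ a ≺ d
  above⇒flatter {a} i h with κ a ≺? d
  ... | yes p = p
  ... | no ¬p = ⊥-elim (ℕₚ.<⇒≱ (ℕₚ.n<1+n r) (ℕₚ.+-cancelˡ-≤ (count (λ b → d ≺? b ⊝ o) B) _ _
      (≤-trans (proj₂ B-rank) (≤-trans cover (ℕₚ.+-monoʳ-≤ (count (λ b → d ≺? b ⊝ o) B)
          (proj₁ (proj₂ (proj₂ fa))))))))
    where
    fa = f-spec a (All.lookup left i)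
    cover : length B ≤ count (λ b → d ≺? b ⊝ o) B + count (λ b → b ⊝ a ≺? κ a) B
    cover = count-cover (λ b → d ≺? b ⊝ o) (λ b → b ⊝ a ≺? κ a) B
      (λ {b} j ¬q → ≺-≼-trans {b ⊝ a} {d} {κ a} (from i j) pd (proj₁ fa)
                      (above-shift o a b d h (≮⇒≼ {d} {b ⊝ o} ¬q)) (≮⇒≼ {κ a} {d} ¬p))
  below⇒steeper : ∀ {a} → a ∈ A → a ⊝ o ≺ d → d ≺ κ a
  below⇒steeper {a} i h with d ≺? κ a
  ... | yes p = p
  ... | no ¬p = ⊥-elim (ℕₚ.<⇒≱ (ℕₚ.n<1+n r) (ℕₚ.+-cancelˡ-≤ (count (λ b → κ a ≺? b ⊝ a) B) _ _
      (≤-trans (proj₂ (proj₂ (proj₂ fa))) (≤-trans cover (≤-trans (ℕₚ.+-monoˡ-≤ _ (proj₁ B-rank))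
          (≤-reflexive (ℕₚ.+-comm r _)))))))
    where
    fa = f-spec a (All.lookup left i)
    cover : length B ≤ count (λ b → b ⊝ o ≺? d) B + count (λ b → κ a ≺? b ⊝ a) B
    cover = count-cover (λ b → b ⊝ o ≺? d) (λ b → κ a ≺? b ⊝ a) B
      (λ {b} j ¬q → ≼-≺-trans {κ a} {d} {b ⊝ a} (proj₁ fa) pd (from i j)
                      (≮⇒≼ {d} {κ a} ¬p) (below-shift o a b d h (≮⇒≼ {b ⊝ o} {d} ¬q)))
  A-below = ≤-trans (ℕₚ.*-monoʳ-≤ 2 (count-mono (λ x → x ⊝ o ≺? d) (λ x → d ≺? κ x) A below⇒steeper)) (proj₂ κ-halved)
  A-above = ≤-trans (ℕₚ.*-monoʳ-≤ 2 (count-mono (λ x → d ≺? x ⊝ o) (λ x → κ x ≺? d) A above⇒flatter)) (proj₁ κ-halved)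

-- Lattice lines

infix 4 _≟ₚ_
_≟ₚ_ : (x y : Pt) → Dec (x ≡ y)
_≟ₚ_ = ≡-dec ℤ._≟_ ℤ._≟_

open DecMembership _≟ₚ_ using (_∈?_)

at : Pt → Pt → ℤ → Pt
at (c₁ , c₂) (v₁ , v₂) z = c₁ ℤ.+ z ℤ.* v₁ , c₂ ℤ.+ z ℤ.* v₂

at-at : ∀ c v y z → at (at c v y) v z ≡ at c v (y ℤ.+ z)
at-at (c₁ , c₂) (v₁ , v₂) y z = cong₂ _,_ (lemma c₁ v₁ y z) (lemma c₂ v₂ y z)
  where
  lemma : ∀ c v y z → c ℤ.+ y ℤ.* v ℤ.+ z ℤ.* v ≡ c ℤ.+ (y ℤ.+ z) ℤ.* v
  lemma = ℤ-Ring.solve-∀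

at-0 : ∀ c v → at c v 0ℤ ≡ c
at-0 (c₁ , c₂) (v₁ , v₂) = cong₂ _,_ (lemma c₁ v₁) (lemma c₂ v₂)
  where
  lemma : ∀ c v → c ℤ.+ 0ℤ ℤ.* v ≡ c
  lemma = ℤ-Ring.solve-∀

-- Coprimality in Bézout form: the coefficients recover the factor of an integer multiple of the
-- vector, as in `parallel⇒multiple`.
Primitive : Pt → Set
Primitive (v₁ , v₂) = ∃[ s ] ∃[ t ] s ℤ.* v₁ ℤ.+ t ℤ.* v₂ ≡ 1ℤ

LexPositive : Pt → Set
LexPositive (v₁ , v₂) = 0ℤ ℤ.< v₁ ⊎ (v₁ ≡ 0ℤ × 0ℤ ℤ.< v₂)

-- Every lattice line has exactly one direction vector of this kind, and its lattice points are the at c v z.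
Direction : Pt → Set
Direction v = Primitive v × LexPositive v

Parallel : Pt → Pt → Set
Parallel (v₁ , v₂) (w₁ , w₂) = v₁ ℤ.* w₂ ≡ v₂ ℤ.* w₁

scale : ℤ → Pt → Pt
scale z (v₁ , v₂) = z ℤ.* v₁ , z ℤ.* v₂

parallel⇒multiple : ∀ v w → Primitive v → Parallel v w → ∃[ z ] w ≡ scale z v
parallel⇒multiple (v₁ , v₂) (w₁ , w₂) (s , t , bez) par = s ℤ.* w₁ ℤ.+ t ℤ.* w₂ , cong₂ _,_ (sym first) (sym second)
  where
  open ≡-Reasoning
  expand₁ : ∀ s t v₁ w₁ w₂ → (s ℤ.* w₁ ℤ.+ t ℤ.* w₂) ℤ.* v₁ ≡ s ℤ.* w₁ ℤ.* v₁ ℤ.+ t ℤ.* (v₁ ℤ.* w₂)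
  expand₁ = ℤ-Ring.solve-∀
  collect₁ : ∀ s t v₁ v₂ w₁ → s ℤ.* w₁ ℤ.* v₁ ℤ.+ t ℤ.* (v₂ ℤ.* w₁) ≡ (s ℤ.* v₁ ℤ.+ t ℤ.* v₂) ℤ.* w₁
  collect₁ = ℤ-Ring.solve-∀
  expand₂ : ∀ s t v₂ w₁ w₂ → (s ℤ.* w₁ ℤ.+ t ℤ.* w₂) ℤ.* v₂ ≡ s ℤ.* (v₂ ℤ.* w₁) ℤ.+ t ℤ.* w₂ ℤ.* v₂
  expand₂ = ℤ-Ring.solve-∀
  collect₂ : ∀ s t v₁ v₂ w₂ → s ℤ.* (v₁ ℤ.* w₂) ℤ.+ t ℤ.* w₂ ℤ.* v₂ ≡ (s ℤ.* v₁ ℤ.+ t ℤ.* v₂) ℤ.* w₂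
  collect₂ = ℤ-Ring.solve-∀
  first : (s ℤ.* w₁ ℤ.+ t ℤ.* w₂) ℤ.* v₁ ≡ w₁
  first = begin
    (s ℤ.* w₁ ℤ.+ t ℤ.* w₂) ℤ.* v₁ ≡⟨ expand₁ s t v₁ w₁ w₂ ⟩
    s ℤ.* w₁ ℤ.* v₁ ℤ.+ t ℤ.* (v₁ ℤ.* w₂) ≡⟨ cong (λ p → s ℤ.* w₁ ℤ.* v₁ ℤ.+ t ℤ.* p) par ⟩
    s ℤ.* w₁ ℤ.* v₁ ℤ.+ t ℤ.* (v₂ ℤ.* w₁) ≡⟨ collect₁ s t v₁ v₂ w₁ ⟩
    (s ℤ.* v₁ ℤ.+ t ℤ.* v₂) ℤ.* w₁ ≡⟨ cong (ℤ._* w₁) bez ⟩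
    1ℤ ℤ.* w₁ ≡⟨ ℤₚ.*-identityˡ w₁ ⟩
    w₁ ∎
  second : (s ℤ.* w₁ ℤ.+ t ℤ.* w₂) ℤ.* v₂ ≡ w₂
  second = begin
    (s ℤ.* w₁ ℤ.+ t ℤ.* w₂) ℤ.* v₂ ≡⟨ expand₂ s t v₂ w₁ w₂ ⟩
    s ℤ.* (v₂ ℤ.* w₁) ℤ.+ t ℤ.* w₂ ℤ.* v₂ ≡⟨ cong (λ p → s ℤ.* p ℤ.+ t ℤ.* w₂ ℤ.* v₂) (sym par) ⟩
    s ℤ.* (v₁ ℤ.* w₂) ℤ.+ t ℤ.* w₂ ℤ.* v₂ ≡⟨ collect₂ s t v₁ v₂ w₂ ⟩
    (s ℤ.* v₁ ℤ.+ t ℤ.* v₂) ℤ.* w₂ ≡⟨ cong (ℤ._* w₂) bez ⟩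
    1ℤ ℤ.* w₂ ≡⟨ ℤₚ.*-identityˡ w₂ ⟩
    w₂ ∎

scale-injective : ∀ v y z → Primitive v → scale y v ≡ scale z v → y ≡ z
scale-injective (v₁ , v₂) y z (s , t , bez) eq = trans (sym (coeff y))
    (trans (cong₂ (λ a b → s ℤ.* a ℤ.+ t ℤ.* b) (cong proj₁ eq) (cong proj₂ eq)) (coeff z))
  where
  lemma : ∀ s t v₁ v₂ z → s ℤ.* (z ℤ.* v₁) ℤ.+ t ℤ.* (z ℤ.* v₂) ≡ z ℤ.* (s ℤ.* v₁ ℤ.+ t ℤ.* v₂)
  lemma = ℤ-Ring.solve-∀
  coeff : ∀ z → s ℤ.* (z ℤ.* v₁) ℤ.+ t ℤ.* (z ℤ.* v₂) ≡ z
  coeff z = trans (lemma s t v₁ v₂ z) (trans (cong (z ℤ.*_) bez) (ℤₚ.*-identityʳ z))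

at-⊝ : ∀ c v z → at c v z ⊝ c ≡ scale z v
at-⊝ (c₁ , c₂) (v₁ , v₂) z = cong₂ _,_ (lemma c₁ v₁ z) (lemma c₂ v₂ z)
  where
  lemma : ∀ c v z → c ℤ.+ z ℤ.* v ℤ.- c ≡ z ℤ.* v
  lemma = ℤ-Ring.solve-∀

at-injective : ∀ c v y z → Primitive v → at c v y ≡ at c v z → y ≡ z
at-injective c v y z prim eq = scale-injective v y z prim
  (trans (sym (at-⊝ c v y)) (trans (cong (_⊝ c) eq) (at-⊝ c v z)))

scale-positive : ∀ v z → LexPositive v → LexPositive (scale z v) → 0ℤ ℤ.< z
scale-positive (v₁ , v₂) z (inj₁ p) (inj₁ q) = ℤₚ.*-cancelʳ-<-nonNeg v₁ {{ℤ.nonNegative (ℤₚ.<⇒≤ p)}} q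
scale-positive (v₁ , v₂) z (inj₁ p) (inj₂ (e , q)) with ℤₚ.i*j≡0⇒i≡0∨j≡0 z e
... | inj₁ refl = ⊥-elim (ℤₚ.<-irrefl refl q)
... | inj₂ refl = ⊥-elim (ℤₚ.<-irrefl refl p)
scale-positive (v₁ , v₂) z (inj₂ (refl , p)) (inj₁ q) = ⊥-elim (ℤₚ.<-irrefl (sym (ℤₚ.*-zeroʳ z)) q)
scale-positive (v₁ , v₂) z (inj₂ (_ , p)) (inj₂ (_ , q)) = ℤₚ.*-cancelʳ-<-nonNeg v₂ {{ℤ.nonNegative (ℤₚ.<⇒≤ p)}} q

scale-scale : ∀ y z v → scale y (scale z v) ≡ scale (y ℤ.* z) v
scale-scale y z (v₁ , v₂) = cong₂ _,_ (sym (ℤₚ.*-assoc y z v₁)) (sym (ℤₚ.*-assoc y z v₂))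

scale-1 : ∀ v → scale 1ℤ v ≡ v
scale-1 (v₁ , v₂) = cong₂ _,_ (ℤₚ.*-identityˡ v₁) (ℤₚ.*-identityˡ v₂)

positive-unit : ∀ {y z} → 0ℤ ℤ.< y → 0ℤ ℤ.< z → y ℤ.* z ≡ 1ℤ → z ≡ 1ℤ
positive-unit {ℤ.+ suc a} {ℤ.+ suc b} (ℤ.+<+ _) (ℤ.+<+ _) eq =
  cong ℤ.+_ (ℕₚ.m*n≡1⇒n≡1 (suc a) (suc b) (ℤₚ.+-injective (trans (ℤₚ.pos-* (suc a) (suc b)) eq)))

-- Each vector is an integer multiple of the other, so the two factors have product `1`.
-- Lexicographic positivity makes both positive, hence equal to `1`.
parallel⇒≡ : ∀ {v w} → Direction v → Direction w → Parallel v w → v ≡ w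
parallel⇒≡ {v} {w} (pv , lv) (pw , lw) par = trans (sym (scale-1 v)) (trans (cong (λ k → scale k v) (sym z≡1))
    (sym eq))
  where
  multiple = parallel⇒multiple v w pv par
  multiple′ = parallel⇒multiple w v pw (trans (ℤₚ.*-comm (proj₁ w) (proj₂ v))
      (trans (sym par) (ℤₚ.*-comm (proj₁ v) (proj₂ w))))
  z = proj₁ multiple
  eq = proj₂ multiple
  y = proj₁ multiple′
  eq′ = proj₂ multiple′
  z≡1 : z ≡ 1ℤ
  z≡1 = positive-unit (scale-positive w y lw (subst LexPositive eq′ lv))
      (scale-positive v z lv (subst LexPositive eq lw))
    (scale-injective v (y ℤ.* z) 1ℤ pv (begin
      scale (y ℤ.* z) v ≡⟨ sym (scale-scale y z v) ⟩
      scale y (scale z v) ≡⟨ cong (scale y) (sym eq) ⟩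
      scale y w ≡⟨ sym eq′ ⟩
      v ≡⟨ sym (scale-1 v) ⟩
      scale 1ℤ v ∎))
    where open ≡-Reasoning

-- Rays of lattice points and their intersections

record Ray : Set where
  constructor ray
  field
    start : Pt
    dir : Pt
    isDirection : Direction dir
    size : ℕ

open Ray

-- Indices begin at `suc i`, so the centre from which a ray starts is not one of its points.
rayPoints : Pt → Pt → ℕ → List Pt
rayPoints c v n = applyUpTo (λ i → at c v (ℤ.+ suc i)) n

points : Ray → List Pt
points f = rayPoints (start f) (dir f) (size f)

points-at : ∀ f {x} → x ∈ points f → ∃[ z ] x ≡ at (start f) (dir f) z
points-at f i = let k , _ , eq = ∈-applyUpTo⁻ _ i in ℤ.+ suc k , eq

hit : Pt → Ray → ℕ
hit x f = indicator (x ∈? points f)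

hits : List Pt → Ray → ℕ
hits P f = count (_∈? points f) P

-- Only parallel rays are constrained, since rays in different directions share at most one point
-- anyway.
Separate : Ray → Ray → Set
Separate f g = dir f ≡ dir g → ∀ {x} → x ∈ points f → x ∉ points g

difference-at : ∀ c v y z → at c v y ⊝ at c v z ≡ scale (y ℤ.- z) v
difference-at (c₁ , c₂) (v₁ , v₂) y z = cong₂ _,_ (lemma c₁ v₁ y z) (lemma c₂ v₂ y z)
  where
  lemma : ∀ c v y z → c ℤ.+ y ℤ.* v ℤ.- (c ℤ.+ z ℤ.* v) ≡ (y ℤ.- z) ℤ.* v
  lemma = ℤ-Ring.solve-∀

⊝≢0 : ∀ {x y} → x ≢ y → x ⊝ y ≢ (0ℤ , 0ℤ)
⊝≢0 {x₁ , x₂} {y₁ , y₂} x≢y eq = x≢y (cong₂ _,_ (ℤₚ.i-j≡0⇒i≡j x₁ y₁ (cong proj₁ eq))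
    (ℤₚ.i-j≡0⇒i≡j x₂ y₂ (cong proj₂ eq)))

*-cancel-nonzero : ∀ {k a b} → k ≢ 0ℤ → k ℤ.* a ≡ k ℤ.* b → a ≡ b
*-cancel-nonzero {k} {a} {b} k≢0 eq = ℤₚ.*-cancelˡ-≡ k a b {{ℤ.≢-nonZero k≢0}} eq

common-multiple⇒parallel : ∀ {v w} y z → scale y v ≡ scale z w → scale y v ≢ (0ℤ , 0ℤ) → Parallel v w
common-multiple⇒parallel {v₁ , v₂} {w₁ , w₂} y z eq ≢0 = *-cancel-nonzero {y ℤ.* z} yz≢0 (begin
  (y ℤ.* z) ℤ.* (v₁ ℤ.* w₂) ≡⟨ lemma y z v₁ w₂ ⟩
  (y ℤ.* v₁) ℤ.* (z ℤ.* w₂) ≡⟨ cong₂ ℤ._*_ (cong proj₁ eq) (sym (cong proj₂ eq)) ⟩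
  (z ℤ.* w₁) ℤ.* (y ℤ.* v₂) ≡⟨ lemma′ y z v₂ w₁ ⟩
  (y ℤ.* z) ℤ.* (v₂ ℤ.* w₁) ∎)
  where
  open ≡-Reasoning
  lemma : ∀ y z v w → (y ℤ.* z) ℤ.* (v ℤ.* w) ≡ (y ℤ.* v) ℤ.* (z ℤ.* w)
  lemma = ℤ-Ring.solve-∀
  lemma′ : ∀ y z v w → (z ℤ.* w) ℤ.* (y ℤ.* v) ≡ (y ℤ.* z) ℤ.* (v ℤ.* w)
  lemma′ = ℤ-Ring.solve-∀
  yz≢0 : y ℤ.* z ≢ 0ℤ
  yz≢0 h with ℤₚ.i*j≡0⇒i≡0∨j≡0 y h
  ... | inj₁ refl = ≢0 refl
  ... | inj₂ refl = ≢0 eq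

-- The difference of the two points is a nonzero multiple of both directions, which are then
-- parallel and, being normalised, equal.
share-two⇒same-direction : ∀ f g {x y} → x ≢ y → x ∈ points f → y ∈ points f → x ∈ points g → y ∈ points g →
    dir f ≡ dir g
share-two⇒same-direction f g {x} {y} x≢y xf yf xg yg
  with points-at f xf | points-at f yf | points-at g xg | points-at g yg
... | a , refl | b , refl | c , eq | d , eq′ =
  parallel⇒≡ (isDirection f) (isDirection g)
    (common-multiple⇒parallel (a ℤ.- b) (c ℤ.- d)
      (trans (sym (difference-at (start f) (dir f) a b)) (trans (cong₂ _⊝_ eq eq′) (difference-at (start g)
          (dir g) c d)))
      (λ h → ⊝≢0 x≢y (trans (difference-at (start f) (dir f) a b) h)))

indicator-× : {X Y : Set} (d : Dec X) (e : Dec Y) → indicator d * indicator e ≡ indicator (d ×-dec e)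
indicator-× (yes _) (yes _) = refl
indicator-× (yes _) (no _) = refl
indicator-× (no _) e = refl

-- Cuts by affine functions and the four cells of two cuts

record Cut : Set where
  constructor cut
  field
    coeff₁ coeff₂ offset : ℤ
    nondegenerate : ¬ (coeff₁ ≡ 0ℤ × coeff₂ ≡ 0ℤ)

open Cut

eval : Cut → Pt → ℤ
eval φ (x₁ , x₂) = coeff₁ φ ℤ.* x₁ ℤ.+ coeff₂ φ ℤ.* x₂ ℤ.+ offset φ

slope : Cut → Pt → ℤ
slope φ (v₁ , v₂) = coeff₁ φ ℤ.* v₁ ℤ.+ coeff₂ φ ℤ.* v₂

eval-at : ∀ φ c v z → eval φ (at c v z) ≡ eval φ c ℤ.+ z ℤ.* slope φ v
eval-at φ (c₁ , c₂) (v₁ , v₂) z = lemma (coeff₁ φ) (coeff₂ φ) (offset φ) c₁ c₂ v₁ v₂ z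
  where
  lemma : ∀ α β γ c₁ c₂ v₁ v₂ z → α ℤ.* (c₁ ℤ.+ z ℤ.* v₁) ℤ.+ β ℤ.* (c₂ ℤ.+ z ℤ.* v₂) ℤ.+ γ
            ≡ α ℤ.* c₁ ℤ.+ β ℤ.* c₂ ℤ.+ γ ℤ.+ z ℤ.* (α ℤ.* v₁ ℤ.+ β ℤ.* v₂)
  lemma = ℤ-Ring.solve-∀

Within : Cut → Ray → Set
Within φ f = eval φ (start f) ≡ 0ℤ × slope φ (dir f) ≡ 0ℤ

within? : ∀ φ f → Dec (Within φ f)
within? φ f = (eval φ (start f) ℤ.≟ 0ℤ) ×-dec (slope φ (dir f) ℤ.≟ 0ℤ)

two-zeros⇒within : ∀ φ f {x y} → x ≢ y → x ∈ points f → y ∈ points f → eval φ x ≡ 0ℤ → eval φ y ≡ 0ℤ → Within φ f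
two-zeros⇒within φ f {x} {y} x≢y xf yf ex ey with points-at f xf | points-at f yf
... | a , refl | b , refl = start-zero , slope-zero
  where
  c = eval φ (start f)
  k = slope φ (dir f)
  ea : c ℤ.+ a ℤ.* k ≡ 0ℤ
  ea = trans (sym (eval-at φ (start f) (dir f) a)) ex
  eb : c ℤ.+ b ℤ.* k ≡ 0ℤ
  eb = trans (sym (eval-at φ (start f) (dir f) b)) ey
  lemma : ∀ a b c k → (a ℤ.- b) ℤ.* k ≡ (c ℤ.+ a ℤ.* k) ℤ.- (c ℤ.+ b ℤ.* k)
  lemma = ℤ-Ring.solve-∀
  slope-zero : k ≡ 0ℤ
  slope-zero = [ (λ h → ⊥-elim (x≢y (cong (at (start f) (dir f)) (ℤₚ.i-j≡0⇒i≡j a b h)))) , (λ h → h) ]′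
    (ℤₚ.i*j≡0⇒i≡0∨j≡0 (a ℤ.- b) (trans (lemma a b c k) (cong₂ ℤ._-_ ea eb)))
  lemma′ : ∀ c a → c ≡ c ℤ.+ a ℤ.* 0ℤ
  lemma′ = ℤ-Ring.solve-∀
  start-zero : c ≡ 0ℤ
  start-zero = trans (lemma′ c a) (trans (cong (λ s → c ℤ.+ a ℤ.* s) (sym slope-zero)) ea)

-- The cross product of the two directions times either coefficient of `φ` is a combination of the
-- two slopes, hence zero, and one coefficient is nonzero.
within⇒same-direction : ∀ φ f g → Within φ f → Within φ g → dir f ≡ dir g
within⇒same-direction φ f g (_ , p) (_ , q) = parallel⇒≡ (isDirection f) (isDirection g) (par (dir f) (dir g) p q)
  where
  α = coeff₁ φ
  β = coeff₂ φ
  lemma₁ : ∀ α β v₁ v₂ w₁ w₂ → α ℤ.* (v₁ ℤ.* w₂ ℤ.- v₂ ℤ.* w₁) ≡ (α ℤ.* v₁ ℤ.+ β ℤ.* v₂) ℤ.* w₂ ℤ.-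
      (α ℤ.* w₁ ℤ.+ β ℤ.* w₂) ℤ.* v₂
  lemma₁ = ℤ-Ring.solve-∀
  lemma₂ : ∀ α β v₁ v₂ w₁ w₂ → β ℤ.* (v₁ ℤ.* w₂ ℤ.- v₂ ℤ.* w₁) ≡ (α ℤ.* w₁ ℤ.+ β ℤ.* w₂) ℤ.* v₁ ℤ.-
      (α ℤ.* v₁ ℤ.+ β ℤ.* v₂) ℤ.* w₁
  lemma₂ = ℤ-Ring.solve-∀
  par : ∀ v w → slope φ v ≡ 0ℤ → slope φ w ≡ 0ℤ → Parallel v w
  par (v₁ , v₂) (w₁ , w₂) p q =
    [ (λ a → [ (λ b → ⊥-elim (nondegenerate φ (a , b))) , ℤₚ.i-j≡0⇒i≡j _ _ ]′
      (ℤₚ.i*j≡0⇒i≡0∨j≡0 β (trans (lemma₂ α β v₁ v₂ w₁ w₂) (cong₂ (λ a b → a ℤ.* v₁ ℤ.- b ℤ.* w₁) q p))))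
    , ℤₚ.i-j≡0⇒i≡j _ _ ]′
      (ℤₚ.i*j≡0⇒i≡0∨j≡0 α (trans (lemma₁ α β v₁ v₂ w₁ w₂) (cong₂ (λ a b → a ℤ.* w₂ ℤ.- b ℤ.* v₂) p q)))

OnSide : Bool → ℤ → Set
OnSide true z = 0ℤ ℤ.< z
OnSide false z = z ℤ.< 0ℤ

onSide? : ∀ s z → Dec (OnSide s z)
onSide? true z = 0ℤ ℤ.<? z
onSide? false z = z ℤ.<? 0ℤ

Cell : Cut → Cut → Bool → Bool → Pt → Set
Cell φ ψ s t x = OnSide s (eval φ x) × OnSide t (eval ψ x)

cell? : ∀ φ ψ s t x → Dec (Cell φ ψ s t x)
cell? φ ψ s t x = onSide? s (eval φ x) ×-dec onSide? t (eval ψ x)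

opposite-signs : ∀ c k a b → 0ℤ ℤ.< c ℤ.+ a ℤ.* k → c ℤ.+ b ℤ.* k ℤ.< 0ℤ → 0ℤ ℤ.< (a ℤ.- b) ℤ.* k
opposite-signs c k a b p q = subst (0ℤ ℤ.<_) (lemma c k a b) (ℤₚ.+-mono-< p (ℤₚ.neg-mono-< q))
  where
  lemma : ∀ c k a b → c ℤ.+ a ℤ.* k ℤ.+ ℤ.- (c ℤ.+ b ℤ.* k) ≡ (a ℤ.- b) ℤ.* k
  lemma = ℤ-Ring.solve-∀

product-positive : ∀ {a b} → 0ℤ ℤ.< a → 0ℤ ℤ.< b → 0ℤ ℤ.< a ℤ.* b
product-positive {a} {b} p q = subst (ℤ._< a ℤ.* b) (ℤₚ.*-zeroˡ b) (ℤₚ.*-monoʳ-<-pos b {{ℤ.positive q}} p)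

-- Along the line `φ` and `ψ` are affine with slopes `k` and `l`. Points in all four cells would
-- make both `(b - c) k (a - d) l` and `(a - d) k (c - b) l` positive, but the sum of these products
-- is identically zero.
line-misses-a-cell : ∀ φ ψ f {a b c d} → a ∈ points f → b ∈ points f → c ∈ points f → d ∈ points f →
  Cell φ ψ true true a → Cell φ ψ true false b → Cell φ ψ false true c → ¬ Cell φ ψ false false d
line-misses-a-cell φ ψ f ia ib ic id (φa , ψa) (φb , ψb) (φc , ψc) (φd , ψd)
  with points-at f ia | points-at f ib | points-at f ic | points-at f id
... | a , refl | b , refl | c , refl | d , refl =
  ℤₚ.<-irrefl (sym (lemma a b c d k l))
    (ℤₚ.+-mono-< (product-positive (φ-gap b c φb φc) (ψ-gap a d ψa ψd)) (product-positive (φ-gap a d φa φd)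
        (ψ-gap c b ψc ψb)))
  where
  k = slope φ (dir f)
  l = slope ψ (dir f)
  φ-gap : ∀ x y → 0ℤ ℤ.< eval φ (at (start f) (dir f) x) → eval φ (at (start f) (dir f) y) ℤ.< 0ℤ → 0ℤ ℤ.<
      (x ℤ.- y) ℤ.* k
  φ-gap x y p q = opposite-signs (eval φ (start f)) k x y (subst (0ℤ ℤ.<_) (eval-at φ _ _ x) p)
      (subst (ℤ._< 0ℤ) (eval-at φ _ _ y) q)
  ψ-gap : ∀ x y → 0ℤ ℤ.< eval ψ (at (start f) (dir f) x) → eval ψ (at (start f) (dir f) y) ℤ.< 0ℤ → 0ℤ ℤ.<
      (x ℤ.- y) ℤ.* l
  ψ-gap x y p q = opposite-signs (eval ψ (start f)) l x y (subst (0ℤ ℤ.<_) (eval-at ψ _ _ x) p)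
      (subst (ℤ._< 0ℤ) (eval-at ψ _ _ y) q)
  lemma : ∀ a b c d k l → ((b ℤ.- c) ℤ.* k) ℤ.* ((a ℤ.- d) ℤ.* l) ℤ.+ ((a ℤ.- d) ℤ.* k) ℤ.* ((c ℤ.- b) ℤ.* l) ≡ 0ℤ
  lemma = ℤ-Ring.solve-∀

count-filter : {A : Set} {C L R : A → Set} (C? : Decidable C) (L? : Decidable L) (R? : Decidable R) (xs : List A) →
               (∀ x → C x → L x × R x) → count C? xs ≤ count R? (filter L? xs)
count-filter C? L? R? xs h = ≤-trans
  (∑-mono xs (λ x → ≤-trans (indicator-mono (C? x) (L? x ×-dec R? x) (h x))
      (≤-reflexive (sym (indicator-× (L? x) (R? x))))))
  (≤-reflexive (sym (∑-filter L? (indicator ∘ R?) xs)))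

-- `ham-sandwich` needs nonempty sets, but a median may leave nothing on one side. A dummy point
-- then stands in, and the bound for the empty set is trivial.
nonempty-substitute : {S : Pt → Set} (y : Pt) → S y → (xs : List Pt) → All S xs →
  ∃[ ys ] 0 < length ys × All S ys ×
    (∀ {P : Pt → Set} (P? : Decidable P) → 2 * count P? ys ≤ length ys → 2 * count P? xs ≤ length xs)
nonempty-substitute y Sy [] [] = y ∷ [] , s≤s z≤n , Sy ∷ [] , λ _ _ → z≤n
nonempty-substitute y Sy (x ∷ xs) Sxs = x ∷ xs , s≤s z≤n , Sxs , λ _ h → h

i-j<0⇒i<j : ∀ {i j} → i ℤ.- j ℤ.< 0ℤ → i ℤ.< j
i-j<0⇒i<j {i} {j} h = ℤₚ.≰⇒> (λ j≤i → ℤₚ.<⇒≱ h (ℤₚ.i≤j⇒0≤j-i j≤i))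

0<i-j⇒j<i : ∀ {i j} → 0ℤ ℤ.< i ℤ.- j → j ℤ.< i
0<i-j⇒j<i {i} {j} h = ℤₚ.≰⇒> (λ i≤j → ℤₚ.<⇒≱ h (ℤₚ.i≤j⇒i-j≤0 i≤j))

quarter-bound : {A : Set} {C L R : A → Set} (C? : Decidable C) (L? : Decidable L) (R? : Decidable R) (xs : List A) →
  (∀ x → C x → L x × R x) → 2 * count R? (filter L? xs) ≤ length (filter L? xs) → 2 * length
      (filter L? xs) ≤ length xs →
  4 * count C? xs ≤ length xs
quarter-bound C? L? R? xs h p q = ≤-trans (≤-reflexive (ℕₚ.*-assoc 2 2 (count C? xs)))
  (≤-trans (ℕₚ.*-monoʳ-≤ 2 (≤-trans (ℕₚ.*-monoʳ-≤ 2 (count-filter C? L? R? xs h)) p)) q)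

-- One cut is the vertical line through a median first coordinate, the other a line that halves both
-- sides of it. Points on a cut belong to no cell.
four-cells : (P : List Pt) → 0 < length P →
  ∃[ φ ] ∃[ ψ ] (∀ s t → 4 * count (cell? φ ψ s t) P ≤ length P)
four-cells P P≠∅ = vertical , tilted , bound
  where
  -- A vector of slope `x₁`, so that `select` finds a median of the first coordinates.
  κ : Pt → Pt
  κ (x₁ , _) = 1ℤ , x₁
  selected = select κ P (All.universal (λ _ → ℤ.+<+ (s≤s z≤n)) P) ⌊ length P /2⌋ (half< (length P) P≠∅)
  v = proj₁ (proj₁ selected)
  P-halved = ranked⇒halved κ P (proj₁ selected) (proj₂ (proj₂ selected))
  left? : Decidable (λ (x : Pt) → proj₁ x ℤ.< v)
  left? x = proj₁ x ℤ.<? v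
  right? : Decidable (λ (x : Pt) → v ℤ.< proj₁ x)
  right? x = v ℤ.<? proj₁ x
  L = filter left? P
  R = filter right? P
  L-half : 2 * length L ≤ length P
  L-half = ≤-trans (ℕₚ.*-monoʳ-≤ 2 (≤-trans (≤-reflexive (length-filter-≡ left? P))
    (count-mono left? (λ x → κ x ≺? κ (proj₁ selected)) P (λ {x} _ h → ℤₚ.*-monoʳ-<-pos 1ℤ h)))) (proj₁ P-halved)
  R-half : 2 * length R ≤ length P
  R-half = ≤-trans (ℕₚ.*-monoʳ-≤ 2 (≤-trans (≤-reflexive (length-filter-≡ right? P))
    (count-mono right? (λ x → κ (proj₁ selected) ≺? κ x) P (λ {x} _ h → ℤₚ.*-monoʳ-<-pos 1ℤ h)))) (proj₂ P-halved)
  L′ = nonempty-substitute {λ x → proj₁ x ℤ.< v} (ℤ.pred v , 0ℤ)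
      (ℤₚ.≤-<-trans ℤₚ.≤-refl (ℤₚ.i≤pred[j]⇒i<j ℤₚ.≤-refl)) L (Allₚ.all-filter left? P)
  R′ = nonempty-substitute {λ x → v ℤ.< proj₁ x} (ℤ.suc v , 0ℤ) (ℤₚ.suc[i]≤j⇒i<j ℤₚ.≤-refl) R
      (Allₚ.all-filter right? P)
  ham = ham-sandwich v (proj₁ L′) (proj₁ R′) (proj₁ (proj₂ L′)) (proj₁ (proj₂ R′)) (proj₁ (proj₂ (proj₂ L′)))
      (proj₁ (proj₂ (proj₂ R′)))
  o = proj₁ ham
  d = proj₁ (proj₂ ham)
  o₁ = proj₁ o
  o₂ = proj₂ o
  d₁ = proj₁ d
  d₂ = proj₂ d
  d-right : Rightward d
  d-right = proj₁ (proj₂ (proj₂ ham))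
  L-halves = proj₁ (proj₂ (proj₂ (proj₂ ham)))
  R-halves = proj₂ (proj₂ (proj₂ (proj₂ ham)))
  vertical : Cut
  vertical = cut 1ℤ 0ℤ (ℤ.- v) (λ { (() , _) })
  tilted : Cut
  tilted = cut (ℤ.- d₂) d₁ (d₂ ℤ.* o₁ ℤ.- o₂ ℤ.* d₁) (λ { (_ , h) → ℤₚ.<-irrefl (sym h) d-right })
  eval-vertical : ∀ x → eval vertical x ≡ proj₁ x ℤ.- v
  eval-vertical (x₁ , x₂) = lemma x₁ x₂ v
    where
    lemma : ∀ x y v → 1ℤ ℤ.* x ℤ.+ 0ℤ ℤ.* y ℤ.+ ℤ.- v ≡ x ℤ.- v
    lemma = ℤ-Ring.solve-∀
  eval-tilted : ∀ x → eval tilted x ≡ (proj₂ x ℤ.- o₂) ℤ.* d₁ ℤ.- d₂ ℤ.* (proj₁ x ℤ.- o₁)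
  eval-tilted (x₁ , x₂) = lemma x₁ x₂ o₁ o₂ d₁ d₂
    where
    lemma : ∀ x y o p d e → ℤ.- e ℤ.* x ℤ.+ d ℤ.* y ℤ.+ (e ℤ.* o ℤ.- p ℤ.* d) ≡ (y ℤ.- p) ℤ.* d ℤ.- e ℤ.* (x ℤ.- o)
    lemma = ℤ-Ring.solve-∀
  is-left : ∀ x → eval vertical x ℤ.< 0ℤ → proj₁ x ℤ.< v
  is-left x h = i-j<0⇒i<j (subst (ℤ._< 0ℤ) (eval-vertical x) h)
  is-right : ∀ x → 0ℤ ℤ.< eval vertical x → v ℤ.< proj₁ x
  is-right x h = 0<i-j⇒j<i (subst (0ℤ ℤ.<_) (eval-vertical x) h)
  is-below : ∀ x → eval tilted x ℤ.< 0ℤ → x ⊝ o ≺ d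
  is-below x h = i-j<0⇒i<j (subst (ℤ._< 0ℤ) (eval-tilted x) h)
  is-above : ∀ x → 0ℤ ℤ.< eval tilted x → d ≺ x ⊝ o
  is-above x h = 0<i-j⇒j<i (subst (0ℤ ℤ.<_) (eval-tilted x) h)
  below? = λ x → x ⊝ o ≺? d
  above? = λ x → d ≺? x ⊝ o
  bound : ∀ s t → 4 * count (cell? vertical tilted s t) P ≤ length P
  bound false false = quarter-bound (cell? vertical tilted false false) left? below? P
      (λ x (p , q) → is-left x p , is-below x q)
    (proj₂ (proj₂ (proj₂ L′)) below? (proj₁ L-halves)) L-half
  bound false true = quarter-bound (cell? vertical tilted false true) left? above? P
      (λ x (p , q) → is-left x p , is-above x q)
    (proj₂ (proj₂ (proj₂ L′)) above? (proj₂ L-halves)) L-half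
  bound true false = quarter-bound (cell? vertical tilted true false) right? below? P
      (λ x (p , q) → is-right x p , is-below x q)
    (proj₂ (proj₂ (proj₂ R′)) below? (proj₁ R-halves)) R-half
  bound true true = quarter-bound (cell? vertical tilted true true) right? above? P
      (λ x (p , q) → is-right x p , is-above x q)
    (proj₂ (proj₂ (proj₂ R′)) above? (proj₂ R-halves)) R-half

-- Rich rays

square : ℕ → ℕ
square k = k * k

square-mono : ∀ {a b} → a ≤ b → square a ≤ square b
square-mono h = *-mono-≤ h h

2ab≤a²+b² : ∀ a b → 2 * (a * b) ≤ square a + square b
2ab≤a²+b² a b with ℕₚ.≤-total a b
... | inj₁ h = subst (λ b → 2 * (a * b) ≤ square a + square b) (ℕₚ.m+[n∸m]≡n h)
                 (≤-trans (m≤m+n _ (square (b ∸ a))) (≤-reflexive (lemma a (b ∸ a))))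
  where
  lemma : ∀ a k → 2 * (a * (a + k)) + k * k ≡ a * a + (a + k) * (a + k)
  lemma = ℕ-Ring.solve-∀
... | inj₂ h = subst (λ a → 2 * (a * b) ≤ square a + square b) (ℕₚ.m+[n∸m]≡n h)
                 (≤-trans (m≤m+n _ (square (a ∸ b))) (≤-reflexive (lemma b (a ∸ b))))
  where
  lemma : ∀ b k → 2 * ((b + k) * b) + k * k ≡ (b + k) * (b + k) + b * b
  lemma = ℕ-Ring.solve-∀

square-of-three : ∀ a b c → square (a + b + c) ≤ 3 * (square a + square b + square c)
square-of-three a b c = begin
  square (a + b + c)
    ≡⟨ expand a b c ⟩
  square a + square b + square c + (2 * (a * b) + 2 * (a * c) + 2 * (b * c))
    ≤⟨ ℕₚ.+-monoʳ-≤ (square a + square b + square c) (+-mono-≤ (+-mono-≤ (2ab≤a²+b² a b) (2ab≤a²+b² a c))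
        (2ab≤a²+b² b c)) ⟩
  square a + square b + square c + (square a + square b + (square a + square c) + (square b + square c))
    ≡⟨ collect (square a) (square b) (square c) ⟩
  3 * (square a + square b + square c) ∎
  where
  open ℕₚ.≤-Reasoning
  expand : ∀ a b c → (a + b + c) * (a + b + c) ≡ a * a + b * b + c * c + (2 * (a * b) + 2 * (a * c) + 2 * (b * c))
  expand = ℕ-Ring.solve-∀
  collect : ∀ x y z → x + y + z + (x + y + (x + z) + (y + z)) ≡ 3 * (x + y + z)
  collect = ℕ-Ring.solve-∀

-- `3 * e + 2` pays for a loss of `e` in each of three cells and for one point on each of the two
-- cuts.
truncated-three : ∀ e h a b c → h ≤ a + b + c + 2 →
  square (h ∸ (3 * e + 2)) ≤ 3 * (square (a ∸ e) + square (b ∸ e) + square (c ∸ e))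
truncated-three e h a b c le = ≤-trans (square-mono bound) (square-of-three (a ∸ e) (b ∸ e) (c ∸ e))
  where
  open ℕₚ.≤-Reasoning
  collect : ∀ e a b c → e + a + (e + b) + (e + c) + 2 ≡ 3 * e + 2 + (a + b + c)
  collect = ℕ-Ring.solve-∀
  bound : h ∸ (3 * e + 2) ≤ (a ∸ e) + (b ∸ e) + (c ∸ e)
  bound = ℕₚ.m≤n+o⇒m∸n≤o h (3 * e + 2) (begin
    h ≤⟨ le ⟩
    a + b + c + 2 ≤⟨ ℕₚ.+-monoˡ-≤ 2 (+-mono-≤ (+-mono-≤ (ℕₚ.m≤n+m∸n a e) (ℕₚ.m≤n+m∸n b e)) (ℕₚ.m≤n+m∸n c e)) ⟩
    (e + (a ∸ e)) + (e + (b ∸ e)) + (e + (c ∸ e)) + 2 ≡⟨ collect e (a ∸ e) (b ∸ e) (c ∸ e) ⟩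
    3 * e + 2 + ((a ∸ e) + (b ∸ e) + (c ∸ e)) ∎)

-- Since one cell is missed, the Cauchy-Schwarz inequality is applied to three terms and costs a
-- factor `3` instead of `4`. This is the entire gain of the recursion.
truncated-four : ∀ e h a b c d → a ≡ 0 ⊎ b ≡ 0 ⊎ c ≡ 0 ⊎ d ≡ 0 → h ≤ (a + (b + (c + (d + 0)))) + 2 →
  square (h ∸ (3 * e + 2)) ≤ 3 * (square (a ∸ e) + (square (b ∸ e) + (square (c ∸ e) + (square (d ∸ e) + 0))))
truncated-four e h a b c d zero-one le = go zero-one
  where
  sq = λ x → square (x ∸ e)
  T = sq a + (sq b + (sq c + (sq d + 0)))
  close : ∀ x y z → h ≤ x + y + z + 2 → sq x + sq y + sq z ≤ T → square (h ∸ (3 * e + 2)) ≤ 3 * T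
  close x y z p q = ≤-trans (truncated-three e h x y z p) (ℕₚ.*-monoʳ-≤ 3 q)
  abc : ∀ a b c d → a + (b + (c + (d + 0))) ≡ a + b + c + d
  abc = ℕ-Ring.solve-∀
  bcd : ∀ a b c d → a + (b + (c + (d + 0))) ≡ b + c + d + a
  bcd = ℕ-Ring.solve-∀
  acd : ∀ a b c d → a + (b + (c + (d + 0))) ≡ a + c + d + b
  acd = ℕ-Ring.solve-∀
  abd : ∀ a b c d → a + (b + (c + (d + 0))) ≡ a + b + d + c
  abd = ℕ-Ring.solve-∀
  drop : ∀ {s t u} → s ≡ t + u → u ≡ 0 → s ≡ t
  drop {t = t} p refl = trans p (ℕₚ.+-identityʳ t)
  keep : ∀ {s t u} → s ≡ t + u → t ≤ s
  keep {t = t} {u} p = ≤-trans (m≤m+n t u) (≤-reflexive (sym p))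
  go : a ≡ 0 ⊎ b ≡ 0 ⊎ c ≡ 0 ⊎ d ≡ 0 → square (h ∸ (3 * e + 2)) ≤ 3 * T
  go (inj₁ z) = close b c d (subst (λ s → h ≤ s + 2) (drop (bcd a b c d) z) le)
      (keep (bcd (sq a) (sq b) (sq c) (sq d)))
  go (inj₂ (inj₁ z)) = close a c d (subst (λ s → h ≤ s + 2) (drop (acd a b c d) z) le)
      (keep (acd (sq a) (sq b) (sq c) (sq d)))
  go (inj₂ (inj₂ (inj₁ z))) = close a b d (subst (λ s → h ≤ s + 2) (drop (abd a b c d) z) le)
      (keep (abd (sq a) (sq b) (sq c) (sq d)))
  go (inj₂ (inj₂ (inj₂ z))) = close a b c (subst (λ s → h ≤ s + 2) (drop (abc a b c d) z) le)
      (keep (abc (sq a) (sq b) (sq c) (sq d)))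

∑-member : {A : Set} (f : A → ℕ) {x : A} {xs : List A} → x ∈ xs → f x ≤ ∑ f xs
∑-member f {xs = y ∷ ys} (here refl) = m≤m+n (f y) _
∑-member f {xs = y ∷ ys} (there i) = ≤-trans (∑-member f i) (m≤n+m _ (f y))

signs : List (Bool × Bool)
signs = (true , true) ∷ (true , false) ∷ (false , true) ∷ (false , false) ∷ []

∈-signs : ∀ s t → (s , t) ∈ signs
∈-signs true true = here refl
∈-signs true false = there (here refl)
∈-signs false true = there (there (here refl))
∈-signs false false = there (there (there (here refl)))

cellOf : Cut → Cut → List Pt → Bool × Bool → List Pt
cellOf φ ψ P (s , t) = filter (cell? φ ψ s t) P

indicator-yes : {X : Set} (d : Dec X) → X → indicator d ≡ 1
indicator-yes (yes _) _ = refl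
indicator-yes (no ¬x) x = ⊥-elim (¬x x)

onCut : Cut → Ray → Pt → ℕ
onCut φ f x = indicator ((x ∈? points f) ×-dec (eval φ x ℤ.≟ 0ℤ))

zero-or-side : ∀ z → z ≡ 0ℤ ⊎ (∃[ s ] OnSide s z)
zero-or-side z with z ℤ.≟ 0ℤ
... | yes h = inj₁ h
... | no h with 0ℤ ℤ.<? z
...   | yes p = inj₂ (true , p)
...   | no ¬p = inj₂ (false , ℤₚ.≤∧≢⇒< (ℤₚ.≮⇒≥ ¬p) h)

hit-split : ∀ φ ψ f x →
  hit x f ≤ ∑ (λ q → indicator (cell? φ ψ (proj₁ q) (proj₂ q) x) * hit x f) signs + (onCut φ f x + onCut ψ f x)
hit-split φ ψ f x = go (x ∈? points f) refl (zero-or-side (eval φ x)) (zero-or-side (eval ψ x))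
  where
  part = λ (q : Bool × Bool) → indicator (cell? φ ψ (proj₁ q) (proj₂ q) x) * hit x f
  go : (d : Dec (x ∈ points f)) → hit x f ≡ indicator d → eval φ x ≡ 0ℤ ⊎ (∃[ s ] OnSide s (eval φ x)) →
       eval ψ x ≡ 0ℤ ⊎ (∃[ t ] OnSide t (eval ψ x)) → hit x f ≤ ∑ part signs + (onCut φ f x + onCut ψ f x)
  go (no _) eq _ _ = ≤-trans (≤-reflexive eq) z≤n
  go (yes i) eq (inj₁ z) _ = ≤-trans (≤-reflexive (trans eq
      (sym (indicator-yes ((x ∈? points f) ×-dec (eval φ x ℤ.≟ 0ℤ)) (i , z)))))
    (≤-trans (m≤m+n (onCut φ f x) (onCut ψ f x)) (m≤n+m _ (∑ part signs)))
  go (yes i) eq (inj₂ _) (inj₁ z) = ≤-trans (≤-reflexive (trans eq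
      (sym (indicator-yes ((x ∈? points f) ×-dec (eval ψ x ℤ.≟ 0ℤ)) (i , z)))))
    (≤-trans (m≤n+m (onCut ψ f x) (onCut φ f x)) (m≤n+m _ (∑ part signs)))
  go (yes i) eq (inj₂ (s , p)) (inj₂ (t , q)) = ≤-trans (≤-reflexive (sym whole))
    (≤-trans (∑-member part (∈-signs s t)) (m≤m+n (∑ part signs) _))
    where
    whole : part (s , t) ≡ hit x f
    whole = trans (cong (_* hit x f) (indicator-yes (cell? φ ψ s t x) (p , q))) (ℕₚ.*-identityˡ (hit x f))

hits-split : ∀ φ ψ f P →
  hits P f ≤ ∑ (λ q → hits (cellOf φ ψ P q) f) signs + (∑ (onCut φ f) P + ∑ (onCut ψ f) P)
hits-split φ ψ f P = begin
  hits P f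
    ≤⟨ ∑-mono P (hit-split φ ψ f) ⟩
  ∑ (λ x → ∑ (part x) signs + (onCut φ f x + onCut ψ f x)) P
    ≡⟨ ∑-+ (λ x → ∑ (part x) signs) (λ x → onCut φ f x + onCut ψ f x) P ⟩
  ∑ (λ x → ∑ (part x) signs) P + ∑ (λ x → onCut φ f x + onCut ψ f x) P
    ≡⟨ cong₂ _+_ (∑-swap part P signs) (∑-+ (onCut φ f) (onCut ψ f) P) ⟩
  ∑ (λ q → ∑ (λ x → part x q) P) signs + (∑ (onCut φ f) P + ∑ (onCut ψ f) P)
    ≡⟨ cong (_+ (∑ (onCut φ f) P + ∑ (onCut ψ f) P)) (∑-cong signs
        (λ q → sym (∑-filter (cell? φ ψ (proj₁ q) (proj₂ q)) (λ x → hit x f) P))) ⟩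
  ∑ (λ q → hits (cellOf φ ψ P q) f) signs + (∑ (onCut φ f) P + ∑ (onCut ψ f) P) ∎
  where
  open ℕₚ.≤-Reasoning
  part : Pt → Bool × Bool → ℕ
  part x q = indicator (cell? φ ψ (proj₁ q) (proj₂ q) x) * hit x f

onCut-≤1 : ∀ φ f {P} → Unique P → ¬ Within φ f → ∑ (onCut φ f) P ≤ 1
onCut-≤1 φ f uniq ¬w = count-≤1 (λ x → (x ∈? points f) ×-dec (eval φ x ℤ.≟ 0ℤ))
  (AllPairs.map (λ x≢y (i , p) (j , q) → ¬w (two-zeros⇒within φ f x≢y i j p q)) uniq)

some-cell-missed : ∀ φ ψ f P → let h = λ q → hits (cellOf φ ψ P q) f in
  h (true , true) ≡ 0 ⊎ h (true , false) ≡ 0 ⊎ h (false , true) ≡ 0 ⊎ h (false , false) ≡ 0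
some-cell-missed φ ψ f P
  with hits (cellOf φ ψ P (true , true)) f ℕₚ.≟ 0 | hits (cellOf φ ψ P (true , false)) f ℕₚ.≟ 0
     | hits (cellOf φ ψ P (false , true)) f ℕₚ.≟ 0 | hits (cellOf φ ψ P (false , false)) f ℕₚ.≟ 0
... | yes z | _ | _ | _ = inj₁ z
... | no _ | yes z | _ | _ = inj₂ (inj₁ z)
... | no _ | no _ | yes z | _ = inj₂ (inj₂ (inj₁ z))
... | no _ | no _ | no _ | yes z = inj₂ (inj₂ (inj₂ z))
... | no a | no b | no c | no d =
  let _ , ia , ca = witness true true a ; _ , ib , cb = witness true false b
      _ , ic , cc = witness false true c ; _ , id , cd = witness false false d
  in ⊥-elim (line-misses-a-cell φ ψ f ia ib ic id ca cb cc cd)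
  where
  witness : ∀ s t → hits (cellOf φ ψ P (s , t)) f ≢ 0 → ∃[ x ] x ∈ points f × Cell φ ψ s t x
  witness s t h = let x , i , p = count-some (_∈? points f) (cellOf φ ψ P (s , t)) (ℕₚ.n≢0⇒n>0 h)
                  in x , p , proj₂ (∈-filter⁻ (cell? φ ψ s t) {xs = P} i)

inside : Cut → List Pt → Ray → ℕ
inside φ P f = indicator (within? φ f) * hits P f

-- A ray that lies inside neither cut meets each of them at most once and misses a cell. For a ray
-- inside a cut nothing is gained, and the crude bound `h² ≤ K h` is charged to `inside`.
split-bound : ∀ φ ψ f {P} e K → Unique P → hits P f ≤ K →
  square (hits P f ∸ (3 * e + 2)) ≤
    3 * ∑ (λ q → square (hits (cellOf φ ψ P q) f ∸ e)) signs + K * (inside φ P f + inside ψ P f)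
split-bound φ ψ f {P} e K uniq h≤K = go (within? φ f) (within? ψ f)
  where
  h = hits P f
  S = 3 * ∑ (λ q → square (hits (cellOf φ ψ P q) f ∸ e)) signs
  crude : square (h ∸ (3 * e + 2)) ≤ K * h
  crude = *-mono-≤ (≤-trans (ℕₚ.m∸n≤m h (3 * e + 2)) h≤K) (ℕₚ.m∸n≤m h (3 * e + 2))
  full : ∀ χ → Within χ f → inside χ P f ≡ h
  full χ w = trans (cong (_* h) (indicator-yes (within? χ f) w)) (ℕₚ.*-identityˡ h)
  exceptional : h ≤ inside φ P f + inside ψ P f → square (h ∸ (3 * e + 2)) ≤ S + K * (inside φ P f + inside ψ P f)
  exceptional le = ≤-trans crude (≤-trans (ℕₚ.*-monoʳ-≤ K le) (m≤n+m _ S))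
  go : Dec (Within φ f) → Dec (Within ψ f) → square (h ∸ (3 * e + 2)) ≤ S + K * (inside φ P f + inside ψ P f)
  go (yes w) _ = exceptional (≤-trans (≤-reflexive (sym (full φ w))) (m≤m+n (inside φ P f) (inside ψ P f)))
  go (no _) (yes w) = exceptional (≤-trans (≤-reflexive (sym (full ψ w))) (m≤n+m (inside ψ P f) (inside φ P f)))
  go (no ¬w) (no ¬w′) = ≤-trans
    (truncated-four e h _ _ _ _ (some-cell-missed φ ψ f P)
      (≤-trans (hits-split φ ψ f P) (ℕₚ.+-monoʳ-≤ (∑ (λ q → hits (cellOf φ ψ P q) f) signs)
          (+-mono-≤ (onCut-≤1 φ f uniq ¬w) (onCut-≤1 ψ f uniq ¬w′)))))
    (m≤m+n S _)

-- Rays inside one cut are parallel, hence disjoint by separation, so each point of `P` is counted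
-- at most once.
∑-inside-≤ : ∀ φ P {Fs} → AllPairs Separate Fs → ∑ (inside φ P) Fs ≤ length P
∑-inside-≤ φ P {Fs} sep = begin
  ∑ (inside φ P) Fs
    ≡⟨ ∑-cong Fs (λ f → sym (∑-* (indicator (within? φ f)) (λ x → hit x f) P)) ⟩
  ∑ (λ f → ∑ (λ x → indicator (within? φ f) * hit x f) P) Fs
    ≡⟨ ∑-swap (λ f x → indicator (within? φ f) * hit x f) Fs P ⟩
  ∑ (λ x → ∑ (λ f → indicator (within? φ f) * hit x f) Fs) P
    ≡⟨ ∑-cong P (λ x → ∑-cong Fs (λ f → indicator-× (within? φ f) (x ∈? points f))) ⟩
  ∑ (λ x → count (λ f → within? φ f ×-dec (x ∈? points f)) Fs) P
    ≤⟨ ∑-const-≤ P (All.universal (λ x → count-≤1 (λ f → within? φ f ×-dec (x ∈? points f))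
         (AllPairs.map (λ {f} {g} s (w , i) (w′ , j) → s (within⇒same-direction φ f g w w′) i j) sep)) P) ⟩
  length P * 1
    ≡⟨ ℕₚ.*-identityʳ (length P) ⟩
  length P ∎
  where open ℕₚ.≤-Reasoning

square-pred-≤ : ∀ h → square (h ∸ 1) ≤ 2 * choose2 h
square-pred-≤ zero = z≤n
square-pred-≤ (suc k) = begin
  k * k ≡⟨ sym (double-choose2 k) ⟩
  2 * choose2 k + k ≤⟨ ℕₚ.+-monoʳ-≤ (2 * choose2 k) (m≤m+n k k) ⟩
  2 * choose2 k + (k + k) ≡⟨ lemma k (choose2 k) ⟩
  2 * (k + choose2 k) ∎
  where
  open ℕₚ.≤-Reasoning
  lemma : ∀ k c → 2 * c + (k + k) ≡ 2 * (k + c)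
  lemma = ℕ-Ring.solve-∀

share-≤1 : ∀ {x y} {Fs} → AllPairs Separate Fs → x ≢ y → ∑ (λ f → hit x f * hit y f) Fs ≤ 1
share-≤1 {x} {y} {Fs} sep x≢y = ≤-trans
  (≤-reflexive (∑-cong Fs (λ f → indicator-× (x ∈? points f) (y ∈? points f))))
  (count-≤1 (λ f → (x ∈? points f) ×-dec (y ∈? points f))
    (AllPairs.map (λ {f} {g} s (i , j) (i′ , j′) → s (share-two⇒same-direction f g x≢y i j i′ j′) i i′) sep))

∑-pairs-≤ : ∀ {P Fs} → Unique P → AllPairs Separate Fs → ∑ (λ f → choose2 (hits P f)) Fs ≤ choose2 (length P)
∑-pairs-≤ {P} {Fs} uniq sep = common-neighbours hit (λ x f → indicator-≤1 (x ∈? points f)) P Fs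
  (AllPairs.map (share-≤1 sep) uniq)

-- The initial `1` comes from `(h - 1)² ≤ 2 * choose2 h`, which turns pairs into squares; the
-- recursion is that of `truncated-four`.
loss : ℕ → ℕ
loss zero = 1
loss (suc d) = 3 * loss d + 2

-- `12` is the factor `4` of a new level times the `3` of Cauchy-Schwarz, and `8 * 4 ^ d` pays for
-- the rays inside the two new cuts.
defect : ℕ → ℕ
defect zero = 0
defect (suc d) = 12 * defect d + 8 * 4 ^ d

-- The outer factor `4` clears the denominator in `c ≤ N / 4`; it cancels in `average-of-four`,
-- where four such bounds are added.
cell-contribution : ∀ t D K N c X → 4 * c ≤ N → X ≤ t * square c + D * (K * c) →
  4 * (12 * X) ≤ 3 * t * square N + 12 * D * (K * N)
cell-contribution t D K N c X c≤ X≤ = begin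
  4 * (12 * X)
    ≤⟨ ℕₚ.*-monoʳ-≤ 4 (ℕₚ.*-monoʳ-≤ 12 X≤) ⟩
  4 * (12 * (t * square c + D * (K * c)))
    ≡⟨ expand t c K D ⟩
  3 * t * square (4 * c) + 12 * D * (K * (4 * c))
    ≤⟨ +-mono-≤ (ℕₚ.*-monoʳ-≤ (3 * t) (square-mono c≤)) (ℕₚ.*-monoʳ-≤ (12 * D) (ℕₚ.*-monoʳ-≤ K c≤)) ⟩
  3 * t * square N + 12 * D * (K * N) ∎
  where
  open ℕₚ.≤-Reasoning
  expand : ∀ t c K D → 4 * (12 * (t * (c * c) + D * (K * c))) ≡ 3 * t * ((4 * c) * (4 * c)) + 12 * D * (K * (4 * c))
  expand = ℕ-Ring.solve-∀

average-of-four : ∀ L (S : Bool × Bool → ℕ) Z → (∀ q → 4 * (12 * (L * S q)) ≤ Z) → 12 * (L * ∑ S signs) ≤ Z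
average-of-four L S Z h = ℕₚ.*-cancelˡ-≤ 4 (begin
  4 * (12 * (L * ∑ S signs))
    ≡⟨ cong (λ X → 4 * (12 * X)) (sym (∑-* L S signs)) ⟩
  4 * (12 * ∑ (λ q → L * S q) signs)
    ≡⟨ cong (4 *_) (sym (∑-* 12 (λ q → L * S q) signs)) ⟩
  4 * ∑ (λ q → 12 * (L * S q)) signs
    ≡⟨ sym (∑-* 4 (λ q → 12 * (L * S q)) signs) ⟩
  ∑ (λ q → 4 * (12 * (L * S q))) signs
    ≤⟨ ∑-const-≤ signs (All.universal h signs) ⟩
  4 * Z ∎)
  where open ℕₚ.≤-Reasoning

-- Each cell holds a quarter of the points and each line meets three cells, so every level of the
-- recursion gains a factor 3/4 over the count of pairs.  Rays inside a cutting line are paid for by the defect.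
RichRays : ℕ → ℕ → List Ray → List Pt → Set
RichRays d K Fs P = Unique P → All (λ f → hits P f ≤ K) Fs →
  4 ^ d * ∑ (λ f → square (hits P f ∸ loss d)) Fs ≤ 3 ^ d * square (length P) + defect d * (K * length P)

rich-rays-step : ∀ d K {Fs} → AllPairs Separate Fs → (∀ {P} → RichRays d K Fs P) →
  ∀ {P} φ ψ → (∀ s t → 4 * count (cell? φ ψ s t) P ≤ length P) → RichRays (suc d) K Fs P
rich-rays-step d K {Fs} sep ih {P} φ ψ quarter uniq small = begin
  4 * L * ∑ (λ f → square (hits P f ∸ loss (suc d))) Fs
    ≤⟨ ℕₚ.*-monoʳ-≤ (4 * L) (∑-mono-∈ Fs (λ {f} i → split-bound φ ψ f (loss d) K uniq (All.lookup small i))) ⟩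
  4 * L * ∑ (λ f → 3 * ∑ (λ q → sq q f) signs + K * (inside φ P f + inside ψ P f)) Fs
    ≡⟨ cong (4 * L *_) (trans (∑-+ (λ f → 3 * ∑ (λ q → sq q f) signs) (λ f → K * (inside φ P f + inside ψ P f)) Fs)
         (cong₂ _+_ (trans (∑-* 3 (λ f → ∑ (λ q → sq q f) signs) Fs) (cong (3 *_) (∑-swap (λ f q → sq q f) Fs signs)))
                    (trans (∑-* K (λ f → inside φ P f + inside ψ P f) Fs)
                        (cong (K *_) (∑-+ (inside φ P) (inside ψ P) Fs))))) ⟩
  4 * L * (3 * ∑ (λ q → S q) signs + K * (∑ (inside φ P) Fs + ∑ (inside ψ P) Fs))
    ≤⟨ ℕₚ.*-monoʳ-≤ (4 * L) (ℕₚ.+-monoʳ-≤ (3 * ∑ S signs) (ℕₚ.*-monoʳ-≤ K (+-mono-≤ (∑-inside-≤ φ P sep)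
        (∑-inside-≤ ψ P sep)))) ⟩
  4 * L * (3 * ∑ S signs + K * (N + N))
    ≡⟨ regroup L (∑ S signs) K N ⟩
  12 * (L * ∑ S signs) + 8 * L * (K * N)
    ≤⟨ ℕₚ.+-monoˡ-≤ (8 * L * (K * N)) (average-of-four L S Z one-cell) ⟩
  (3 * 3 ^ d * square N + 12 * defect d * (K * N)) + 8 * L * (K * N)
    ≡⟨ collect (3 * 3 ^ d * square N) (12 * defect d) (8 * L) (K * N) ⟩
  3 * 3 ^ d * square N + (12 * defect d + 8 * L) * (K * N) ∎
  where
  open ℕₚ.≤-Reasoning
  L = 4 ^ d
  N = length P
  sq : Bool × Bool → Ray → ℕ
  sq q f = square (hits (cellOf φ ψ P q) f ∸ loss d)
  S : Bool × Bool → ℕ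
  S q = ∑ (sq q) Fs
  regroup : ∀ L S K N → 4 * L * (3 * S + K * (N + N)) ≡ 12 * (L * S) + 8 * L * (K * N)
  regroup = ℕ-Ring.solve-∀
  collect : ∀ a b c k → (a + b * k) + c * k ≡ a + (b + c) * k
  collect = ℕ-Ring.solve-∀
  Z = 3 * 3 ^ d * square N + 12 * defect d * (K * N)
  cell-length : ∀ q → 4 * length (cellOf φ ψ P q) ≤ N
  cell-length (s , t) = ≤-trans (≤-reflexive (cong (4 *_) (length-filter-≡ (cell? φ ψ s t) P))) (quarter s t)
  cell-hits : ∀ q f → hits (cellOf φ ψ P q) f ≤ hits P f
  cell-hits (s , t) f = ≤-trans (≤-reflexive (∑-filter (cell? φ ψ s t) (λ x → hit x f) P))
    (∑-mono P (λ x → ≤-trans (ℕₚ.*-monoˡ-≤ (hit x f) (indicator-≤1 (cell? φ ψ s t x)))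
        (≤-reflexive (ℕₚ.*-identityˡ (hit x f)))))
  one-cell : ∀ q → 4 * (12 * (L * S q)) ≤ Z
  one-cell q@(s , t) = cell-contribution (3 ^ d) (defect d) K N (length (cellOf φ ψ P q)) (L * S q) (cell-length q)
    (ih (AllPairsₚ.filter⁺ (cell? φ ψ s t) uniq) (All.map (λ {f} h → ≤-trans (cell-hits q f) h) small))

rich-rays : ∀ d K {Fs} → AllPairs Separate Fs → ∀ {P} → RichRays d K Fs P
rich-rays zero K {Fs} sep {P} uniq _ = begin
  ∑ (λ f → square (hits P f ∸ 1)) Fs + 0 ≡⟨ ℕₚ.+-identityʳ _ ⟩
  ∑ (λ f → square (hits P f ∸ 1)) Fs ≤⟨ ∑-mono Fs (λ f → square-pred-≤ (hits P f)) ⟩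
  ∑ (λ f → 2 * choose2 (hits P f)) Fs ≡⟨ ∑-* 2 (λ f → choose2 (hits P f)) Fs ⟩
  2 * ∑ (λ f → choose2 (hits P f)) Fs ≤⟨ ℕₚ.*-monoʳ-≤ 2 (∑-pairs-≤ uniq sep) ⟩
  2 * choose2 (length P) ≤⟨ m≤m+n _ (length P) ⟩
  2 * choose2 (length P) + length P ≡⟨ double-choose2 (length P) ⟩
  square (length P) ≡⟨ lemma (square (length P)) ⟩
  1 * square (length P) + 0 ∎
  where
  open ℕₚ.≤-Reasoning
  lemma : ∀ a → a ≡ 1 * a + 0
  lemma = ℕ-Ring.solve-∀
-- Without points there is no median to cut at, but then every term vanishes.
rich-rays (suc d) K {Fs} sep {[]} _ _ = ≤-trans (≤-reflexive (trans (cong (4 ^ suc d *_) zero-sum)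
    (ℕₚ.*-zeroʳ (4 ^ suc d)))) z≤n
  where
  zero-sum : ∑ (λ f → square (0 ∸ loss (suc d))) Fs ≡ 0
  zero-sum = trans (∑-cong Fs (λ f → cong square (ℕₚ.0∸n≡0 (loss (suc d))))) (∑-0 Fs)
rich-rays (suc d) K sep {P@(_ ∷ _)} =
  let φ , ψ , quarter = four-cells P (s≤s z≤n) in rich-rays-step d K sep (rich-rays d K sep) φ ψ quarter

-- A point on `k` rays is counted `k ≤ 1 + choose2 k` times, and each pair of rays is paid for at
-- most once, at its only common point.
few-rich-rays : ∀ {Q Fs m} → Unique Q → AllPairs Separate Fs → All (λ f → m ≤ hits Q f) Fs →
  length Fs * m ≤ length Q + choose2 (length Fs)
few-rich-rays {Q} {Fs} {m} uniq sep rich = begin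
  length Fs * m
    ≤⟨ ∑-const-≥ Fs rich ⟩
  ∑ (hits Q) Fs
    ≡⟨ ∑-swap (λ f x → hit x f) Fs Q ⟩
  ∑ (λ x → ∑ (hit x) Fs) Q
    ≤⟨ ∑-mono Q (λ x → n≤1+choose2 (∑ (hit x) Fs)) ⟩
  ∑ (λ x → 1 + choose2 (∑ (hit x) Fs)) Q
    ≡⟨ ∑-+ (λ _ → 1) (λ x → choose2 (∑ (hit x) Fs)) Q ⟩
  ∑ (λ _ → 1) Q + ∑ (λ x → choose2 (∑ (hit x) Fs)) Q
    ≤⟨ +-mono-≤ (≤-trans (∑-const-≤ Q (All.universal (λ _ → ≤-refl) Q)) (≤-reflexive (ℕₚ.*-identityʳ (length Q))))
                (common-neighbours (λ f x → hit x f) (λ f x → indicator-≤1 (x ∈? points f)) Fs Q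
                    (AllPairs.map (λ {f} {g} → meet {f} {g}) sep)) ⟩
  length Q + choose2 (length Fs) ∎
  where
  open ℕₚ.≤-Reasoning
  meet : ∀ {f g} → Separate f g → ∑ (λ x → hit x f * hit x g) Q ≤ 1
  meet {f} {g} s = ≤-trans (≤-reflexive (∑-cong Q (λ x → indicator-× (x ∈? points f) (x ∈? points g))))
    (count-≤1 (λ x → (x ∈? points f) ×-dec (x ∈? points g))
      (AllPairs.map (λ x≢y (i , i′) (j , j′) → s (share-two⇒same-direction f g x≢y i j i′ j′) i i′) uniq))

unique-⊆⇒length-≤ : {xs ys : List Pt} → Unique xs → (∀ {x} → x ∈ xs → x ∈ ys) → length xs ≤ length ys
unique-⊆⇒length-≤ {xs} {ys} uniq sub = begin
  length xs ≡⟨ sym (ℕₚ.*-identityʳ (length xs)) ⟩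
  length xs * 1 ≤⟨ ∑-const-≥ xs (All.tabulate (λ {x} i →
    subst (_≤ ∑ (λ y → indicator (x ≟ₚ y)) ys) (indicator-yes (x ≟ₚ x) refl) (∑-member (λ y → indicator (x ≟ₚ y))
        (sub i)))) ⟩
  ∑ (λ x → ∑ (λ y → indicator (x ≟ₚ y)) ys) xs ≡⟨ ∑-swap (λ x y → indicator (x ≟ₚ y)) xs ys ⟩
  ∑ (λ y → ∑ (λ x → indicator (x ≟ₚ y)) xs) ys
    ≤⟨ ∑-const-≤ ys (All.universal (λ y → count-≤1 (_≟ₚ y) (AllPairs.map
        (λ x≢z x≡y z≡y → x≢z (trans x≡y (sym z≡y))) uniq)) ys) ⟩
  length ys * 1 ≡⟨ ℕₚ.*-identityʳ (length ys) ⟩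
  length ys ∎
  where open ℕₚ.≤-Reasoning

-- The line through two lattice points

-- Euclid's algorithm, passing from `(a , b)` to `(b , a mod b)` and carrying a Bézout identity for
-- the reduced vector.
reduced : ∀ a b → ∃[ v ] ∃[ z ] Primitive v × (a , b) ≡ scale z v
reduced a b = go a b (<-wellFounded ℤ.∣ b ∣)
  where
  go : ∀ a b → Acc _<_ ℤ.∣ b ∣ → ∃[ v ] ∃[ z ] Primitive v × (a , b) ≡ scale z v
  go a b (acc rec) with b ℤ.≟ 0ℤ
  ... | yes refl = (1ℤ , 0ℤ) , a , (1ℤ , 0ℤ , refl) , cong₂ _,_ (sym (ℤₚ.*-identityʳ a)) (sym (ℤₚ.*-zeroʳ a))
  ... | no b≢0 = (k ℤ.* v₁ ℤ.+ v₂ , v₁) , z , (t , s ℤ.- t ℤ.* k , trans (bezout s t k v₁ v₂) bez)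
               , cong₂ _,_ (trans division (trans (cong₂ (λ r d → r ℤ.+ k ℤ.* d) (cong proj₂ eq) (cong proj₁ eq))
                   (collect k z v₁ v₂)))
                           (cong proj₁ eq)
    where
    instance
      b-nonZero = ℤ.≢-nonZero b≢0
    k = a ℤ-DivMod./ b
    r = a ℤ-DivMod.% b
    division : a ≡ ℤ.+ r ℤ.+ k ℤ.* b
    division = ℤ-DivMod.a≡a%n+[a/n]*n a b
    rest = go b (ℤ.+ r) (rec (ℤ-DivMod.n%d<d a b))
    v₁ = proj₁ (proj₁ rest)
    v₂ = proj₂ (proj₁ rest)
    z = proj₁ (proj₂ rest)
    s = proj₁ (proj₁ (proj₂ (proj₂ rest)))
    t = proj₁ (proj₂ (proj₁ (proj₂ (proj₂ rest))))
    bez = proj₂ (proj₂ (proj₁ (proj₂ (proj₂ rest))))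
    eq = proj₂ (proj₂ (proj₂ rest))
    bezout : ∀ s t k v w → t ℤ.* (k ℤ.* v ℤ.+ w) ℤ.+ (s ℤ.- t ℤ.* k) ℤ.* v ≡ s ℤ.* v ℤ.+ t ℤ.* w
    bezout = ℤ-Ring.solve-∀
    collect : ∀ k z v w → z ℤ.* w ℤ.+ k ℤ.* (z ℤ.* v) ≡ z ℤ.* (k ℤ.* v ℤ.+ w)
    collect = ℤ-Ring.solve-∀

neg : Pt → Pt
neg (v₁ , v₂) = ℤ.- v₁ , ℤ.- v₂

at-neg : ∀ c v z → at c (neg v) z ≡ at c v (ℤ.- z)
at-neg (c₁ , c₂) (v₁ , v₂) z = cong₂ _,_ (lemma c₁ v₁ z) (lemma c₂ v₂ z)
  where
  lemma : ∀ c v z → c ℤ.+ z ℤ.* (ℤ.- v) ≡ c ℤ.+ ℤ.- z ℤ.* v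
  lemma = ℤ-Ring.solve-∀

neg-primitive : ∀ {v} → Primitive v → Primitive (neg v)
neg-primitive {v₁ , v₂} (s , t , bez) = ℤ.- s , ℤ.- t , trans (lemma s t v₁ v₂) bez
  where
  lemma : ∀ s t v w → ℤ.- s ℤ.* ℤ.- v ℤ.+ ℤ.- t ℤ.* ℤ.- w ≡ s ℤ.* v ℤ.+ t ℤ.* w
  lemma = ℤ-Ring.solve-∀

scale-neg : ∀ z v → scale (ℤ.- z) (neg v) ≡ scale z v
scale-neg z (v₁ , v₂) = cong₂ _,_ (lemma z v₁) (lemma z v₂)
  where
  lemma : ∀ z v → ℤ.- z ℤ.* ℤ.- v ≡ z ℤ.* v
  lemma = ℤ-Ring.solve-∀

primitive-lexPositive : ∀ v → Primitive v → LexPositive v ⊎ LexPositive (neg v)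
primitive-lexPositive (v₁ , v₂) prim with 0ℤ ℤ.<? v₁ | v₁ ℤ.≟ 0ℤ | 0ℤ ℤ.<? v₂ | v₂ ℤ.≟ 0ℤ
... | yes p | _ | _ | _ = inj₁ (inj₁ p)
... | no ¬p | no q | _ | _ = inj₂ (inj₁ (ℤₚ.neg-mono-< (ℤₚ.≤∧≢⇒< (ℤₚ.≮⇒≥ ¬p) q)))
... | no _ | yes refl | yes p | _ = inj₁ (inj₂ (refl , p))
... | no _ | yes refl | no ¬p | no q = inj₂ (inj₂ (refl , ℤₚ.neg-mono-< (ℤₚ.≤∧≢⇒< (ℤₚ.≮⇒≥ ¬p) q)))
primitive-lexPositive _ (s , t , bez) | no _ | yes refl | no _ | yes refl =
  ⊥-elim (0≢1 (trans (sym (cong₂ ℤ._+_ (ℤₚ.*-zeroʳ s) (ℤₚ.*-zeroʳ t))) bez))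
  where
  0≢1 : 0ℤ ≢ 1ℤ
  0≢1 ()

at-⊝-scale : ∀ p q v z → q ⊝ p ≡ scale z v → q ≡ at p v z
at-⊝-scale (p₁ , p₂) (q₁ , q₂) (v₁ , v₂) z eq =
  cong₂ _,_ (trans (lemma p₁ q₁) (cong (λ d → p₁ ℤ.+ d) (cong proj₁ eq)))
      (trans (lemma p₂ q₂) (cong (λ d → p₂ ℤ.+ d) (cong proj₂ eq)))
  where
  lemma : ∀ p q → q ≡ p ℤ.+ (q ℤ.- p)
  lemma = ℤ-Ring.solve-∀

abstract
  -- For `q` equal to `p` the step count is zero and the direction carries no information; otherwise
  -- `line-through-unique` determines both.
  line-through : ∀ p q → ∃[ v ] Direction v × ∃[ z ] q ≡ at p v z
  line-through p q with reduced (proj₁ (q ⊝ p)) (proj₂ (q ⊝ p))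
  ... | v , z , prim , eq with primitive-lexPositive v prim
  ...   | inj₁ lex = v , (prim , lex) , z , at-⊝-scale p q v z eq
  ...   | inj₂ lex = neg v , (neg-primitive {v} prim , lex) , ℤ.- z , at-⊝-scale p q (neg v) (ℤ.- z)
      (trans eq (sym (scale-neg z v)))

line-through-unique : ∀ {p v w y z} → Direction v → Direction w → y ≢ 0ℤ → at p v y ≡ at p w z → v ≡ w × y ≡ z
line-through-unique {p} {v} {w} {y} {z} dv dw y≢0 eq = v≡w , y≡z v≡w
  where
  multiples : scale y v ≡ scale z w
  multiples = trans (sym (at-⊝ p v y)) (trans (cong (_⊝ p) eq) (at-⊝ p w z))
  zero-multiple : scale y v ≢ (0ℤ , 0ℤ)
  zero-multiple h = y≢0 (scale-injective v y 0ℤ (proj₁ dv) (trans h (cong₂ _,_ (sym (ℤₚ.*-zeroˡ (proj₁ v)))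
      (sym (ℤₚ.*-zeroˡ (proj₂ v))))))
  v≡w : v ≡ w
  v≡w = parallel⇒≡ dv dw (common-multiple⇒parallel y z multiples zero-multiple)
  y≡z : v ≡ w → y ≡ z
  y≡z refl = at-injective p v y z (proj₁ dv) eq

-- Threats

tally : List Pt → List Pt → ℕ
tally R M = count (_∈? R) M

∈-ray⁺ : ∀ c v {k n} → k < n → at c v (ℤ.+ suc k) ∈ rayPoints c v n
∈-ray⁺ c v = ∈-applyUpTo⁺ (λ i → at c v (ℤ.+ suc i))

∈-ray⁻ : ∀ c v {x n} → x ∈ rayPoints c v n → ∃[ k ] k < n × x ≡ at c v (ℤ.+ suc k)
∈-ray⁻ c v = ∈-applyUpTo⁻ (λ i → at c v (ℤ.+ suc i))

rayPoints-mono : ∀ c v {m n} → m ≤ n → ∀ {x} → x ∈ rayPoints c v m → x ∈ rayPoints c v n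
rayPoints-mono c v m≤n i with ∈-ray⁻ c v i
... | k , k<m , refl = ∈-ray⁺ c v (ℕₚ.<-≤-trans k<m m≤n)

rayPoints-unique : ∀ c v n → Primitive v → Unique (rayPoints c v n)
rayPoints-unique c v n prim = AllPairsₚ.applyUpTo⁺₁ (λ i → at c v (ℤ.+ suc i)) n
  (λ {i} {j} i<j _ eq → ℕₚ.<⇒≢ (s≤s i<j) (ℤₚ.+-injective (at-injective c v (ℤ.+ suc i) (ℤ.+ suc j) prim eq)))

tally-mono : ∀ {R R′} M → (∀ {x} → x ∈ M → x ∈ R → x ∈ R′) → tally R M ≤ tally R′ M
tally-mono {R} {R′} M h = count-mono (_∈? R) (_∈? R′) M h

-- The third condition leaves a point that neither player has claimed, so the stretch can still be
-- cut. Because of it threats are not monotone in `M`: filling a stretch ends the threat.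
IsThreat : ℕ → List Pt → List Pt → Pt → Pt → ℕ → ℕ → Set
IsThreat μ M B c v i j =
  c ∈ M
  × (All (_∉ B) (rayPoints c v j) × All (_∉ B) (rayPoints c (neg v) i))
  × (Any (_∉ M) (rayPoints c v j) ⊎ Any (_∉ M) (rayPoints c (neg v) i))
  × (μ ≤ tally (rayPoints c v j) M × μ ≤ tally (rayPoints c (neg v) i) M)

isThreat? : ∀ μ M B c v i j → Dec (IsThreat μ M B c v i j)
isThreat? μ M B c v i j =
  (c ∈? M)
  ×-dec (All.all? (λ x → ¬? (x ∈? B)) (rayPoints c v j) ×-dec All.all? (λ x → ¬? (x ∈? B)) (rayPoints c (neg v) i))
  ×-dec (any? (λ x → ¬? (x ∈? M)) (rayPoints c v j) ⊎-dec any? (λ x → ¬? (x ∈? M)) (rayPoints c (neg v) i))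
  ×-dec (μ ℕₚ.≤? tally (rayPoints c v j) M) ×-dec (μ ℕₚ.≤? tally (rayPoints c (neg v) i) M)

-- A stretch of a line, free of Breaker's points and not yet filled by Maker, with μ points of Maker on either side of its centre.
record Threat (μ : ℕ) (M B : List Pt) : Set where
  constructor threat
  field
    centre : Pt
    direction : Pt
    isDirection : Direction direction
    reach⁻ reach⁺ : ℕ
    isThreat : IsThreat μ M B centre direction reach⁻ reach⁺

last-hit : ∀ M c v j → 1 ≤ tally (rayPoints c v j) M →
  ∃[ k ] k < j × at c v (ℤ.+ suc k) ∈ M × (∀ l → k < l → l < j → at c v (ℤ.+ suc l) ∉ M)
last-hit M c v zero h = ⊥-elim (ℕₚ.<⇒≱ h (≤-reflexive (count-none (_∈? []) M (λ _ ()))))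
last-hit M c v (suc j) h with at c v (ℤ.+ suc j) ∈? M
... | yes i = j , ≤-refl , i , λ l j<l l<sj → ⊥-elim (ℕₚ.<⇒≱ j<l (ℕₚ.≤-pred l<sj))
... | no ¬i = let k , k<j , i , none = last-hit M c v j (≤-trans h (tally-mono M shrink))
              in k , ℕₚ.m<n⇒m<1+n k<j , i , λ l k<l l<sj → beyond none l k<l l<sj (l ℕₚ.≟ j)
  where
  beyond : ∀ {k} → (∀ l → k < l → l < j → at c v (ℤ.+ suc l) ∉ M) → ∀ l → k < l → l < suc j → Dec (l ≡ j) →
      at c v (ℤ.+ suc l) ∉ M
  beyond none l k<l l<sj (yes refl) = ¬i
  beyond none l k<l l<sj (no l≢j) = none l k<l (ℕₚ.≤∧≢⇒< (ℕₚ.≤-pred l<sj) l≢j)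
  shrink : ∀ {x} → x ∈ M → x ∈ rayPoints c v (suc j) → x ∈ rayPoints c v j
  shrink x∈M x∈ with ∈-ray⁻ c v x∈
  ... | k , k<sj , refl = ∈-ray⁺ c v (ℕₚ.≤∧≢⇒< (ℕₚ.≤-pred k<sj) (λ { refl → ¬i x∈M }))

-- A half-line may be cut one step after its last Maker point, which leaves finitely many stretches to examine.
trim : ∀ M c v j → 1 ≤ tally (rayPoints c v j) M →
  ∃[ k ] at c v (ℤ.+ suc k) ∈ M × ∃[ β ] β ∈ 0 ∷ 1 ∷ [] × β + suc k ≤ j
    × tally (rayPoints c v j) M ≤ tally (rayPoints c v (β + suc k)) M
    × (Any (_∉ M) (rayPoints c v j) → Any (_∉ M) (rayPoints c v (β + suc k)))
trim M c v j h with last-hit M c v j h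
... | k , k<j , k∈ , none = k , k∈ , rest (suc k ℕₚ.<? j)
  where
  Trimmed : ℕ → Set
  Trimmed β = β ∈ 0 ∷ 1 ∷ [] × β + suc k ≤ j
    × tally (rayPoints c v j) M ≤ tally (rayPoints c v (β + suc k)) M
    × (Any (_∉ M) (rayPoints c v j) → Any (_∉ M) (rayPoints c v (β + suc k)))
  keep : ∀ β {x} → x ∈ M → x ∈ rayPoints c v j → x ∈ rayPoints c v (β + suc k)
  keep β x∈M x∈ with ∈-ray⁻ c v x∈
  ... | l , l<j , refl = ∈-ray⁺ c v (ℕₚ.<-≤-trans (s≤s (ℕₚ.≮⇒≥ (λ k<l → none l k<l l<j x∈M))) (m≤n+m (suc k) β))
  rest : Dec (suc k < j) → ∃[ β ] Trimmed β
  rest (yes sk<j) = 1 , there (here refl) , sk<j , tally-mono M (keep 1)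
    , λ _ → lose (∈-ray⁺ c v ≤-refl) (none (suc k) ≤-refl sk<j)
  rest (no ¬sk<j) = 0 , here refl , k<j , tally-mono M (keep 0)
    , λ g → let x , x∈ , x∉ = find g in lose (rayPoints-mono c v (ℕₚ.≮⇒≥ ¬sk<j) x∈) x∉

extent : Pt → Pt → ℕ
extent c y = ℤ.∣ proj₁ (proj₂ (proj₂ (line-through c y))) ∣

directionTo : Pt → Pt → Pt
directionTo c y = proj₁ (line-through c y)

extent-at : ∀ c v z → Direction v → z ≢ 0ℤ → directionTo c (at c v z) ≡ v × extent c (at c v z) ≡ ℤ.∣ z ∣
extent-at c v z dv z≢0 =
  let w , dw , y , eq = line-through c (at c v z)
      v≡w , z≡y = line-through-unique {c} {v} {w} {z} {y} dv dw z≢0 eq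
  in sym v≡w , sym (cong ℤ.∣_∣ z≡y)

-- A trimmed threat is given by its centre, Maker's last points `y` and `x` on the two sides and two
-- bits for one further step on each side. The three points belong to `M`, so finitely many cases
-- remain.
Candidate : ℕ → List Pt → List Pt → Pt → Pt → Pt → Set
Candidate μ M B c y x =
  Any (λ α → Any (λ β → IsThreat μ M B c (directionTo c y) (α + extent c x) (β + extent c y)) (0 ∷ 1 ∷ []))
      (0 ∷ 1 ∷ [])

candidate? : ∀ μ M B c y x → Dec (Candidate μ M B c y x)
candidate? μ M B c y x = any? (λ α → any? (λ β → isThreat? μ M B c (directionTo c y) (α + extent c x)
    (β + extent c y)) (0 ∷ 1 ∷ [])) (0 ∷ 1 ∷ [])

-- For completeness both halves are trimmed: `1 ≤ μ` provides the last Maker points, from which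
-- `line-through` recovers the direction and the reaches.
search-threat : ∀ μ M B → 1 ≤ μ → Dec (Threat μ M B)
search-threat μ M B 1≤μ = map′ sound complete (any? (λ c → any? (λ y → any? (λ x → candidate? μ M B c y x) M) M) M)
  where
  sound : Any (λ c → Any (λ y → Any (λ x → Candidate μ M B c y x) M) M) M → Threat μ M B
  sound h =
    let c , _ , h₁ = find h ; y , _ , h₂ = find h₁ ; x , _ , h₃ = find h₂ ; _ , _ , h₄ = find h₃ ; _ , _ , is = find h₄
    in threat c (directionTo c y) (proj₁ (proj₂ (line-through c y))) _ _ is
  complete : Threat μ M B → Any (λ c → Any (λ y → Any (λ x → Candidate μ M B c y x) M) M) M
  complete (threat c v dv i j (c∈M , (free⁺ , free⁻) , gap , (many⁺ , many⁻))) =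
    lose c∈M (lose y∈M (lose x∈M (lose α∈ (lose β∈ is))))
    where
    trim⁺ = trim M c v j (≤-trans 1≤μ many⁺)
    trim⁻ = trim M c (neg v) i (≤-trans 1≤μ many⁻)
    k = proj₁ trim⁺
    l = proj₁ trim⁻
    y = at c v (ℤ.+ suc k)
    x = at c (neg v) (ℤ.+ suc l)
    y∈M = proj₁ (proj₂ trim⁺)
    x∈M = proj₁ (proj₂ trim⁻)
    β = proj₁ (proj₂ (proj₂ trim⁺))
    α = proj₁ (proj₂ (proj₂ trim⁻))
    β∈ = proj₁ (proj₂ (proj₂ (proj₂ trim⁺)))
    α∈ = proj₁ (proj₂ (proj₂ (proj₂ trim⁻)))
    rest⁺ = proj₂ (proj₂ (proj₂ (proj₂ trim⁺)))
    rest⁻ = proj₂ (proj₂ (proj₂ (proj₂ trim⁻)))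
    to-y : directionTo c y ≡ v × extent c y ≡ suc k
    to-y = extent-at c v (ℤ.+ suc k) dv (λ ())
    x-extent : extent c x ≡ suc l
    x-extent = trans (cong (extent c) (at-neg c v (ℤ.+ suc l))) (proj₂ (extent-at c v (ℤ.-[1+ l ]) dv (λ ())))
    restrict : ∀ {w m n} → m ≤ n → All (_∉ B) (rayPoints c w n) → All (_∉ B) (rayPoints c w m)
    restrict {w} m≤n free = All.tabulate (λ z∈ → All.lookup free (rayPoints-mono c w m≤n z∈))
    trimmed : IsThreat μ M B c v (α + suc l) (β + suc k)
    trimmed = c∈M , (restrict (proj₁ rest⁺) free⁺ , restrict (proj₁ rest⁻) free⁻)
            , [ inj₁ ∘ proj₂ (proj₂ rest⁺) , inj₂ ∘ proj₂ (proj₂ rest⁻) ]′ gap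
            , (≤-trans many⁺ (proj₁ (proj₂ rest⁺)) , ≤-trans many⁻ (proj₁ (proj₂ rest⁻)))
    is : IsThreat μ M B c (directionTo c y) (α + extent c x) (β + extent c y)
    is = subst (λ n → IsThreat μ M B c (directionTo c y) (α + n) (β + extent c y)) (sym x-extent)
        (subst (λ n → IsThreat μ M B c (directionTo c y) (α + suc l) (β + n)) (sym (proj₂ to-y))
        (subst (λ w → IsThreat μ M B c w (α + suc l) (β + suc k)) (sym (proj₁ to-y)) trimmed))

abstract
  threat? : ∀ μ M B → 1 ≤ μ → Dec (Threat μ M B)
  threat? = search-threat

-- Runs around a centre and families of separate rays

Run : List Pt → Pt → Pt → ℕ → Set
Run M c v a = ∀ k → k < a → at c v (ℤ.+ suc k) ∈ M

-- The fuel suffices because a run of `a` points consists of distinct points of `M`, whence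
-- `a ≤ length M`.
search-end : ∀ M c v → Primitive v → ∃[ a ] Run M c v a × at c v (ℤ.+ suc a) ∉ M
search-end M c v prim = search (suc (length M)) 0 (λ _ ()) ≤-refl
  where
  search : ∀ fuel a → Run M c v a → length M < a + fuel → ∃[ a ] Run M c v a × at c v (ℤ.+ suc a) ∉ M
  search zero a run lt = ⊥-elim (ℕₚ.<⇒≱ (subst (length M <_) (ℕₚ.+-identityʳ a) lt)
    (subst (_≤ length M) (length-applyUpTo (λ i → at c v (ℤ.+ suc i)) a)
      (unique-⊆⇒length-≤ (rayPoints-unique c v a prim) (λ x∈ → let k , k<a , eq = ∈-ray⁻ c v x∈ in subst (_∈ M) (sym eq) (run k k<a)))))
  search (suc fuel) a run lt with at c v (ℤ.+ suc a) ∈? M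
  ... | no end = a , run , end
  ... | yes i = search fuel (suc a) longer (subst (length M <_) (ℕₚ.+-suc a fuel) lt)
    where
    longer : Run M c v (suc a)
    longer k k<sa with k ℕₚ.≟ a
    ... | yes refl = i
    ... | no k≢a = run k (ℕₚ.≤∧≢⇒< (ℕₚ.≤-pred k<sa) k≢a)

abstract
  run-end : ∀ M c v → Primitive v → ∃[ a ] Run M c v a × at c v (ℤ.+ suc a) ∉ M
  run-end = search-end

Closed : List Pt → List Pt → Pt → Pt → Set
Closed M B c v = ∃[ a ] Run M c v a × at c v (ℤ.+ suc a) ∈ B

ClosedRay : List Pt → List Pt → Ray → Set
ClosedRay M B f = Ray.start f ∈ M × Closed M B (Ray.start f) (Ray.dir f) × Closed M B (Ray.start f) (neg (Ray.dir f))

-- The size is the least one that collects `m` points of `Q`. Both cases of `separate-new` rest on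
-- this minimality, for the old ray in one and for the new ray in the other.
Owns : List Pt → ℕ → Ray → Set
Owns Q m f = hits Q f ≡ m × (∀ J → m ≤ tally (rayPoints (Ray.start f) (Ray.dir f) J) Q → Ray.size f ≤ J)

Disjoint : List Pt → List Pt → Set
Disjoint M B = ∀ {x} → x ∈ M → x ∉ B

-- The interval from `lo` to `hi` avoids `β` and `α`. If its point `y` lay between them, so would
-- the whole interval, and then `u` would belong to the run.
line-gap : {M B : ℤ → Set} {β α lo y hi u : ℤ} → (∀ z → M z → ¬ B z) → B β → B α → (∀ z → β ℤ.< z → z ℤ.< α → M z) →
  M y → lo ℤ.≤ y → y ℤ.≤ hi → (∀ z → lo ℤ.≤ z → z ℤ.≤ hi → ¬ B z) → lo ℤ.≤ u → u ℤ.≤ hi → ¬ M u → α ℤ.< lo ⊎ hi ℤ.< β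
line-gap {β = β} {α} {lo} {y} {hi} {u} disj Bβ Bα run My lo≤y y≤hi free lo≤u u≤hi ¬Mu with y ℤ.<? α | β ℤ.<? y
... | no y≮α | _ = inj₁ (ℤₚ.≰⇒> (λ lo≤α → free α lo≤α (ℤₚ.≤-trans (ℤₚ.≮⇒≥ y≮α) y≤hi) Bα))
... | yes _ | no β≮y = inj₂ (ℤₚ.≰⇒> (λ β≤hi → free β (ℤₚ.≤-trans lo≤y (ℤₚ.≮⇒≥ β≮y)) β≤hi Bβ))
... | yes y<α | yes β<y = ⊥-elim (¬Mu (run u
  (ℤₚ.≰⇒> (λ u≤β → free β (ℤₚ.≤-trans lo≤u u≤β) (ℤₚ.≤-trans (ℤₚ.<⇒≤ β<y) y≤hi) Bβ))
  (ℤₚ.≰⇒> (λ α≤u → free α (ℤₚ.≤-trans lo≤y (ℤₚ.<⇒≤ y<α)) (ℤₚ.≤-trans α≤u u≤hi) Bα))))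

at-back : ∀ c v y z → at (at c v y) v (z ℤ.- y) ≡ at c v z
at-back c v y z = trans (at-at c v y (z ℤ.- y)) (cong (at c v) (lemma y z))
  where
  lemma : ∀ y z → y ℤ.+ (z ℤ.- y) ≡ z
  lemma = ℤ-Ring.solve-∀

stretch-free : ∀ {μ M B c v i j} → Disjoint M B → IsThreat μ M B c v i j →
  ∀ w → ℤ.- (ℤ.+ i) ℤ.≤ w → w ℤ.≤ ℤ.+ j → at c v w ∉ B
stretch-free {c = c} {v} disj (c∈M , _) (ℤ.+ zero) _ _ = disj (subst (_∈ _) (sym (at-0 c v)) c∈M)
stretch-free {c = c} {v} {j = j} disj (_ , (free⁺ , _) , _) (ℤ.+ suc t) _ (ℤ.+≤+ t<j) = All.lookup free⁺
    (∈-ray⁺ c v t<j)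
stretch-free {c = c} {v} {suc i} disj (_ , (_ , free⁻) , _) ℤ.-[1+ t ] (ℤ.-≤- t≤i) _ =
  subst (_∉ _) (at-neg c v (ℤ.+ suc t)) (All.lookup free⁻ (∈-ray⁺ c (neg v) (s≤s t≤i)))

stretch-gap : ∀ {μ M B c v i j} → IsThreat μ M B c v i j →
  ∃[ w ] ℤ.- (ℤ.+ i) ℤ.≤ w × w ℤ.≤ ℤ.+ j × at c v w ∉ M
stretch-gap {c = c} {v} {i} {j} (_ , _ , inj₁ gap , _) =
  let x , x∈ , x∉ = find gap ; k , k<j , eq = ∈-ray⁻ c v x∈
  in ℤ.+ suc k , ℤₚ.neg-≤-pos {i} {suc k} , ℤ.+≤+ k<j , subst (_∉ _) eq x∉
stretch-gap {c = c} {v} {i} {j} (_ , _ , inj₂ gap , _) =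
  let x , x∈ , x∉ = find gap ; k , k<i , eq = ∈-ray⁻ c (neg v) x∈
  in ℤ.-[1+ k ] , ℤₚ.neg-mono-≤ (ℤ.+≤+ k<i) , ℤ.-≤+ , subst (_∉ _) (trans eq (at-neg c v (ℤ.+ suc k))) x∉

positive-part : ∀ {z} → 0ℤ ℤ.< z → ∃[ s ] z ≡ ℤ.+ suc s
positive-part {ℤ.+ suc s} _ = s , refl
positive-part {ℤ.+ zero} (ℤ.+<+ ())

closed-run : ∀ {M B} e (cl : ClosedRay M B e) →
  let a = proj₁ (proj₁ (proj₂ cl)) ; b = proj₁ (proj₂ (proj₂ cl)) in
  ∀ z → ℤ.-[1+ b ] ℤ.< z → z ℤ.< ℤ.+ suc a → at (Ray.start e) (Ray.dir e) z ∈ M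
closed-run e (c∈M , _) (ℤ.+ zero) _ _ = subst (_∈ _) (sym (at-0 (Ray.start e) (Ray.dir e))) c∈M
closed-run e (_ , (a , run , _) , _) (ℤ.+ suc t) _ (ℤ.+<+ (s≤s t<a)) = run t t<a
closed-run e (_ , _ , (b , run , _)) ℤ.-[1+ t ] (ℤ.-<- t<b) _ = subst (_∈ _) (at-neg (Ray.start e) (Ray.dir e)
    (ℤ.+ suc t)) (run t t<b)

-- A stretch free of Breaker points cannot reach across the two Breaker points around the run of an
-- earlier centre, and it does not fit between them because that run is full.  So it lies on one side,
-- and half of its Maker points separate the two centres.
separate-new : ∀ {M B Q m μ i j} e f → Disjoint M B → Owns Q m e → ClosedRay M B e →
  let c = Ray.start f ; v = Ray.dir f in IsThreat μ M B c v i j →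
  m ≤ tally (rayPoints c v j) Q → m ≤ tally (rayPoints c (neg v) i) Q → Owns Q m f → Separate f e
separate-new {M} {B} {Q} {m} {μ} {i} {j} e f disj (_ , e-minimal) cl@(_ , (a , _ , a∈B) ,
    (b , _ , b∈B)) isT many⁺ many⁻ (_ , f-minimal) refl x∈f x∈e
  with ∈-ray⁻ (Ray.start f) (Ray.dir f) x∈f | ∈-ray⁻ (Ray.start e) (Ray.dir f) x∈e
... | l , l<J , refl | k , k<K , eq = [ right-of , left-of ]′ gap
  where
  c = Ray.start f
  v = Ray.dir f
  ce = Ray.start e
  y = ℤ.+ suc k ℤ.- ℤ.+ suc l
  c≡ : c ≡ at ce v y
  c≡ = begin
    c ≡⟨ sym (at-0 c v) ⟩
    at c v 0ℤ ≡⟨ cong (at c v) (sym (ℤₚ.+-inverseʳ (ℤ.+ suc l))) ⟩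
    at c v (ℤ.+ suc l ℤ.+ ℤ.- (ℤ.+ suc l)) ≡⟨ sym (at-at c v (ℤ.+ suc l) (ℤ.- (ℤ.+ suc l))) ⟩
    at (at c v (ℤ.+ suc l)) v (ℤ.- (ℤ.+ suc l)) ≡⟨ cong (λ p → at p v (ℤ.- (ℤ.+ suc l))) eq ⟩
    at (at ce v (ℤ.+ suc k)) v (ℤ.- (ℤ.+ suc l)) ≡⟨ at-at ce v (ℤ.+ suc k) (ℤ.- (ℤ.+ suc l)) ⟩
    at ce v y ∎
    where open ≡-Reasoning
  relative : ∀ z → at c v (z ℤ.- y) ≡ at ce v z
  relative z = trans (cong (λ p → at p v (z ℤ.- y)) c≡) (at-back ce v y z)
  relative′ : ∀ w → at c v w ≡ at ce v (y ℤ.+ w)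
  relative′ w = trans (cong (λ p → at p v w) c≡) (at-at ce v y w)
  lower : ∀ y i → y ℤ.- i ℤ.- y ≡ ℤ.- i
  lower = ℤ-Ring.solve-∀
  upper : ∀ y j → y ℤ.+ j ℤ.- y ≡ j
  upper = ℤ-Ring.solve-∀
  free : ∀ z → y ℤ.- ℤ.+ i ℤ.≤ z → z ℤ.≤ y ℤ.+ ℤ.+ j → at ce v z ∉ B
  free z p q = subst (_∉ B) (relative z) (stretch-free {μ} disj isT (z ℤ.- y)
    (subst (ℤ._≤ z ℤ.- y) (lower y (ℤ.+ i)) (ℤₚ.+-monoˡ-≤ (ℤ.- y) p))
    (subst (z ℤ.- y ℤ.≤_) (upper y (ℤ.+ j)) (ℤₚ.+-monoˡ-≤ (ℤ.- y) q)))
  hole = stretch-gap {μ} isT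
  gap : ℤ.+ suc a ℤ.< y ℤ.- ℤ.+ i ⊎ y ℤ.+ ℤ.+ j ℤ.< ℤ.-[1+ b ]
  gap = line-gap {λ z → at ce v z ∈ M} {λ z → at ce v z ∈ B} {y = y} (λ z → disj)
    (subst (_∈ B) (at-neg ce v (ℤ.+ suc b)) b∈B) a∈B (closed-run e cl) (subst (_∈ M) c≡ (proj₁ isT))
    (ℤₚ.i-j≤i y (ℤ.+ i)) (ℤₚ.i≤i+j y (ℤ.+ j)) free
    (ℤₚ.+-monoʳ-≤ y (proj₁ (proj₂ hole))) (ℤₚ.+-monoʳ-≤ y (proj₁ (proj₂ (proj₂ hole))))
    (λ u∈M → proj₂ (proj₂ (proj₂ hole)) (subst (_∈ M) (sym (relative′ (proj₁ hole))) u∈M))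
  -- The left half of the new stretch, with its `m` points of `Q`, lies between the centre of `e`
  -- and the common point, so the ray of `e` would have ended before that point.
  right-of : ℤ.+ suc a ℤ.< y ℤ.- ℤ.+ i → ⊥
  right-of lt = ℕₚ.<⇒≱ k<K (e-minimal k (≤-trans many⁻ (tally-mono Q (λ _ → into))))
    where
    into : ∀ {x} → x ∈ rayPoints c (neg v) i → x ∈ rayPoints ce v k
    into x∈ with ∈-ray⁻ c (neg v) x∈
    ... | t , t<i , refl = subst (_∈ rayPoints ce v k) (sym (trans (at-neg c v (ℤ.+ suc t))
        (trans (relative′ (ℤ.- (ℤ.+ suc t))) (cong (at ce v) (proj₂ index)))))
                             (∈-ray⁺ ce v (ℕₚ.≤-pred (ℤₚ.drop‿+<+ (subst (ℤ._< ℤ.+ suc k) (proj₂ index) below))))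
      where
      index : ∃[ s ] y ℤ.+ ℤ.- (ℤ.+ suc t) ≡ ℤ.+ suc s
      index = positive-part (ℤₚ.<-≤-trans (ℤₚ.<-trans (ℤ.+<+ (s≤s z≤n)) lt)
          (ℤₚ.+-monoʳ-≤ y (ℤₚ.neg-mono-≤ (ℤ.+≤+ t<i))))
      below : y ℤ.+ ℤ.- (ℤ.+ suc t) ℤ.< ℤ.+ suc k
      below = ℤₚ.≤-<-trans (ℤₚ.i-j≤i y (ℤ.+ suc t)) (subst (y ℤ.<_) (ℤₚ.+-identityʳ (ℤ.+ suc k))
          (ℤₚ.+-monoʳ-< (ℤ.+ suc k) {ℤ.- (ℤ.+ suc l)} {0ℤ} ℤ.-<+))
  -- The ray of `f` ends within its stretch, which lies before the centre of `e`, while the ray of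
  -- `e` begins after that centre.
  left-of : y ℤ.+ ℤ.+ j ℤ.< ℤ.-[1+ b ] → ⊥
  left-of lt = ℤₚ.<-asym (ℤₚ.<-trans lt ℤ.-<+) (ℤₚ.<-≤-trans (subst (0ℤ ℤ.<_) (rejoin (ℤ.+ suc k) (ℤ.+ suc l))
      (ℤ.+<+ (s≤s z≤n)))
    (ℤₚ.+-monoʳ-≤ y (ℤ.+≤+ (≤-trans l<J (f-minimal j many⁺)))))
    where
    rejoin : ∀ k l → k ≡ k ℤ.- l ℤ.+ l
    rejoin = ℤ-Ring.solve-∀

-- A discrete intermediate value argument: with steps of at most one, `g` cannot jump over `m`.
first-reaching : (g : ℕ → ℕ) → (∀ {a b} → a ≤ b → g a ≤ g b) → (∀ k → g (suc k) ≤ suc (g k)) → g 0 ≡ 0 →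
  ∀ m j → m ≤ g j → ∃[ J ] g J ≡ m × (∀ J′ → m ≤ g J′ → J ≤ J′)
first-reaching g mono step g0 m zero h = 0 , ℕₚ.≤-antisym (≤-trans (≤-reflexive g0) z≤n) h , λ _ _ → z≤n
first-reaching g mono step g0 m (suc j) h with m ℕₚ.≤? g j
... | yes h′ = first-reaching g mono step g0 m j h′
... | no ¬h = suc j , ℕₚ.≤-antisym (≤-trans (step j) (ℕₚ.≰⇒> ¬h)) h
            , λ J′ h′ → ℕₚ.≰⇒> (λ J′≤j → ¬h (≤-trans h′ (mono J′≤j)))

tally-step : ∀ {Q} c v k → Unique Q → tally (rayPoints c v (suc k)) Q ≤ suc (tally (rayPoints c v k) Q)
tally-step {Q} c v k uniq = begin
  tally (rayPoints c v (suc k)) Q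
    ≤⟨ ∑-mono Q split ⟩
  ∑ (λ x → indicator (x ≟ₚ end) + indicator (x ∈? rayPoints c v k)) Q
    ≡⟨ ∑-+ (λ x → indicator (x ≟ₚ end)) (λ x → indicator (x ∈? rayPoints c v k)) Q ⟩
  count (_≟ₚ end) Q + tally (rayPoints c v k) Q
    ≤⟨ ℕₚ.+-monoˡ-≤ (tally (rayPoints c v k) Q) (count-≤1 (_≟ₚ end)
        (AllPairs.map (λ x≢z x≡y z≡y → x≢z (trans x≡y (sym z≡y))) uniq)) ⟩
  suc (tally (rayPoints c v k) Q) ∎
  where
  open ℕₚ.≤-Reasoning
  end = at c v (ℤ.+ suc k)
  split : ∀ x → indicator (x ∈? rayPoints c v (suc k)) ≤ indicator (x ≟ₚ end) + indicator (x ∈? rayPoints c v k)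
  split x with x ≟ₚ end
  ... | yes _ = ≤-trans (indicator-≤1 (x ∈? rayPoints c v (suc k))) (s≤s z≤n)
  ... | no x≢ = indicator-mono (x ∈? rayPoints c v (suc k)) (x ∈? rayPoints c v k) shorter
    where
    shorter : x ∈ rayPoints c v (suc k) → x ∈ rayPoints c v k
    shorter x∈ with ∈-ray⁻ c v x∈
    ... | l , l<sk , refl = ∈-ray⁺ c v (ℕₚ.≤∧≢⇒< (ℕₚ.≤-pred l<sk) (λ { refl → x≢ refl }))

owning-ray : ∀ {Q m} c v (dv : Direction v) j → Unique Q → m ≤ tally (rayPoints c v j) Q → ∃[ J ] Owns Q m
    (ray c v dv J)
owning-ray {Q} {m} c v dv j uniq = first-reaching (λ k → tally (rayPoints c v k) Q)
  (λ {a} {b} a≤b → tally-mono Q (λ _ → rayPoints-mono c v a≤b)) (λ k → tally-step c v k uniq)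
      (count-none (_∈? []) Q (λ _ ())) m j

record Family (Q : List Pt) (m : ℕ) (M B : List Pt) (Fs : List Ray) : Set where
  constructor family
  field
    owns : All (Owns Q m) Fs
    separate : AllPairs Separate Fs
    closed : All (ClosedRay M B) Fs

Halves : List Pt → ℕ → ∀ {μ M B} → Threat μ M B → Set
Halves Q m t = m ≤ tally (rayPoints centre direction reach⁺) Q × m ≤ tally (rayPoints centre (neg direction) reach⁻) Q
  where open Threat t

-- The new centre has to be a threat but not yet blocked. So besides the treated threats also the
-- one that survives a turn yields a ray.
grow : ∀ {Q m M B Fs μ} → Unique Q → Disjoint M B → Family Q m M B Fs → (t : Threat μ M B) → Halves Q m t →
  ∃[ J ] let f = ray (Threat.centre t) (Threat.direction t) (Threat.isDirection t) J in
    All (Owns Q m) (f ∷ Fs) × AllPairs Separate (f ∷ Fs)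
grow {Q} {m} {M} {B} {Fs} {μ} uniq disj (family owns sep closed) (threat c v dv i j isT) (many⁺ , many⁻) =
  let J , own = owning-ray c v dv j uniq many⁺
  in J , own ∷ owns , All.tabulate (λ {e} e∈ → separate-new {Q = Q} {μ = μ} e (ray c v dv J) disj
      (All.lookup owns e∈) (All.lookup closed e∈) isT many⁺ many⁻ own) ∷ sep

-- Breaker's strategy

infix 4 _⊑_
_⊑_ : List Pt → List Pt → Set
xs ⊑ ys = ∀ {x} → x ∈ xs → x ∈ ys

-- Fewer Breaker points only make a stretch freer, so a threat that is present after some of
-- Breaker's claims was present before them.
weaken-threat : ∀ {μ ν M B B′} → μ ≤ ν → B ⊑ B′ → Threat ν M B′ → Threat μ M B
weaken-threat μ≤ν B⊑B′ (threat c v dv i j (c∈M , (free⁺ , free⁻) , gap , (many⁺ , many⁻))) =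
  threat c v dv i j (c∈M , (All.map (λ x∉ → x∉ ∘ B⊑B′) free⁺ , All.map (λ x∉ → x∉ ∘ B⊑B′) free⁻) , gap ,
      (≤-trans μ≤ν many⁺ , ≤-trans μ≤ν many⁻))

family-mono : ∀ {Q m M M′ B B′ Fs} → M ⊑ M′ → B ⊑ B′ → Family Q m M B Fs → Family Q m M′ B′ Fs
family-mono M⊑M′ B⊑B′ (family owns sep closed) = family owns sep
  (All.map (λ { (c∈M , (a , run , a∈B) , (b , run′ , b∈B)) →
      M⊑M′ c∈M , (a , (λ k k<a → M⊑M′ (run k k<a)) , B⊑B′ a∈B) ,
          (b , (λ k k<b → M⊑M′ (run′ k k<b)) , B⊑B′ b∈B) }) closed)

insert-unless : {X : Set} → Dec X → Pt → List Pt → List Pt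
insert-unless (yes _) x new = new
insert-unless (no _) x new = x ∷ new

Fresh : List Pt → List Pt → Set
Fresh C new = Unique new × All (_∉ C) new

fresh-∷ : ∀ {C x new} → x ∉ new ++ C → Fresh C new → Fresh C (x ∷ new)
fresh-∷ {new = new} x∉ (uniq , out) =
  All.tabulate (λ y∈ x≡y → x∉ (∈-++⁺ˡ (subst (_∈ new) (sym x≡y) y∈))) ∷ uniq , x∉ ∘ ∈-++⁺ʳ new ∷ out

abstract
  -- The end of a run may already be Breaker's, from an earlier turn or from the current one; then
  -- no point is spent.
  add-new : List Pt → Pt → List Pt → List Pt
  add-new C x new = insert-unless (x ∈? (new ++ C)) x new

  add-new-fresh : ∀ {C} x {new} → Fresh C new → Fresh C (add-new C x new)
  add-new-fresh {C} x {new} fresh = go (x ∈? (new ++ C))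
    where
    go : (d : Dec (x ∈ new ++ C)) → Fresh C (insert-unless d x new)
    go (yes _) = fresh
    go (no x∉) = fresh-∷ x∉ fresh

  add-new-length : ∀ C x new → length (add-new C x new) ≤ suc (length new)
  add-new-length C x new = go (x ∈? (new ++ C))
    where
    go : (d : Dec (x ∈ new ++ C)) → length (insert-unless d x new) ≤ suc (length new)
    go (yes _) = ℕₚ.n≤1+n _
    go (no _) = ≤-refl

  add-new-⊑ : ∀ C x new → new ⊑ add-new C x new
  add-new-⊑ C x new {y} y∈ = go (x ∈? (new ++ C))
    where
    go : (d : Dec (x ∈ new ++ C)) → y ∈ insert-unless d x new
    go (yes _) = y∈
    go (no _) = there y∈

  add-new-∈ : ∀ C x new → x ∈ add-new C x new ++ C
  add-new-∈ C x new = go (x ∈? (new ++ C))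
    where
    go : (d : Dec (x ∈ new ++ C)) → x ∈ insert-unless d x new ++ C
    go (yes x∈) = x∈
    go (no _) = here refl

++-monoˡ-⊑ : ∀ {xs ys} zs → xs ⊑ ys → xs ++ zs ⊑ ys ++ zs
++-monoˡ-⊑ {xs} {ys} zs h i = [ ∈-++⁺ˡ ∘ h , ∈-++⁺ʳ ys ]′ (∈-++⁻ xs i)

endpoint : (M : List Pt) (c v : Pt) → Primitive v → Pt
endpoint M c v prim = at c v (ℤ.+ suc (proj₁ (run-end M c v prim)))

endpoint-∉ : ∀ M c v prim → endpoint M c v prim ∉ M
endpoint-∉ M c v prim = proj₂ (proj₂ (run-end M c v prim))

endpoint-closes : ∀ {M B} c v prim → endpoint M c v prim ∈ B → Closed M B c v
endpoint-closes {M} c v prim i = proj₁ (run-end M c v prim) , proj₁ (proj₂ (run-end M c v prim)) , i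

block : (M B : List Pt) (c v : Pt) → Primitive v → List Pt → List Pt
block M B c v prim new =
  add-new (M ++ B) (endpoint M c v prim) (add-new (M ++ B) (endpoint M c (neg v) (neg-primitive {v} prim)) new)

block-fresh : ∀ M B c v prim new → Fresh (M ++ B) new → Fresh (M ++ B) (block M B c v prim new)
block-fresh M B c v prim new fresh =
  add-new-fresh (endpoint M c v prim) (add-new-fresh (endpoint M c (neg v) (neg-primitive {v} prim)) {new} fresh)

block-length : ∀ M B c v prim new → length (block M B c v prim new) ≤ 2 + length new
block-length M B c v prim new = ≤-trans (add-new-length (M ++ B) (endpoint M c v prim) (add-new (M ++ B) y new))
    (s≤s (add-new-length (M ++ B) y new))
  where y = endpoint M c (neg v) (neg-primitive {v} prim)

block-⊑ : ∀ M B c v prim new → new ⊑ block M B c v prim new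
block-⊑ M B c v prim new = add-new-⊑ (M ++ B) (endpoint M c v prim) (add-new (M ++ B) y new) ∘ add-new-⊑
    (M ++ B) y new
  where y = endpoint M c (neg v) (neg-primitive {v} prim)

outside-M : {M B : List Pt} {x : Pt} (new : List Pt) → x ∈ new ++ (M ++ B) → x ∉ M → x ∈ new ++ B
outside-M {M} new x∈ x∉M = [ ∈-++⁺ˡ , (λ i → [ (λ j → ⊥-elim (x∉M j)) , ∈-++⁺ʳ new ]′ (∈-++⁻ M i)) ]′ (∈-++⁻ new x∈)

block-closes : ∀ M B c v dv J new → c ∈ M → ClosedRay M (block M B c v (proj₁ dv) new ++ B) (ray c v dv J)
block-closes M B c v dv J new c∈M =
  c∈M , endpoint-closes {M} {block M B c v prim new ++ B} c v prim (outside-M {M} {B} (block M B c v prim new)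
      (add-new-∈ (M ++ B) x inner) (endpoint-∉ M c v prim))
      , endpoint-closes {M} {block M B c v prim new ++ B} c (neg v) prim′ (outside-M {M} {B} (block M B c v prim new)
          (++-monoˡ-⊑ {inner} {block M B c v prim new} (M ++ B) (add-new-⊑ (M ++ B) x inner)
              (add-new-∈ (M ++ B) y new)) (endpoint-∉ M c (neg v) prim′))
  where
  prim = proj₁ dv
  prim′ = neg-primitive {v} prim
  x = endpoint M c v prim
  y = endpoint M c (neg v) prim′
  inner = add-new (M ++ B) y new

record Levels : Set where
  constructor levels
  field
    low high : ℕ
    low-positive : 1 ≤ low
    low≤high : low ≤ high
  high-positive : 1 ≤ high
  high-positive = ≤-trans low-positive low≤high

choose : ∀ {μ ν B*} M B → Dec (Threat μ M B*) → Dec (Threat ν M B*) → List Pt → List Pt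
choose M B (yes t) _ new = block M B (Threat.centre t) (Threat.direction t) (proj₁ (Threat.isDirection t)) new
choose M B (no _) (yes t) new = block M B (Threat.centre t) (Threat.direction t) (proj₁ (Threat.isDirection t)) new
choose M B (no _) (no _) new = new

choose-first : ∀ {μ ν B*} M B (d : Dec (Threat μ M B*)) (e : Dec (Threat ν M B*)) new → Threat μ M B* →
  Σ (Threat μ M B*) (λ t → choose M B d e new ≡ block M B (Threat.centre t) (Threat.direction t)
      (proj₁ (Threat.isDirection t)) new)
choose-first M B (yes t) _ new _ = t , refl
choose-first M B (no ¬t) _ new t = ⊥-elim (¬t t)

choose-either : ∀ {μ ν B*} M B (d : Dec (Threat μ M B*)) (e : Dec (Threat ν M B*)) new → ν ≤ μ → Threat ν M B* →
  Σ (Threat ν M B*) (λ t → choose M B d e new ≡ block M B (Threat.centre t) (Threat.direction t)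
      (proj₁ (Threat.isDirection t)) new)
choose-either M B (yes (threat c v dv i j (c∈M , free , gap , (many⁺ , many⁻)))) _ new ν≤μ _ =
  threat c v dv i j (c∈M , free , gap , (≤-trans ν≤μ many⁺ , ≤-trans ν≤μ many⁻)) , refl
choose-either M B (no _) (yes t) new _ _ = t , refl
choose-either M B (no _) (no ¬t) new _ t = ⊥-elim (¬t t)

choose-properties : ∀ {μ ν B*} M B (d : Dec (Threat μ M B*)) (e : Dec (Threat ν M B*)) new →
  (Fresh (M ++ B) new → Fresh (M ++ B) (choose M B d e new))
  × length (choose M B d e new) ≤ 2 + length new × new ⊑ choose M B d e new
choose-properties M B d e new = go d e
  where
  Good : List Pt → Set
  Good new′ = (Fresh (M ++ B) new → Fresh (M ++ B) new′) × length new′ ≤ 2 + length new × new ⊑ new′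
  blocked : ∀ c v prim → Good (block M B c v prim new)
  blocked c v prim = block-fresh M B c v prim new , block-length M B c v prim new , block-⊑ M B c v prim new
  go : ∀ {μ ν B*} (d : Dec (Threat μ M B*)) (e : Dec (Threat ν M B*)) → Good (choose M B d e new)
  go (yes t) _ = blocked (Threat.centre t) (Threat.direction t) (proj₁ (Threat.isDirection t))
  go (no _) (yes t) = blocked (Threat.centre t) (Threat.direction t) (proj₁ (Threat.isDirection t))
  go (no _) (no _) = (λ f → f) , ≤-trans (ℕₚ.n≤1+n _) (ℕₚ.n≤1+n _) , (λ i → i)

-- Threats are tested against `new ++ B`, so points chosen earlier in the same turn already count.
attend : Levels → List Pt → List Pt → List Pt → List Pt
attend ls M B new =
  choose M B (threat? (Levels.high ls) M (new ++ B) (Levels.high-positive ls)) (threat? (Levels.low ls) M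
      (new ++ B) (Levels.low-positive ls)) new

-- What the analysis needs from the selection rule at threshold `μ`. It holds at both thresholds,
-- because high threats are served first and are low threats as well.
Attends : Levels → ℕ → List Pt → List Pt → Set
Attends ls μ M B = ∀ new → Threat μ M (new ++ B) → Σ (Threat μ M (new ++ B)) (λ t →
  attend ls M B new ≡ block M B (Threat.centre t) (Threat.direction t) (proj₁ (Threat.isDirection t)) new)

attends-high : ∀ ls M B → Attends ls (Levels.high ls) M B
attends-high ls M B new = choose-first M B (threat? (Levels.high ls) M (new ++ B) (Levels.high-positive ls))
    (threat? (Levels.low ls) M (new ++ B) (Levels.low-positive ls)) new

attends-low : ∀ ls M B → Attends ls (Levels.low ls) M B
attends-low ls M B new = choose-either M B (threat? (Levels.high ls) M (new ++ B) (Levels.high-positive ls))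
    (threat? (Levels.low ls) M (new ++ B) (Levels.low-positive ls)) new (Levels.low≤high ls)

attend-properties : ∀ ls M B new → (Fresh (M ++ B) new → Fresh (M ++ B) (attend ls M B new))
  × length (attend ls M B new) ≤ 2 + length new × new ⊑ attend ls M B new
attend-properties ls M B new = choose-properties M B
  (threat? (Levels.high ls) M (new ++ B) (Levels.high-positive ls)) (threat? (Levels.low ls) M (new ++ B)
      (Levels.low-positive ls)) new

rounds : Levels → List Pt → List Pt → ℕ → List Pt → List Pt
rounds ls M B zero new = new
rounds ls M B (suc r) new = rounds ls M B r (attend ls M B new)

rounds-properties : ∀ ls M B r new → (Fresh (M ++ B) new → Fresh (M ++ B) (rounds ls M B r new))
  × length (rounds ls M B r new) ≤ 2 * r + length new × new ⊑ rounds ls M B r new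
rounds-properties ls M B zero new = (λ f → f) , ≤-refl , (λ i → i)
rounds-properties ls M B (suc r) new =
  let f , l , s = attend-properties ls M B new
      f′ , l′ , s′ = rounds-properties ls M B r (attend ls M B new)
  in f′ ∘ f , ≤-trans l′ (≤-trans (ℕₚ.+-monoʳ-≤ (2 * r) l) (≤-reflexive (lemma r (length new)))) , s′ ∘ s
  where
  lemma : ∀ r n → 2 * r + (2 + n) ≡ 2 * suc r + n
  lemma = ℕ-Ring.solve-∀

disjoint-fresh : ∀ {M B new} → Disjoint M B → Fresh (M ++ B) new → Disjoint M (new ++ B)
disjoint-fresh {new = new} disj (_ , out) x∈M x∈ = [ (λ i → All.lookup out i (∈-++⁺ˡ x∈M)) , disj x∈M ]′
    (∈-++⁻ new x∈)

extend-family : ∀ {μ Q m M B new Fs} → Unique Q → Disjoint M (new ++ B) → Family Q m M (new ++ B) Fs →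
  (t : Threat μ M (new ++ B)) → Halves Q m t →
  ∃[ f ] Family Q m M (block M B (Threat.centre t) (Threat.direction t) (proj₁ (Threat.isDirection t)) new ++ B)
      (f ∷ Fs)
extend-family {Q = Q} {m} {M} {B} {new} {Fs} uniq disj fam t@(threat c v dv i j (c∈M , _)) halves =
  let J , owns , sep = grow uniq disj fam t halves
  in ray c v dv J , family owns sep (block-closes M B c v dv J new c∈M
       ∷ Family.closed (family-mono {Q} {m} {M} {M} {new ++ B} {block M B c v (proj₁ dv) new ++ B} {Fs}
           (λ i → i) (++-monoˡ-⊑ {new} {block M B c v (proj₁ dv) new} B (block-⊑ M B c v (proj₁ dv) new)) fam))

-- A threat that survives all rounds was present before each of them. So no round was idle, and each
-- of them adds a ray.
rounds-family : ∀ ls {μ Q m M B} → Unique Q → Disjoint M B → Attends ls μ M B →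
  (∀ {B*} → B ⊑ B* → (t : Threat μ M B*) → Halves Q m t) →
  ∀ r new {Fs} → Fresh (M ++ B) new → Family Q m M (new ++ B) Fs → Threat μ M (rounds ls M B r new ++ B) →
  ∃[ Fs′ ] length Fs′ ≡ r + length Fs × Family Q m M (rounds ls M B r new ++ B) Fs′
rounds-family ls uniq disj pick halves zero new {Fs} _ fam _ = Fs , refl , fam
rounds-family ls {μ} {Q} {m} {M} {B} uniq disj pick halves (suc r) new {Fs} fresh fam final =
  let Fs′ , len , fam′ = rounds-family ls uniq disj pick halves r (attend ls M B new) (proj₁ (attend-properties ls M B new) fresh) grown final
  in Fs′ , trans len (ℕₚ.+-suc r (length Fs)) , fam′
  where
  persists : Threat μ M (new ++ B)
  persists = weaken-threat ≤-refl (++-monoˡ-⊑ B (proj₂ (proj₂ (rounds-properties ls M B (suc r) new)))) final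
  picked = pick new persists
  extended = extend-family {μ} {Q} {m} {M} {B} {new} {Fs} uniq (disjoint-fresh disj fresh) fam (proj₁ picked)
      (halves (∈-++⁺ʳ new) (proj₁ picked))
  grown : Family Q m M (attend ls M B new ++ B) (proj₁ extended ∷ Fs)
  grown = subst (λ n → Family Q m M (n ++ B) (proj₁ extended ∷ Fs)) (sym (proj₂ picked)) (proj₂ extended)

fresh-point : List Pt → Pt
fresh-point L = ℤ.+ suc (∑ (λ x → ℤ.∣ proj₁ x ∣) L) , 0ℤ

fresh-point-∉ : ∀ L → fresh-point L ∉ L
fresh-point-∉ L i = ℕₚ.<-irrefl refl (∑-member (λ x → ℤ.∣ proj₁ x ∣) i)

pad : ℕ → List Pt → List Pt → List Pt
pad zero C new = new
pad (suc k) C new = pad k C (fresh-point (new ++ C) ∷ new)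

pad-properties : ∀ k C new → (Fresh C new → Fresh C (pad k C new)) × length
    (pad k C new) ≡ k + length new × new ⊑ pad k C new
pad-properties zero C new = (λ f → f) , refl , (λ i → i)
pad-properties (suc k) C new =
  let f , l , s = pad-properties k C (fresh-point (new ++ C) ∷ new)
  in (λ fresh → f (fresh-∷ (fresh-point-∉ (new ++ C)) fresh))
     , trans l (ℕₚ.+-suc k (length new)) , s ∘ there

-- A round spends at most two points, so `⌊ t /2⌋` rounds fit into a move of `t` points; arbitrary
-- unclaimed points fill the rest.
reply : Levels → ℕ → List Pt → List Pt → List Pt
reply ls t M B = let new = rounds ls M B ⌊ t /2⌋ [] in pad (t ∸ length new) (M ++ B) new

reply-fresh : ∀ ls t M B → Fresh (M ++ B) (reply ls t M B)
reply-fresh ls t M B = let new = rounds ls M B ⌊ t /2⌋ [] in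
  proj₁ (pad-properties (t ∸ length new) (M ++ B) new) (proj₁ (rounds-properties ls M B ⌊ t /2⌋ []) ([] , []))

reply-length : ∀ ls t M B → length (reply ls t M B) ≡ t
reply-length ls t M B = trans (proj₁ (proj₂ (pad-properties (t ∸ length (rounds ls M B ⌊ t /2⌋ [])) (M ++ B)
    (rounds ls M B ⌊ t /2⌋ []))))
  (ℕₚ.m∸n+n≡m (≤-trans (proj₁ (proj₂ (rounds-properties ls M B ⌊ t /2⌋ [])))
      (≤-trans (≤-reflexive (ℕₚ.+-identityʳ _)) (twice-half t))))

++-swap-⊑ : ∀ {xs ys zs} → xs ⊑ ys → xs ++ zs ⊑ zs ++ ys
++-swap-⊑ {xs} {zs = zs} h i = [ ∈-++⁺ʳ zs ∘ h , ∈-++⁺ˡ ]′ (∈-++⁻ xs i)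

turn-family : ∀ ls {μ Q m M B Fs} t → Unique Q → Disjoint M B → Attends ls μ M B →
  (∀ {B*} → B ⊑ B* → (t : Threat μ M B*) → Halves Q m t) → Family Q m M B Fs →
  Threat μ M (B ++ reply ls t M B) →
  ∃[ Fs′ ] length Fs′ ≡ ⌊ t /2⌋ + length Fs × Family Q m M (B ++ reply ls t M B) Fs′
turn-family ls {M = M} {B} t uniq disj pick halves fam final =
  let Fs′ , len , fam′ = rounds-family ls uniq disj pick halves ⌊ t /2⌋ [] ([] , []) fam (weaken-threat ≤-refl (λ {x} → included {x}) final)
  in Fs′ , len , family-mono (λ i → i) (λ {x} → included {x}) fam′
  where
  included : rounds ls M B ⌊ t /2⌋ [] ++ B ⊑ B ++ reply ls t M B
  included = ++-swap-⊑ {new} {reply ls t M B} {B} (proj₂ (proj₂ (pad-properties (t ∸ length new) (M ++ B) new)))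
    where new = rounds ls M B ⌊ t /2⌋ []

-- Threats inside free stretches

at-shift : ∀ p v y z w → y ℤ.+ z ≡ w → at (at p v y) v z ≡ at p v w
at-shift p v y z w eq = trans (at-at p v y z) (cong (at p v) eq)

tally-++ : ∀ R M Q → tally R (M ++ Q) ≡ tally R M + tally R Q
tally-++ R M Q = ∑-++ (indicator ∘ (_∈? R)) M Q

-- The centre is the Maker point number μ + 1 of the stretch.
ray-threat : ∀ {μ M B} p v n → Direction v → Unique M → (∀ k → k < n → at p v (ℤ.+ suc k) ∉ B) →
  ∀ u → u < n → at p v (ℤ.+ suc u) ∉ M → suc (μ + μ) ≤ tally (rayPoints p v n) M → Threat μ M B
ray-threat {μ} {M} {B} p v n dv uniq free u u<n u∉M many = go (proj₁ first) (proj₂ first)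
  where
  count-to : ℕ → ℕ
  count-to k = tally (rayPoints p v k) M
  first : ∃[ J ] Owns M (suc μ) (ray p v dv J)
  first = owning-ray p v dv n uniq (≤-trans (s≤s (m≤m+n μ μ)) many)
  go : ∀ J → Owns M (suc μ) (ray p v dv J) → Threat μ M B
  go zero (eq , _) = ⊥-elim (ℕₚ.0≢1+n (trans (sym (count-none (_∈? []) M (λ _ ()))) eq))
  go (suc k) (eq , minimal) = threat c v dv k (n ∸ suc k)
    ( c∈M
    , (All.tabulate (λ x∈ x∈B → let l , l<n , e = right-in x∈ in free l l<n (subst (_∈ B) e x∈B))
      , All.tabulate (λ x∈ x∈B → let l , l<k , e = left-in x∈ in free l (ℕₚ.<-trans l<k k<n) (subst (_∈ B) e x∈B)))
    , gap (ℕₚ.<-cmp u k)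
    , (right-many , ≤-trans left-many (tally-mono M (λ _ x∈ → let l , l<k , e = ∈-ray⁻ p v x∈ in subst (_∈ rayPoints c (neg v) k) (sym e) (left-out l<k)))))
    where
    c = at p v (ℤ.+ suc k)
    k<n : k < n
    k<n = minimal n (≤-trans (s≤s (m≤m+n μ μ)) many)
    few : ¬ suc μ ≤ count-to k
    few h = ℕₚ.<-irrefl refl (minimal k h)
    left-many : μ ≤ count-to k
    left-many = ℕₚ.≤-pred (≤-trans (≤-reflexive (sym eq)) (tally-step p v k uniq))
    c∈M : c ∈ M
    c∈M with c ∈? M
    ... | yes i = i
    ... | no ¬i = ⊥-elim (few (≤-trans (≤-reflexive (sym eq)) (tally-mono M shrink)))
      where
      shrink : ∀ {x} → x ∈ M → x ∈ rayPoints p v (suc k) → x ∈ rayPoints p v k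
      shrink x∈M x∈ with ∈-ray⁻ p v x∈
      ... | l , l<sk , refl = ∈-ray⁺ p v (ℕₚ.≤∧≢⇒< (ℕₚ.≤-pred l<sk) (λ { refl → ¬i x∈M }))
    right-index : ∀ t → at c v (ℤ.+ suc t) ≡ at p v (ℤ.+ suc (suc k + t))
    right-index t = at-shift p v (ℤ.+ suc k) (ℤ.+ suc t) _ (cong (λ s → ℤ.+ suc s) (ℕₚ.+-suc k t))
    left-index : ∀ l t → k ≡ l + suc t → at c (neg v) (ℤ.+ suc t) ≡ at p v (ℤ.+ suc l)
    left-index l t k≡ = trans (at-neg c v (ℤ.+ suc t)) (at-shift p v (ℤ.+ suc k) (ℤ.- (ℤ.+ suc t)) (ℤ.+ suc l)
      (trans (cong (λ s → ℤ.+ suc s ℤ.+ ℤ.- (ℤ.+ suc t)) k≡) (cancel (ℤ.+ suc l) (ℤ.+ suc t))))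
      where
      cancel : ∀ a b → a ℤ.+ b ℤ.+ ℤ.- b ≡ a
      cancel = ℤ-Ring.solve-∀
    right-in : ∀ {x} → x ∈ rayPoints c v (n ∸ suc k) → ∃[ l ] l < n × x ≡ at p v (ℤ.+ suc l)
    right-in x∈ = let t , t< , e = ∈-ray⁻ c v x∈ in
      suc k + t , ≤-trans (≤-reflexive (sym (ℕₚ.+-suc (suc k) t))) (≤-trans (ℕₚ.+-monoʳ-≤ (suc k) t<)
          (≤-reflexive (ℕₚ.m+[n∸m]≡n k<n)))
      , trans e (right-index t)
    left-in : ∀ {x} → x ∈ rayPoints c (neg v) k → ∃[ l ] l < k × x ≡ at p v (ℤ.+ suc l)
    left-in x∈ = let t , t<k , e = ∈-ray⁻ c (neg v) x∈ in
      k ∸ suc t , ℕₚ.∸-monoʳ-< (s≤s z≤n) t<k , trans e (left-index (k ∸ suc t) t (sym (ℕₚ.m∸n+n≡m t<k)))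
    left-out : ∀ {l} → l < k → at p v (ℤ.+ suc l) ∈ rayPoints c (neg v) k
    left-out {l} l<k = subst (_∈ rayPoints c (neg v) k) (left-index l (k ∸ suc l)
        (sym (trans (ℕₚ.+-suc l (k ∸ suc l)) (ℕₚ.m+[n∸m]≡n l<k))))
      (∈-ray⁺ c (neg v) (ℕₚ.∸-monoʳ-< (s≤s z≤n) l<k))
    right-out : ∀ {l} → k < l → l < n → at p v (ℤ.+ suc l) ∈ rayPoints c v (n ∸ suc k)
    right-out {l} k<l l<n = subst (_∈ rayPoints c v (n ∸ suc k)) (trans (right-index (l ∸ suc k))
        (cong (λ s → at p v (ℤ.+ suc s)) (ℕₚ.m+[n∸m]≡n k<l)))
      (∈-ray⁺ c v (ℕₚ.∸-monoˡ-< l<n k<l))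
    gap : Tri (u < k) (u ≡ k) (k < u) → Any (_∉ M) (rayPoints c v (n ∸ suc k)) ⊎ Any (_∉ M) (rayPoints c (neg v) k)
    gap (tri< u<k _ _) = inj₂ (lose (left-out u<k) u∉M)
    gap (tri≈ _ refl _) = ⊥-elim (u∉M c∈M)
    gap (tri> _ _ k<u) = inj₁ (lose (right-out k<u u<n) u∉M)
    right-many : μ ≤ tally (rayPoints c v (n ∸ suc k)) M
    right-many = ℕₚ.+-cancelˡ-≤ (suc μ) _ _ (≤-trans many (≤-trans (∑-mono M cover)
      (≤-trans (≤-reflexive (∑-+ (λ x → indicator (x ∈? rayPoints p v (suc k)))
          (λ x → indicator (x ∈? rayPoints c v (n ∸ suc k))) M))
        (ℕₚ.+-monoˡ-≤ (tally (rayPoints c v (n ∸ suc k)) M) (≤-reflexive eq)))))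
      where
      cover : ∀ x → indicator (x ∈? rayPoints p v n) ≤ indicator (x ∈? rayPoints p v (suc k)) + indicator
          (x ∈? rayPoints c v (n ∸ suc k))
      cover x with x ∈? rayPoints p v n
      ... | no _ = z≤n
      ... | yes x∈ with ∈-ray⁻ p v x∈
      ...   | l , l<n , refl with l ℕₚ.<? suc k
      ...     | yes l<sk = ≤-trans (≤-reflexive (sym (indicator-yes (x ∈? rayPoints p v (suc k))
          (∈-ray⁺ p v l<sk)))) (m≤m+n _ _)
      ...     | no l≮sk = ≤-trans (≤-reflexive (sym (indicator-yes (x ∈? rayPoints c v (n ∸ suc k))
          (right-out (ℕₚ.≮⇒≥ l≮sk) l<n)))) (m≤n+m _ _)

-- The two halves and the centre are read as a single ray. It starts one step before the leftmost
-- point, because rays exclude their start.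
stretch-in-ray : ∀ c v i j w → ℤ.- (ℤ.+ i) ℤ.≤ w → w ℤ.≤ ℤ.+ j →
  ∃[ k ] k < i + suc j × at (at c v ℤ.-[1+ i ]) v (ℤ.+ suc k) ≡ at c v w
stretch-in-ray c v i j w lo hi = k , k< , at-shift c v ℤ.-[1+ i ] (ℤ.+ suc k) w
    (trans (cong (λ s → ℤ.-[1+ i ] ℤ.+ (ℤ.+ 1 ℤ.+ s)) k≡) (cancel (ℤ.+ i) w))
  where
  nonneg : 0ℤ ℤ.≤ w ℤ.+ ℤ.+ i
  nonneg = subst (ℤ._≤ w ℤ.+ ℤ.+ i) (ℤₚ.+-inverseˡ (ℤ.+ i)) (ℤₚ.+-monoˡ-≤ (ℤ.+ i) lo)
  k = ℤ.∣ w ℤ.+ ℤ.+ i ∣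
  k≡ : ℤ.+ k ≡ w ℤ.+ ℤ.+ i
  k≡ = ℤₚ.0≤i⇒+∣i∣≡i nonneg
  k< : k < i + suc j
  k< = ≤-trans (s≤s (ℤₚ.drop‿+≤+ (subst (ℤ._≤ ℤ.+ (j + i)) (sym k≡) (ℤₚ.+-monoˡ-≤ (ℤ.+ i) hi))))
      (≤-reflexive (trans (cong suc (ℕₚ.+-comm j i)) (sym (ℕₚ.+-suc i j))))
  cancel : ∀ i w → ℤ.- (ℤ.+ 1 ℤ.+ i) ℤ.+ (ℤ.+ 1 ℤ.+ (w ℤ.+ i)) ≡ w
  cancel = ℤ-Ring.solve-∀

ray-in-stretch : ∀ c v i j k → k < i + suc j →
  ∃[ w ] ℤ.- (ℤ.+ i) ℤ.≤ w × w ℤ.≤ ℤ.+ j × at (at c v ℤ.-[1+ i ]) v (ℤ.+ suc k) ≡ at c v w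
ray-in-stretch c v i j k k< = ℤ.+ k ℤ.- ℤ.+ i
  , subst (ℤ._≤ ℤ.+ k ℤ.- ℤ.+ i) (ℤₚ.+-identityˡ (ℤ.- (ℤ.+ i))) (ℤₚ.+-monoˡ-≤ (ℤ.- (ℤ.+ i)) (ℤ.+≤+ z≤n))
  , subst (ℤ.+ k ℤ.- ℤ.+ i ℤ.≤_) (cancel (ℤ.+ i) (ℤ.+ j)) (ℤₚ.+-monoˡ-≤ (ℤ.- (ℤ.+ i))
      (ℤ.+≤+ (ℕₚ.≤-pred (≤-trans k< (≤-reflexive (ℕₚ.+-suc i j))))))
  , at-shift c v ℤ.-[1+ i ] (ℤ.+ suc k) _ (regroup (ℤ.+ i) (ℤ.+ k))
  where
  cancel : ∀ i j → i ℤ.+ j ℤ.- i ≡ j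
  cancel = ℤ-Ring.solve-∀
  regroup : ∀ i k → ℤ.- (ℤ.+ 1 ℤ.+ i) ℤ.+ (ℤ.+ 1 ℤ.+ k) ≡ k ℤ.- i
  regroup = ℤ-Ring.solve-∀

-- A stretch that was no threat earlier had few points then, so most of its points are new.
new-halves : ∀ {m D M Q B} → Unique M → Disjoint (M ++ Q) B → ¬ Threat m M B → 3 * m ≤ D →
  ∀ {B*} → B ⊑ B* → (t : Threat D (M ++ Q) B*) → Halves Q m t
new-halves {m} {D} {M} {Q} {B} uniq disj quiet 3m≤D B⊑B* t@(threat c v dv i j isT@(_ , _ , _ , (many⁺ , many⁻))) =
  remaining many⁺ (old-few (λ x∈ → let k , k<j , e = ∈-ray⁻ c v x∈ in ℤ.+ suc k , ℤₚ.neg-≤-pos {i} {suc k} , ℤ.+≤+ k<j , e))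
  , remaining many⁻ (old-few (λ x∈ → let k , k<i , e = ∈-ray⁻ c (neg v) x∈ in ℤ.-[1+ k ] , ℤₚ.neg-mono-≤ (ℤ.+≤+ k<i) , ℤ.-≤+ , trans e (at-neg c v (ℤ.+ suc k))))
  where
  isT′ = Threat.isThreat (weaken-threat {D} {D} ≤-refl B⊑B* t)
  p = at c v ℤ.-[1+ i ]
  n = i + suc j
  hole = stretch-gap {D} isT
  hole-index = stretch-in-ray c v i j (proj₁ hole) (proj₁ (proj₂ hole)) (proj₁ (proj₂ (proj₂ hole)))
  -- With `2 * m + 1` old points the stretch would already have been a threat: Breaker had no
  -- further points then, and a point outside `M ++ Q` is outside `M`.
  all-few : tally (rayPoints p v n) M ≤ m + m
  all-few = ℕₚ.≮⇒≥ (λ many → quiet (ray-threat p v n dv uniq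
    (λ k k<n k∈B → let w , lo , hi , e = ray-in-stretch c v i j k k<n in stretch-free {D} disj isT′ w lo hi (subst (_∈ B) e k∈B))
    (proj₁ hole-index) (proj₁ (proj₂ hole-index))
    (λ u∈M → proj₂ (proj₂ (proj₂ hole)) (∈-++⁺ˡ (subst (_∈ M) (proj₂ (proj₂ hole-index)) u∈M))) many))
  old-few : ∀ {R} → (∀ {x} → x ∈ R → ∃[ w ] ℤ.- (ℤ.+ i) ℤ.≤ w × w ℤ.≤ ℤ.+ j × x ≡ at c v w) → tally R M ≤ m + m
  old-few h = ≤-trans (tally-mono M (λ _ x∈ → let w , lo , hi , e = h x∈ ; k , k<n , e′ = stretch-in-ray c v i j w lo hi
    in subst (_∈ rayPoints p v n) (trans e′ (sym e)) (∈-ray⁺ p v k<n))) all-few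
  remaining : ∀ {R} → D ≤ tally R (M ++ Q) → tally R M ≤ m + m → m ≤ tally R Q
  remaining {R} many few = ℕₚ.+-cancelˡ-≤ (m + m) _ _ (≤-trans (≤-reflexive (lemma m)) (≤-trans 3m≤D (≤-trans many
    (≤-trans (≤-reflexive (tally-++ R M Q)) (ℕₚ.+-monoˡ-≤ (tally R Q) few)))))
    where
    lemma : ∀ m → m + m + m ≡ 3 * m
    lemma = ℕ-Ring.solve-∀

-- Winning segments

between-sym : ∀ {a b x} → Between a b x → Between b a x
between-sym (inj₁ h) = inj₂ h
between-sym (inj₂ h) = inj₁ h

onSegment-sym : ∀ p q x → OnSegment p q x → OnSegment q p x
onSegment-sym (p₁ , p₂) (q₁ , q₂) (x₁ , x₂) (col , b₁ , b₂) =
  trans (flip p₁ p₂ q₁ q₂ x₁ x₂) (trans (cong (λ c → (q₂ ℤ.- p₂) ℤ.* (x₁ ℤ.- p₁) ℤ.- c ℤ.+ (p₂ ℤ.- q₂) ℤ.*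
      (x₁ ℤ.- q₁)) col)
    (cancel ((q₂ ℤ.- p₂) ℤ.* (x₁ ℤ.- p₁)) ((p₂ ℤ.- q₂) ℤ.* (x₁ ℤ.- q₁)))) , between-sym b₁ , between-sym b₂
  where
  flip : ∀ p₁ p₂ q₁ q₂ x₁ x₂ → (p₁ ℤ.- q₁) ℤ.* (x₂ ℤ.- q₂) ≡
    (q₂ ℤ.- p₂) ℤ.* (x₁ ℤ.- p₁) ℤ.- (q₁ ℤ.- p₁) ℤ.* (x₂ ℤ.- p₂) ℤ.+ (p₂ ℤ.- q₂) ℤ.* (x₁ ℤ.- q₁)
  flip = ℤ-Ring.solve-∀
  cancel : ∀ a b → a ℤ.- a ℤ.+ b ≡ b
  cancel = ℤ-Ring.solve-∀

between-multiple : ∀ c w {k z} → 0ℤ ℤ.≤ k → k ℤ.≤ z → Between c (c ℤ.+ z ℤ.* w) (c ℤ.+ k ℤ.* w)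
between-multiple c w {k} {z} 0≤k k≤z with ℤₚ.≤-total 0ℤ w
... | inj₁ 0≤w = inj₁ (subst (ℤ._≤ c ℤ.+ k ℤ.* w) (at-zero c w)
    (ℤₚ.+-monoʳ-≤ c (ℤₚ.*-monoʳ-≤-nonNeg w {{ℤ.nonNegative 0≤w}} 0≤k))
                      , ℤₚ.+-monoʳ-≤ c (ℤₚ.*-monoʳ-≤-nonNeg w {{ℤ.nonNegative 0≤w}} k≤z))
  where
  at-zero : ∀ c w → c ℤ.+ 0ℤ ℤ.* w ≡ c
  at-zero = ℤ-Ring.solve-∀
... | inj₂ w≤0 = inj₂ (ℤₚ.+-monoʳ-≤ c (ℤₚ.*-monoʳ-≤-nonPos w {{ℤ.nonPositive w≤0}} k≤z)
                      , subst (c ℤ.+ k ℤ.* w ℤ.≤_) (at-zero c w)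
                          (ℤₚ.+-monoʳ-≤ c (ℤₚ.*-monoʳ-≤-nonPos w {{ℤ.nonPositive w≤0}} 0≤k)))
  where
  at-zero : ∀ c w → c ℤ.+ 0ℤ ℤ.* w ≡ c
  at-zero = ℤ-Ring.solve-∀

at-onSegment : ∀ p v {k z} → 0ℤ ℤ.≤ k → k ℤ.≤ z → OnSegment p (at p v z) (at p v k)
at-onSegment (p₁ , p₂) (v₁ , v₂) {k} {z} 0≤k k≤z = collinear p₁ p₂ v₁ v₂ k z , between-multiple p₁ v₁ 0≤k k≤z , between-multiple p₂ v₂ 0≤k k≤z
  where
  collinear : ∀ p q v w k z → (p ℤ.+ z ℤ.* v ℤ.- p) ℤ.* (q ℤ.+ k ℤ.* w ℤ.- q) ≡ (q ℤ.+ z ℤ.* w ℤ.- q) ℤ.*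
      (p ℤ.+ k ℤ.* v ℤ.- p)
  collinear = ℤ-Ring.solve-∀

+-cancelˡ-≤-ℤ : ∀ c {a b} → c ℤ.+ a ℤ.≤ c ℤ.+ b → a ℤ.≤ b
+-cancelˡ-≤-ℤ c {a} {b} h = subst₂ ℤ._≤_ (lemma c a) (lemma c b) (ℤₚ.+-monoʳ-≤ (ℤ.- c) h)
  where
  lemma : ∀ c a → ℤ.- c ℤ.+ (c ℤ.+ a) ≡ a
  lemma = ℤ-Ring.solve-∀

multiple-between : ∀ c w {k z} → 0ℤ ℤ.< w → 0ℤ ℤ.< z → Between c (c ℤ.+ z ℤ.* w) (c ℤ.+ k ℤ.* w) → 0ℤ ℤ.≤ k × k ℤ.≤ z
multiple-between c w {k} {z} 0<w 0<z b = go b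
  where
  instance
    w-positive = ℤ.positive 0<w
  at-zero : ∀ c w → c ≡ c ℤ.+ 0ℤ ℤ.* w
  at-zero = ℤ-Ring.solve-∀
  compare : ∀ a b → c ℤ.+ a ℤ.* w ℤ.≤ c ℤ.+ b ℤ.* w → a ℤ.≤ b
  compare a b h = ℤₚ.*-cancelʳ-≤-pos a b w (+-cancelˡ-≤-ℤ c h)
  go : Between c (c ℤ.+ z ℤ.* w) (c ℤ.+ k ℤ.* w) → 0ℤ ℤ.≤ k × k ℤ.≤ z
  go (inj₁ (lo , hi)) = compare 0ℤ k (subst (ℤ._≤ c ℤ.+ k ℤ.* w) (at-zero c w) lo) , compare k z hi
  go (inj₂ (lo , hi)) = ⊥-elim (ℤₚ.<⇒≱ 0<z (ℤₚ.≤-trans (compare z k lo)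
      (compare k 0ℤ (subst (c ℤ.+ k ℤ.* w ℤ.≤_) (at-zero c w) hi))))

onSegment-at : ∀ p v {z} x → Direction v → 0ℤ ℤ.< z → OnSegment p (at p v z) x →
    ∃[ k ] 0ℤ ℤ.≤ k × k ℤ.≤ z × x ≡ at p v k
onSegment-at p@(p₁ , p₂) v@(v₁ , v₂) {z} x@(x₁ , x₂) (prim , lex) 0<z
    (col , b₁ , b₂) = k , proj₁ range , proj₂ range , x≡
  where
  strip : ∀ p v z d → (p ℤ.+ z ℤ.* v ℤ.- p) ℤ.* d ≡ z ℤ.* (v ℤ.* d)
  strip = ℤ-Ring.solve-∀
  par : Parallel v (x ⊝ p)
  par = *-cancel-nonzero {z} (λ z≡0 → ℤₚ.<-irrefl (sym z≡0) 0<z) (trans (sym (strip p₁ v₁ z (x₂ ℤ.- p₂)))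
      (trans col (strip p₂ v₂ z (x₁ ℤ.- p₁))))
  multiple = parallel⇒multiple v (x ⊝ p) prim par
  k = proj₁ multiple
  x≡ : x ≡ at p v k
  x≡ = at-⊝-scale p x v k (proj₂ multiple)
  range : 0ℤ ℤ.≤ k × k ℤ.≤ z
  range = [ (λ 0<v₁ → multiple-between p₁ v₁ 0<v₁ 0<z (subst (Between p₁ (p₁ ℤ.+ z ℤ.* v₁)) (cong proj₁ x≡) b₁))
          , (λ (_ , 0<v₂) → multiple-between p₂ v₂ 0<v₂ 0<z (subst (Between p₂ (p₂ ℤ.+ z ℤ.* v₂))
              (cong proj₂ x≡) b₂)) ]′ lex

between-same : ∀ {a x} → Between a a x → x ≡ a
between-same (inj₁ (p , q)) = ℤₚ.≤-antisym q p
between-same (inj₂ (p , q)) = ℤₚ.≤-antisym q p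

tally-≤-length : ∀ R Q → tally R Q ≤ length Q
tally-≤-length R Q = count-≤-length (_∈? R) Q

-- At most `length new` of the `n` winning points are new, so the segment contains `2 * D + 1` old
-- ones. This makes it a threat unless Maker had filled it, and in that case `S` consists of old
-- points.
no-win-along : ∀ {n D M B new} → Unique M → ¬ Threat D M B → suc (D + D) + length new ≤ n →
  ∀ S → Unique S → length S ≡ n → All (_∈ M ++ new) S → ¬ All (_∈ M) S → ∀ p v g → Direction v →
  All (OnSegment p (at p v (ℤ.+ suc g))) S → ¬ All (λ b → ¬ OnSegment p (at p v (ℤ.+ suc g)) b) B
no-win-along {n} {D} {M} {B} {new} uniq quiet enough S S-uniq S-length S∈ S∉M p v g dv S-on B-off = decide
    (any? (λ x → ¬? (x ∈? M)) R)
  where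
  b = at p v ℤ.-[1+ 0 ]
  R = rayPoints b v (suc (suc g))
  reindex : ∀ k → at b v (ℤ.+ suc k) ≡ at p v (ℤ.+ k)
  reindex k = at-shift p v ℤ.-[1+ 0 ] (ℤ.+ suc k) (ℤ.+ k) refl
  S⊑R : ∀ {x} → x ∈ S → x ∈ R
  S⊑R {x} i = locate (onSegment-at p v x dv (ℤ.+<+ (s≤s z≤n)) (All.lookup S-on i))
    where
    locate : (∃[ k ] 0ℤ ℤ.≤ k × k ℤ.≤ ℤ.+ suc g × x ≡ at p v k) → x ∈ R
    locate (ℤ.+ k , _ , ℤ.+≤+ k≤ , eq) = subst (_∈ R) (trans (reindex k) (sym eq)) (∈-ray⁺ b v (s≤s k≤))
  free : ∀ k → k < suc (suc g) → at b v (ℤ.+ suc k) ∉ B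
  free k k< i = All.lookup B-off (subst (_∈ B) (reindex k) i) (at-onSegment p v (ℤ.+≤+ z≤n) (ℤ.+≤+ (ℕₚ.≤-pred k<)))
  many : suc (D + D) ≤ tally R M
  many = ℕₚ.+-cancelʳ-≤ (length new) _ _ (begin
    suc (D + D) + length new ≤⟨ enough ⟩
    n ≡⟨ sym S-length ⟩
    length S ≤⟨ unique-⊆⇒length-≤ S-uniq (λ i → ∈-filter⁺ (_∈? R) (All.lookup S∈ i) (S⊑R i)) ⟩
    length (filter (_∈? R) (M ++ new)) ≡⟨ length-filter-≡ (_∈? R) (M ++ new) ⟩
    tally R (M ++ new) ≡⟨ tally-++ R M new ⟩
    tally R M + tally R new ≤⟨ ℕₚ.+-monoʳ-≤ (tally R M) (tally-≤-length R new) ⟩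
    tally R M + length new ∎)
    where open ℕₚ.≤-Reasoning
  decide : Dec (Any (_∉ M) R) → ⊥
  decide (yes gap) = let x , x∈ , x∉ = find gap ; u , u< , eq = ∈-ray⁻ b v x∈
    in quiet (ray-threat b v (suc (suc g)) dv uniq free u u< (subst (_∉ M) eq x∉) many)
  decide (no full) = S∉M (All.tabulate (λ i → inside-M (S⊑R i)))
    where
    inside-M : ∀ {x} → x ∈ R → x ∈ M
    inside-M {x} i with x ∈? M
    ... | yes x∈ = x∈
    ... | no x∉ = ⊥-elim (full (lose i x∉))

-- `2 ≤ n` excludes a segment of a single point. If `q` precedes `p` in the normalised direction,
-- the two ends are exchanged.
no-win : ∀ {n D M B new} → Unique M → ¬ Threat D M B → suc (D + D) + length new ≤ n → 2 ≤ n →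
  ¬ WinningSegment n M B → ¬ WinningSegment n (M ++ new) B
no-win {n} {D} {M} {B} {new} uniq quiet enough 2≤n before (S , p , q , S-uniq , S-length , S∈ , p∈ , q∈ , S-on , B-off) =
  conclude (line-through p q)
  where
  S∉M : ¬ All (_∈ M) S
  S∉M S∈M = before (S , p , q , S-uniq , S-length , S∈M , p∈ , q∈ , S-on , B-off)
  along = no-win-along {n} {D} {M} {B} {new} uniq quiet enough
  trivial : q ≡ p → ⊥
  trivial refl = ℕₚ.<⇒≱ 2≤n (≤-trans (≤-reflexive (sym S-length)) (unique-⊆⇒length-≤ {ys = p ∷ []} S-uniq
    (λ i → here (let _ , b₁ , b₂ = All.lookup S-on i in cong₂ _,_ (between-same b₁) (between-same b₂)))))
  conclude : (∃[ v ] Direction v × ∃[ z ] q ≡ at p v z) → ⊥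
  conclude (v , dv , ℤ.+ zero , eq) = trivial (trans eq (at-0 p v))
  conclude (v , dv , ℤ.+ suc g , refl) = along S S-uniq S-length S∈ S∉M p v g dv S-on B-off
  conclude (v , dv , ℤ.-[1+ g ] , eq) = along S S-uniq S-length S∈ S∉M q v g dv
    (All.map (λ {x} h → subst (λ e → OnSegment q e x) p≡ (onSegment-sym p q x h)) S-on)
    (All.map (λ {x} h on → h (onSegment-sym q p x (subst (λ e → OnSegment q e x) (sym p≡) on))) B-off)
    where
    p≡ : p ≡ at q v (ℤ.+ suc g)
    p≡ = trans (sym (at-0 p v)) (trans (sym (at-shift p v ℤ.-[1+ g ] (ℤ.+ suc g) 0ℤ (ℤₚ.+-inverseˡ (ℤ.+ suc g))))
        (cong (λ r → at r v (ℤ.+ suc g)) (sym eq)))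

-- The course of the game

-- M k and B k are the points claimed in the first k timesteps; the move of Maker in timestep k + 1 is legal if k < end.
record Game (ls : Levels) (end : ℕ) : Set where
  field
    M B move : ℕ → List Pt
    M-zero : M 0 ≡ []
    B-zero : B 0 ≡ []
    M-suc : ∀ k → M (suc k) ≡ M k ++ move k
    B-suc : ∀ k → B (suc k) ≡ B k ++ reply ls (length (move k)) (M (suc k)) (B k)
    legal : ∀ k → k < end → LegalMove (suc k) (M k ++ B k) (move k)

unique-++⁻ʳ : ∀ (xs : List Pt) {ys} → Unique (xs ++ ys) → Unique ys
unique-++⁻ʳ [] u = u
unique-++⁻ʳ (x ∷ xs) (_ ∷ u) = unique-++⁻ʳ xs u

empty-no-threat : ∀ {μ B} → ¬ Threat μ [] B
empty-no-threat (threat _ _ _ _ _ (() , _))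

-- The number of rounds in the first `u` turns, which is `u² / 4` rounded down. A later window has
-- longer turns, so this is a lower bound for every window of `u` turns.
staircase : ℕ → ℕ
staircase zero = 0
staircase (suc u) = ⌊ suc u /2⌋ + staircase u

square≤staircase : ∀ u → square u ≤ 4 * staircase u + 1
square≤staircase zero = z≤n
square≤staircase (suc zero) = ≤-refl
square≤staircase (suc (suc u)) = begin
  square (2 + u) ≡⟨ expand u ⟩
  square u + 4 * (1 + u) ≤⟨ ℕₚ.+-monoˡ-≤ (4 * (1 + u)) (square≤staircase u) ⟩
  4 * staircase u + 1 + 4 * (1 + u) ≡⟨ cong (λ s → 4 * staircase u + 1 + 4 * (1 + s)) (sym (ℕₚ.⌊n/2⌋+⌈n/2⌉≡n u)) ⟩
  4 * staircase u + 1 + 4 * (1 + (⌊ u /2⌋ + ⌈ u /2⌉)) ≡⟨ collect (staircase u) ⌊ u /2⌋ ⌈ u /2⌉ ⟩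
  4 * (suc ⌊ u /2⌋ + (⌈ u /2⌉ + staircase u)) + 1 ∎
  where
  open ℕₚ.≤-Reasoning
  expand : ∀ u → (2 + u) * (2 + u) ≡ u * u + 4 * (1 + u)
  expand = ℕ-Ring.solve-∀
  collect : ∀ s f c → 4 * s + 1 + 4 * (1 + (f + c)) ≡ 4 * (suc f + (c + s)) + 1
  collect = ℕ-Ring.solve-∀

module _ {ls : Levels} {end : ℕ} (game : Game ls end) where
  open Game game
  open Levels ls using (low; high)

  B-grows : ∀ i d → B i ⊑ B (i + d)
  B-grows i zero {x} x∈ = subst (λ k → x ∈ B k) (sym (ℕₚ.+-identityʳ i)) x∈
  B-grows i (suc d) {x} x∈ = subst (λ k → x ∈ B k) (sym (ℕₚ.+-suc i d)) (subst (x ∈_) (sym (B-suc (i + d)))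
      (∈-++⁺ˡ (B-grows i d x∈)))

  B-mono : ∀ {i j} → i ≤ j → B i ⊑ B j
  B-mono {i} {j} i≤j {x} x∈ = subst (λ k → x ∈ B k) (ℕₚ.m+[n∸m]≡n i≤j) (B-grows i (j ∸ i) x∈)

  appended : ∀ t u → t + u ≤ end → ∃[ Q ] M (t + u) ≡ M t ++ Q × length Q ≤ u * (t + u)
  appended t zero _ = [] , trans (cong M (ℕₚ.+-identityʳ t)) (sym (++-identityʳ (M t))) , z≤n
  appended t (suc u) le =
    let lt = subst (_≤ end) (ℕₚ.+-suc t u) le
        Q , eq , len = appended t u (ℕₚ.<⇒≤ lt)
    in Q ++ move (t + u)
       , trans (cong M (ℕₚ.+-suc t u)) (trans (M-suc (t + u)) (trans (cong (_++ move (t + u)) eq)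
           (++-assoc (M t) Q (move (t + u)))))
       , (begin
           length (Q ++ move (t + u)) ≡⟨ length-++ Q ⟩
           length Q + length (move (t + u)) ≡⟨ cong (length Q +_) (proj₁ (legal (t + u) lt)) ⟩
           length Q + suc (t + u) ≤⟨ ℕₚ.+-monoˡ-≤ (suc (t + u)) (≤-trans len (ℕₚ.*-monoʳ-≤ u (ℕₚ.n≤1+n (t + u)))) ⟩
           u * suc (t + u) + suc (t + u) ≡⟨ ℕₚ.+-comm (u * suc (t + u)) (suc (t + u)) ⟩
           suc u * suc (t + u) ≡⟨ cong (suc u *_) (sym (ℕₚ.+-suc t u)) ⟩
           suc u * (t + suc u) ∎)
    where open ℕₚ.≤-Reasoning

  appended-between : ∀ {t T} → t ≤ T → T ≤ end → ∃[ Q ] M T ≡ M t ++ Q × length Q ≤ (T ∸ t) * T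
  appended-between {t} {T} t≤T T≤ = subst (λ s → ∃[ Q ] M s ≡ M t ++ Q × length Q ≤ (T ∸ t) * s) (ℕₚ.m+[n∸m]≡n t≤T)
    (appended t (T ∸ t) (subst (_≤ end) (sym (ℕₚ.m+[n∸m]≡n t≤T)) T≤))

  length-M : ∀ T → T ≤ end → length (M T) ≤ T * T
  length-M T T≤ = let Q , eq , len = appended 0 T T≤ in
    ≤-trans (≤-reflexive (cong length (trans eq (cong (_++ Q) M-zero)))) len

  M-mono : ∀ {t T} → t ≤ T → T ≤ end → M t ⊑ M T
  M-mono t≤T T≤ {x} x∈ = let Q , eq , _ = appended-between t≤T T≤ in subst (x ∈_) (sym eq) (∈-++⁺ˡ x∈)

  mutual
    disjoint : ∀ k → k ≤ end → Disjoint (M k) (B k)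
    disjoint zero _ {x} x∈M _ = contradiction (subst (x ∈_) M-zero x∈M) (λ ())
    disjoint (suc k) k< {x} x∈M x∈B = [ disjoint-mid k k< x∈M ,
        (λ i → All.lookup (proj₂ (reply-fresh ls (length (move k)) (M (suc k)) (B k))) i (∈-++⁺ˡ x∈M)) ]′
      (∈-++⁻ (B k) (subst (x ∈_) (B-suc k) x∈B))

    disjoint-mid : ∀ k → k < end → Disjoint (M (suc k)) (B k)
    disjoint-mid k k< {x} x∈M x∈B = [ (λ i → disjoint k (ℕₚ.<⇒≤ k<) i x∈B) ,
        (λ i → All.lookup (proj₂ (proj₂ (legal k k<))) i (∈-++⁺ʳ (M k) x∈B)) ]′
      (∈-++⁻ (M k) (subst (x ∈_) (M-suc k) x∈M))

  unique-M : ∀ k → k ≤ end → Unique (M k)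
  unique-M zero _ = subst Unique (sym M-zero) []
  unique-M (suc k) k< = subst Unique (sym (M-suc k)) (Uniqueₚ.++⁺ (unique-M k (ℕₚ.<⇒≤ k<))
      (proj₁ (proj₂ (legal k k<)))
    (λ (x∈M , x∈m) → All.lookup (proj₂ (proj₂ (legal k k<))) x∈m (∈-++⁺ˡ x∈M)))

  low-threat? : ∀ T → Dec (Threat low (M T) (B T))
  low-threat? T = threat? low (M T) (B T) (Levels.low-positive ls)

  -- Time `0` is quiet because Maker has no points, so a loud window never extends before the start
  -- of the game.
  recent-quiet : ∀ w T → (∃[ T₀ ] T₀ ≤ T × T ≤ T₀ + w × ¬ Threat low (M T₀) (B T₀))
    ⊎ (∃[ t ] t + w ≡ T × (∀ u → u < w → Threat low (M (suc (t + u))) (B (suc (t + u)))))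
  recent-quiet zero T = inj₂ (T , ℕₚ.+-identityʳ T , λ _ ())
  recent-quiet (suc w) zero = inj₁ (0 , z≤n , z≤n , λ th → empty-no-threat
      (subst (λ X → Threat low X (B 0)) M-zero th))
  recent-quiet (suc w) (suc T) with low-threat? (suc T)
  ... | no ¬th = inj₁ (suc T , ≤-refl , m≤m+n (suc T) (suc w) , ¬th)
  ... | yes th with recent-quiet w T
  ...   | inj₁ (T₀ , T₀≤T , T≤ , ¬th) = inj₁ (T₀ , ℕₚ.m≤n⇒m≤1+n T₀≤T , ≤-trans (s≤s T≤)
      (≤-reflexive (sym (ℕₚ.+-suc T₀ w))) , ¬th)
  ...   | inj₂ (t , refl , loud) = inj₂ (t , ℕₚ.+-suc t w , λ u u<sw → extend u u<sw (u ℕₚ.≟ w))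
    where
    extend : ∀ u → u < suc w → Dec (u ≡ w) → Threat low (M (suc (t + u))) (B (suc (t + u)))
    extend u _ (yes refl) = th
    extend u u<sw (no u≢w) = loud u (ℕₚ.≤∧≢⇒< (ℕₚ.≤-pred u<sw) u≢w)

  RichFamily : List Pt → ℕ → Set
  RichFamily Q j = ∃[ Fs ] j ≤ length Fs × All (Owns Q low) Fs × AllPairs Separate Fs

  turn : ∀ {μ Q Fs} k → k < end → Unique Q → (∀ M B → Attends ls μ M B) →
    (∀ {B*} → B k ⊑ B* → (t : Threat μ (M (suc k)) B*) → Halves Q low t) → Family Q low (M k) (B k) Fs →
    Threat μ (M (suc k)) (B (suc k)) → ∃[ Fs′ ] length Fs′ ≡ ⌊ suc k /2⌋ + length Fs × Family Q low (M (suc k))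
        (B (suc k)) Fs′
  turn {μ} {Q} {Fs} k k< uniq attends halves fam th =
    let Fs′ , len , fam′ = turn-family ls (length (move k)) uniq (disjoint-mid k k<) (attends (M (suc k)) (B k)) halves
                             (family-mono (M-mono (ℕₚ.n≤1+n k) k<) (λ i → i) fam) (subst (Threat μ (M (suc k)))
                                 (B-suc k) th)
    in Fs′ , trans len (cong (λ s → ⌊ s /2⌋ + length Fs) (proj₁ (legal k k<))) , subst
        (λ X → Family Q low (M (suc k)) X Fs′) (sym (B-suc k)) fam′

  -- Maker's points only increase, so the final set `M T` can serve as `Q` in every turn of the
  -- window, and the rays of earlier turns need no adjustment.
  all-halves : ∀ {T t B*} → t ≤ T → T ≤ end → (th : Threat low (M t) B*) → Halves (M T) low th
  all-halves {T} {t} t≤T T≤ (threat c v dv i j (_ , _ , _ , (many⁺ , many⁻))) =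
    let Q , eq , _ = appended-between t≤T T≤
        more = λ R → ≤-trans (m≤m+n (tally R (M t)) (tally R Q))
            (≤-reflexive (trans (sym (tally-++ R (M t) Q)) (cong (tally R) (sym eq))))
    in ≤-trans many⁺ (more (rayPoints c v j)) , ≤-trans many⁻ (more (rayPoints c (neg v) i))

  loud-family : ∀ {T} t w → t + w ≤ T → T ≤ end → (∀ u → u < w → Threat low (M (suc (t + u))) (B (suc (t + u)))) →
    ∃[ Fs ] staircase w ≤ length Fs × Family (M T) low (M (t + w)) (B (t + w)) Fs
  loud-family t zero _ _ _ = [] , z≤n , family [] [] []
  loud-family {T} t (suc w) t+w≤ T≤ loud =
    let lt = subst (_≤ T) (ℕₚ.+-suc t w) t+w≤
        Fs , large , fam = loud-family t w (ℕₚ.<⇒≤ lt) T≤ (λ u u<w → loud u (ℕₚ.m<n⇒m<1+n u<w))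
        Fs′ , len , fam′ = turn (t + w) (≤-trans lt T≤) (unique-M T T≤) (attends-low ls)
            (λ _ th → all-halves lt T≤ th) fam (loud w ≤-refl)
    in Fs′ , ≤-trans (+-mono-≤ (ℕₚ.⌊n/2⌋-mono (s≤s (m≤n+m w t))) large) (≤-reflexive (sym len))
       , subst (λ s → Family (M T) low (M s) (B s) Fs′) (sym (ℕₚ.+-suc t w)) fam′

  grow-rich : ∀ {Q Fs T μ} → T ≤ end → Unique Q → Family Q low (M T) (B T) Fs → (th : Threat μ (M T) (B T)) →
      Halves Q low th → RichFamily Q (suc (length Fs))
  grow-rich {Fs = Fs} {T} T≤ uniq fam th halves =
    let _ , owns , sep = grow uniq (disjoint T T≤) fam th halves in _ ∷ Fs , ≤-refl , owns , sep

  -- After a quiet time only the last turn is used, and `Q` holds the points claimed since then; in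
  -- a loud window all its turns are used, with `Q` equal to `M T`. The surviving threat accounts
  -- for the `suc` in both bounds.
  many-rich : ∀ w T → T ≤ end → 3 * low ≤ high → Threat high (M T) (B T) →
    (∃[ Q ] Unique Q × length Q ≤ w * T × RichFamily Q (suc ⌊ T /2⌋)) ⊎ RichFamily (M T) (suc (staircase w))
  many-rich w T T≤ 3low≤high th with recent-quiet w T
  many-rich w .(t + w) T≤ 3low≤high th | inj₂ (t , refl , loud) =
    let Fs , large , fam = loud-family t w ≤-refl T≤ loud
        th′ = weaken-threat (Levels.low≤high ls) (λ i → i) th
        Fs′ , large′ , rich = grow-rich T≤ (unique-M (t + w) T≤) fam th′ (all-halves ≤-refl T≤ th′)
    in inj₂ (Fs′ , ≤-trans (s≤s large) large′ , rich)
  many-rich w zero T≤ 3low≤high th | inj₁ _ = ⊥-elim (empty-no-threat (subst (λ X → Threat high X (B 0)) M-zero th))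
  many-rich w (suc k) T≤ 3low≤high th | inj₁ (T₀ , T₀≤ , T≤T₀+w , quiet) with T₀ ℕₚ.≟ suc k
  -- A high threat is also a low one, so the quiet time is strictly before the last turn, which is
  -- then played entirely after it.
  ... | yes refl = ⊥-elim (quiet (weaken-threat (Levels.low≤high ls) (λ i → i) th))
  ... | no T₀≢ = inj₁ (Q , Q-uniq , ≤-trans len (ℕₚ.*-monoˡ-≤ (suc k) (ℕₚ.m≤n+o⇒m∸n≤o (suc k) T₀ T≤T₀+w)) , rich)
    where
    T₀≤k : T₀ ≤ k
    T₀≤k = ℕₚ.≤-pred (ℕₚ.≤∧≢⇒< T₀≤ T₀≢)
    suffix = appended-between T₀≤ T≤
    Q = proj₁ suffix
    eq = proj₁ (proj₂ suffix)
    len = proj₂ (proj₂ suffix)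
    Q-uniq : Unique Q
    Q-uniq = unique-++⁻ʳ (M T₀) (subst Unique eq (unique-M (suc k) T≤))
    halves : ∀ {B*} → B k ⊑ B* → (t : Threat high (M (suc k)) B*) → Halves Q low t
    halves Bk⊑ = subst (λ X → Disjoint X (B T₀) → ∀ {B*} → B T₀ ⊑ B* → (t : Threat high X B*) → Halves Q low t)
        (sym eq)
      (λ disj → new-halves (unique-M T₀ (≤-trans T₀≤ T≤)) disj quiet 3low≤high)
      (λ x∈M x∈B → disjoint-mid k T≤ x∈M (B-mono T₀≤k x∈B)) (λ i → Bk⊑ (B-mono T₀≤k i))
    rich : RichFamily Q (suc ⌊ suc k /2⌋)
    rich = let Fs , lenF , fam = turn k T≤ Q-uniq (attends-high ls) halves (family [] [] []) th
               Fs′ , large , r = grow-rich T≤ Q-uniq fam th (halves (B-mono (ℕₚ.n≤1+n k)) th)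
           in Fs′ , ≤-trans (≤-reflexive (cong suc (trans (sym (ℕₚ.+-identityʳ _)) (sym lenF)))) large , r

  -- Induction on the turns: Breaker's further points cannot create a winning segment, so its
  -- absence after one move of Maker is still available at the next.
  no-win-at : ∀ {n} → 2 ≤ n → (∀ k → k < end → ¬ Threat high (M k) (B k)) → suc (high + high) + end ≤ n →
    ∀ k → k < end → ¬ WinningSegment n (M (suc k)) (B k)
  no-win-at {n} 2≤n calm enough k k< = subst (λ X → ¬ WinningSegment n X (B k)) (sym (M-suc k))
    (no-win (unique-M k (ℕₚ.<⇒≤ k<)) (calm k k<)
      (≤-trans (ℕₚ.+-monoʳ-≤ (suc (high + high)) (≤-trans (≤-reflexive (proj₁ (legal k k<))) k<)) enough) 2≤n
          (before k k<))
    where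
    before : ∀ k → k < end → ¬ WinningSegment n (M k) (B k)
    before zero _ (S , p , q , _ , _ , S∈ , p∈ , _) = contradiction (subst (p ∈_) M-zero (All.lookup S∈ p∈)) (λ ())
    before (suc k) k< (S , p , q , u , l , S∈ , p∈ , q∈ , on , off) =
      no-win-at 2≤n calm enough k (ℕₚ.<⇒≤ k<) (S , p , q , u , l , S∈ , p∈ , q∈ , on , All.tabulate
          (λ i → All.lookup off (B-mono (ℕₚ.n≤1+n k) i)))

-- Parameters

absurd-multiple : ∀ {a b x} → b < a → 1 ≤ x → ¬ a * x ≤ b * x
absurd-multiple {a} {b} {x} b<a 1≤x h = ℕₚ.<⇒≱ b<a (ℕₚ.*-cancelʳ-≤ a b x {{>-nonZero 1≤x}} h)

-- After doubling, the rays need `120 * (a * j)` incidences, but `L` provides only `4 * (a * j)` and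
-- the pairs of rays at most `j * j`, which is at most `30 * a * j`.
few-contradiction : ∀ {a j w T L} → 1 ≤ a → 1 ≤ j → w ≤ a → L ≤ w * T → T ≤ 2 * j → j ≤ 30 * a →
  ¬ j * (60 * a) ≤ L + choose2 j
few-contradiction {a} {j} {w} {T} {L} 1≤a 1≤j w≤a L≤ T≤ j≤ h =
  absurd-multiple {120} {34} {a * j} (ℕₚ.<ᵇ⇒< 34 120 _) (*-mono-≤ 1≤a 1≤j) (begin
    120 * (a * j) ≡⟨ double a j ⟩
    2 * (j * (60 * a)) ≤⟨ ℕₚ.*-monoʳ-≤ 2 h ⟩
    2 * (L + choose2 j) ≡⟨ ℕₚ.*-distribˡ-+ 2 L (choose2 j) ⟩
    2 * L + 2 * choose2 j ≤⟨ +-mono-≤ (ℕₚ.*-monoʳ-≤ 2 (≤-trans L≤ (*-mono-≤ w≤a T≤)))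
        (≤-trans (m≤m+n (2 * choose2 j) j) (≤-reflexive (double-choose2 j))) ⟩
    2 * (a * (2 * j)) + j * j ≤⟨ ℕₚ.+-monoʳ-≤ (2 * (a * (2 * j))) (ℕₚ.*-monoˡ-≤ j j≤) ⟩
    2 * (a * (2 * j)) + 30 * a * j ≡⟨ collect a j ⟩
    34 * (a * j) ∎)
  where
  open ℕₚ.≤-Reasoning
  double : ∀ a j → 120 * (a * j) ≡ 2 * (j * (60 * a))
  double = ℕ-Ring.solve-∀
  collect : ∀ a j → 2 * (a * (2 * j)) + 30 * a * j ≡ 34 * (a * j)
  collect = ℕ-Ring.solve-∀

-- Exactly `30 * a` rays are considered, because for too many rays the pairs would outweigh the
-- incidences. With `a = q * w` and `L ≤ 840 * (a * a)`, doubling compares `3600` with `1680 + 900`.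
many-contradiction : ∀ {q w T L} → 1 ≤ q * w → L ≤ w * T → T ≤ 840 * q * (q * w) →
  ¬ (30 * (q * w)) * (60 * (q * w)) ≤ L + choose2 (30 * (q * w))
many-contradiction {q} {w} {T} {L} 1≤a L≤ T≤ h =
  absurd-multiple {3600} {2580} {a * a} (ℕₚ.<ᵇ⇒< 2580 3600 _) (*-mono-≤ 1≤a 1≤a) (begin
    3600 * (a * a) ≡⟨ double a ⟩
    2 * ((30 * a) * (60 * a)) ≤⟨ ℕₚ.*-monoʳ-≤ 2 h ⟩
    2 * (L + choose2 (30 * a)) ≡⟨ ℕₚ.*-distribˡ-+ 2 L (choose2 (30 * a)) ⟩
    2 * L + 2 * choose2 (30 * a)
      ≤⟨ +-mono-≤ (ℕₚ.*-monoʳ-≤ 2 (≤-trans L≤ (ℕₚ.*-monoʳ-≤ w T≤)))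
          (≤-trans (m≤m+n (2 * choose2 (30 * a)) (30 * a)) (≤-reflexive (double-choose2 (30 * a)))) ⟩
    2 * (w * (840 * q * a)) + 30 * a * (30 * a) ≡⟨ collect q w a ⟩
    1680 * ((q * w) * a) + 900 * (a * a) ≡⟨ sum (a * a) ⟩
    2580 * (a * a) ∎)
  where
  open ℕₚ.≤-Reasoning
  a = q * w
  double : ∀ a → 3600 * (a * a) ≡ 2 * ((30 * a) * (60 * a))
  double = ℕ-Ring.solve-∀
  collect : ∀ q w a → 2 * (w * (840 * q * a)) + 30 * a * (30 * a) ≡ 1680 * ((q * w) * a) + 900 * (a * a)
  collect = ℕ-Ring.solve-∀
  sum : ∀ b → 1680 * b + 900 * b ≡ 2580 * b
  sum = ℕ-Ring.solve-∀

-- Everything is compared with `w² m²`. The factor `16` is `4` from `w² ≤ 4 F` and `4` from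
-- `m ≤ 2 (m - e)`. In the main term `N² ≤ (g r)² w² m²`, a constant that the depth beats; in the
-- defect `m N ≤ g² w² m` has one factor `m` less and is absorbed for large `m`.
rich-contradiction : ∀ {w m n N F e t₃ t₄ C g r} → w * w ≤ 4 * F → N ≤ n * n → n ≤ g * w → n ≤ r * m →
  2 * e ≤ m → 16 * (C * (g * g)) ≤ m → (16 * square (g * r) + 2) * t₃ ≤ t₄ → 1 ≤ t₃ → 1 ≤ w → 1 ≤ m →
  ¬ t₄ * (F * square (m ∸ e)) ≤ t₃ * square N + C * (m * N)
rich-contradiction {w} {m} {n} {N} {F} {e} {t₃} {t₄} {C} {g} {r} w²≤ N≤ n≤gw n≤rm 2e≤m C≤m t₄≥ 1≤t₃ 1≤w 1≤m h =
  absurd-multiple {t₄} {16 * A * t₃ + 1} {X} big (*-mono-≤ (*-mono-≤ 1≤w 1≤w) (*-mono-≤ 1≤m 1≤m)) (begin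
    t₄ * (w * w * (m * m))
      ≤⟨ ℕₚ.*-monoʳ-≤ t₄ (*-mono-≤ w²≤ (*-mono-≤ m≤ m≤)) ⟩
    t₄ * (4 * F * ((2 * (m ∸ e)) * (2 * (m ∸ e))))
      ≡⟨ pull t₄ F (m ∸ e) ⟩
    16 * (t₄ * (F * square (m ∸ e)))
      ≤⟨ ℕₚ.*-monoʳ-≤ 16 h ⟩
    16 * (t₃ * square N + C * (m * N))
      ≤⟨ ℕₚ.*-monoʳ-≤ 16 (+-mono-≤ (ℕₚ.*-monoʳ-≤ t₃ (square-mono N≤mixed)) (ℕₚ.*-monoʳ-≤ C (ℕₚ.*-monoʳ-≤ m N≤pure))) ⟩
    16 * (t₃ * square ((g * w) * (r * m)) + C * (m * ((g * w) * (g * w))))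
      ≡⟨ regroup t₃ g w r m C ⟩
    16 * A * t₃ * X + 16 * (C * (g * g)) * (w * w * m)
      ≤⟨ ℕₚ.+-monoʳ-≤ (16 * A * t₃ * X) (ℕₚ.*-monoˡ-≤ (w * w * m) C≤m) ⟩
    16 * A * t₃ * X + m * (w * w * m)
      ≡⟨ last (16 * A * t₃) w m ⟩
    (16 * A * t₃ + 1) * X ∎)
  where
  open ℕₚ.≤-Reasoning
  A = square (g * r)
  X = w * w * (m * m)
  m≤ : m ≤ 2 * (m ∸ e)
  m≤ = ℕₚ.+-cancelʳ-≤ m _ _ (begin
    m + m ≡⟨ cong (λ s → s + s) (sym (ℕₚ.m∸n+n≡m e≤m)) ⟩
    ((m ∸ e) + e) + ((m ∸ e) + e) ≡⟨ rearrange (m ∸ e) e ⟩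
    2 * (m ∸ e) + 2 * e ≤⟨ ℕₚ.+-monoʳ-≤ (2 * (m ∸ e)) 2e≤m ⟩
    2 * (m ∸ e) + m ∎)
    where
    e≤m : e ≤ m
    e≤m = ≤-trans (m≤m+n e (e + 0)) 2e≤m
    rearrange : ∀ a e → (a + e) + (a + e) ≡ 2 * a + 2 * e
    rearrange = ℕ-Ring.solve-∀
  N≤mixed : N ≤ (g * w) * (r * m)
  N≤mixed = ≤-trans N≤ (*-mono-≤ n≤gw n≤rm)
  N≤pure : N ≤ (g * w) * (g * w)
  N≤pure = ≤-trans N≤ (*-mono-≤ n≤gw n≤gw)
  big : 16 * A * t₃ + 1 < t₄
  big = ≤-trans (≤-reflexive (two (16 * A * t₃))) (≤-trans (ℕₚ.+-monoʳ-≤ (16 * A * t₃) (ℕₚ.*-monoʳ-≤ 2 1≤t₃))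
    (≤-trans (≤-reflexive (sym (ℕₚ.*-distribʳ-+ t₃ (16 * A) 2))) t₄≥))
    where
    two : ∀ s → suc (s + 1) ≡ s + 2 * 1
    two = ℕ-Ring.solve-∀
  pull : ∀ t F y → t * (4 * F * ((2 * y) * (2 * y))) ≡ 16 * (t * (F * (y * y)))
  pull = ℕ-Ring.solve-∀
  regroup : ∀ t g w r m C → 16 * (t * (((g * w) * (r * m)) * ((g * w) * (r * m))) + C * (m * ((g * w) * (g * w))))
    ≡ 16 * ((g * r) * (g * r)) * t * (w * w * (m * m)) + 16 * (C * (g * g)) * (w * w * m)
  regroup = ℕ-Ring.solve-∀
  last : ∀ s w m → s * (w * w * (m * m)) + m * (w * w * m) ≡ (s + 1) * (w * w * (m * m))
  last = ℕ-Ring.solve-∀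

-- Bernoulli's inequality `(4 / 3)^d ≥ 1 + d / 3` with the denominators cleared.
bernoulli : ∀ d → (3 + d) * 3 ^ d ≤ 3 * 4 ^ d
bernoulli zero = ≤-refl
bernoulli (suc d) = begin
  (4 + d) * (3 * 3 ^ d) ≤⟨ m≤m+n _ (d * 3 ^ d) ⟩
  (4 + d) * (3 * 3 ^ d) + d * 3 ^ d ≡⟨ lemma d (3 ^ d) ⟩
  4 * ((3 + d) * 3 ^ d) ≤⟨ ℕₚ.*-monoʳ-≤ 4 (bernoulli d) ⟩
  4 * (3 * 4 ^ d) ≡⟨ swap (4 ^ d) ⟩
  3 * (4 * 4 ^ d) ∎
  where
  open ℕₚ.≤-Reasoning
  lemma : ∀ d t → (4 + d) * (3 * t) + d * t ≡ 4 * ((3 + d) * t)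
  lemma = ℕ-Ring.solve-∀
  swap : ∀ t → 4 * (3 * t) ≡ 3 * (4 * t)
  swap = ℕ-Ring.solve-∀

powers-diverge : ∀ A → A * 3 ^ (3 * A) ≤ 4 ^ (3 * A)
powers-diverge A = ℕₚ.*-cancelˡ-≤ 3 (begin
  3 * (A * t) ≡⟨ sym (ℕₚ.*-assoc 3 A t) ⟩
  3 * A * t ≤⟨ ℕₚ.*-monoˡ-≤ t (m≤n+m (3 * A) 3) ⟩
  (3 + 3 * A) * t ≤⟨ bernoulli (3 * A) ⟩
  3 * 4 ^ (3 * A) ∎)
  where
  open ℕₚ.≤-Reasoning
  t = 3 ^ (3 * A)

-- Up to factors depending on q, everything is a multiple of the length w of the time window:
-- n lies between 420 q² w and 840 q² w, and the thresholds are 60 q w and 180 q w.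
record Parameters (q n : ℕ) : Set where
  field
    w g r d : ℕ
    ls : Levels
  open Levels ls public using (low; high)
  field
    1≤q : 1 ≤ q
    1≤w : 1 ≤ w
    low≡ : low ≡ 60 * (q * w)
    3low≤high : 3 * low ≤ high
    room : q * suc (high + high) ≤ n
    upper : n ≤ 840 * q * (q * w)
    n≤gw : n ≤ g * w
    n≤rlow : n ≤ r * low
    loss-small : 2 * loss d ≤ low
    defect-small : 16 * (defect d * (g * g)) ≤ low
    deep : (16 * square (g * r) + 2) * 3 ^ d ≤ 4 ^ d

module _ {q n : ℕ} (par : Parameters q n) {end : ℕ} (game : Game (Parameters.ls par) end) where
  open Parameters par
  open Game game using (M; B)

  private
    a = q * w

    w≤a : w ≤ a
    w≤a = ≤-trans (≤-reflexive (sym (ℕₚ.*-identityˡ w))) (ℕₚ.*-monoˡ-≤ w 1≤q)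

    1≤a : 1 ≤ a
    1≤a = ≤-trans 1≤w w≤a

    rich : ∀ Q {Fs} → All (Owns Q low) Fs → All (λ f → 60 * a ≤ hits Q f) Fs
    rich Q = All.map (λ o → ≤-reflexive (trans (sym low≡) (sym (proj₁ o))))

    2h+2 : ∀ h → 2 * h + 2 ≡ 2 * suc h
    2h+2 = ℕ-Ring.solve-∀

    4s+4 : ∀ s → 4 * s + 4 ≡ 4 * suc s
    4s+4 = ℕ-Ring.solve-∀

  not-many-new : ∀ {Q T} → T ≤ n → Unique Q → length Q ≤ w * T → ¬ RichFamily game Q (suc ⌊ T /2⌋)
  not-many-new {Q} {T} T≤n uniq L≤ (Fs , large , owns , sep) with length Fs ℕₚ.≤? 30 * a
  ... | yes small = few-contradiction {a} {length Fs} {w} {T} 1≤a (≤-trans (s≤s z≤n) large) w≤a L≤ T≤2j small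
      (few-rich-rays uniq sep (rich Q owns))
    where
    T≤2j : T ≤ 2 * length Fs
    T≤2j = ≤-trans (n≤2half+1 T) (≤-trans (ℕₚ.+-monoʳ-≤ (2 * ⌊ T /2⌋) (s≤s z≤n))
        (≤-trans (≤-reflexive (2h+2 ⌊ T /2⌋)) (ℕₚ.*-monoʳ-≤ 2 large)))
  ... | no big = many-contradiction {q} {w} {T} 1≤a L≤ (≤-trans T≤n upper)
        (subst (λ j → j * (60 * a) ≤ length Q + choose2 j) (trans (length-take (30 * a) Fs)
            (ℕₚ.m≤n⇒m⊓n≡m (ℕₚ.<⇒≤ (ℕₚ.≰⇒> big))))
          (few-rich-rays uniq (AllPairsₚ.take⁺ (30 * a) sep) (Allₚ.take⁺ (30 * a) (rich Q owns))))

  not-many-in-total : ∀ {T} → T ≤ end → T ≤ n → ¬ RichFamily game (M T) (suc (staircase w))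
  not-many-in-total {T} T≤ T≤n (Fs , large , owns , sep) =
    rich-contradiction {w} {low} {n} {length (M T)} {length Fs} {loss d} {3 ^ d} {4 ^ d} {defect d} {g} {r}
      (≤-trans (square≤staircase w) (≤-trans (ℕₚ.+-monoʳ-≤ (4 * staircase w) (s≤s z≤n))
          (≤-trans (≤-reflexive (4s+4 (staircase w))) (ℕₚ.*-monoʳ-≤ 4 large))))
      (≤-trans (length-M game T T≤) (*-mono-≤ T≤n T≤n))
      n≤gw n≤rlow loss-small defect-small deep (ℕₚ.m^n>0 3 d) 1≤w (Levels.low-positive ls)
      (≤-trans (ℕₚ.*-monoʳ-≤ (4 ^ d) (∑-const-≥ Fs (All.map
          (λ {f} o → ≤-reflexive (cong (λ h → square (h ∸ loss d)) (sym (proj₁ o)))) owns)))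
        (rich-rays d low sep (unique-M game T T≤) (All.map (λ o → ≤-reflexive (proj₁ o)) owns)))

  no-high-threat : ∀ T → T ≤ end → T ≤ n → ¬ Threat high (M T) (B T)
  no-high-threat T T≤ T≤n th = [ (λ (Q , uniq , L≤ , fam) → not-many-new T≤n uniq L≤ fam) , not-many-in-total T≤ T≤n ]′
    (many-rich game w T T≤ 3low≤high th)

-- The order of choice avoids a circle: `g` and `r` depend on `q` only, the depth `d` is chosen to
-- beat `(g r)²`, and then `w`, hence `n`, is taken large compared with the loss and the defect at
-- that depth.
parameters : ∀ q → 1 ≤ q → ∃[ N ] (∀ n → N ≤ n → Parameters q n)
-- `g` is read off from `n ≤ 840 q² w`, and division by `low = 60 q w` gives `r = 14 q`.
parameters q 1≤q = choose-depth (840 * (q * q)) (14 * q) refl refl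
  where
  choose-window : ∀ g r d W n → g ≡ 840 * (q * q) → r ≡ 14 * q → (16 * square (g * r) + 2) * 3 ^ d ≤ 4 ^ d →
    2 * loss d + 16 * (defect d * (g * g)) + 1 ≤ W → (w : ℕ) → W ≤ w → 420 * (q * q) * w ≤ n → n ≤ 420 *
        (q * q) * suc w → Parameters q n
  choose-window g r d W n g≡ r≡ deep W-large w W≤w lower upper = record
    { w = w ; g = g ; r = r ; d = d ; ls = levels (60 * a) (3 * (60 * a)) (≤-trans 1≤a a≤60a) (m≤m+n (60 * a) _)
    ; 1≤q = 1≤q ; 1≤w = 1≤w ; low≡ = refl ; 3low≤high = ≤-refl
    -- `2 * high` is `360 * a` and the extra `1` is at most `a`; the resulting `361 * a` is below
    -- `420 * a`.
    ; room = ≤-trans (ℕₚ.*-monoʳ-≤ q (≤-trans (s≤s (≤-reflexive (double a))) (≤-trans (+-mono-≤ 1≤a ≤-refl)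
        (ℕₚ.*-monoˡ-≤ a (ℕₚ.≤ᵇ⇒≤ 361 420 _)))))
               (≤-trans (≤-reflexive (assoc-room q w)) lower)
    ; upper = n≤840
    ; n≤gw = ≤-trans n≤840 (≤-reflexive (trans (assoc-g q w) (cong (_* w) (sym g≡))))
    ; n≤rlow = ≤-trans n≤840 (≤-reflexive (trans (assoc-r q a) (cong (_* (60 * a)) (sym r≡))))
    ; loss-small = ≤-trans (≤-trans (≤-trans (m≤m+n _ _) (m≤m+n _ 1)) W-large) W≤60a
    ; defect-small = ≤-trans (≤-trans (≤-trans (m≤n+m _ (2 * loss d)) (m≤m+n _ 1)) W-large) W≤60a
    ; deep = deep }
    where
    a = q * w
    a≤60a : a ≤ 60 * a
    a≤60a = m≤m+n a _
    1≤w : 1 ≤ w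
    1≤w = ≤-trans (m≤n+m 1 _) (≤-trans W-large W≤w)
    w≤a : w ≤ a
    w≤a = ≤-trans (≤-reflexive (sym (ℕₚ.*-identityˡ w))) (ℕₚ.*-monoˡ-≤ w 1≤q)
    1≤a : 1 ≤ a
    1≤a = ≤-trans 1≤w w≤a
    W≤60a : W ≤ 60 * a
    W≤60a = ≤-trans W≤w (≤-trans w≤a a≤60a)
    double : ∀ a → 3 * (60 * a) + 3 * (60 * a) ≡ 360 * a
    double = ℕ-Ring.solve-∀
    assoc-room : ∀ q w → q * (420 * (q * w)) ≡ 420 * (q * q) * w
    assoc-room = ℕ-Ring.solve-∀
    assoc-g : ∀ q w → 840 * q * (q * w) ≡ 840 * (q * q) * w
    assoc-g = ℕ-Ring.solve-∀
    assoc-r : ∀ q a → 840 * q * a ≡ 14 * q * (60 * a)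
    assoc-r = ℕ-Ring.solve-∀
    twice : ∀ q w → 420 * (q * q) * (w + w) ≡ 840 * q * (q * w)
    twice = ℕ-Ring.solve-∀
    n≤840 : n ≤ 840 * q * (q * w)
    n≤840 = ≤-trans upper (≤-trans (ℕₚ.*-monoʳ-≤ (420 * (q * q)) (ℕₚ.+-monoˡ-≤ w 1≤w)) (≤-reflexive (twice q w)))
  divide : ∀ c W n → 1 ≤ c → c * W ≤ n → ∃[ w ] W ≤ w × c * w ≤ n × n ≤ c * suc w
  divide c W n 1≤c cW≤n = n DivMod./ c
    , ≤-trans (≤-reflexive (sym (trans (cong (DivMod._/ c) (ℕₚ.*-comm c W)) (DivMod.m*n/n≡m W c))))
        (DivMod./-monoˡ-≤ c cW≤n)
    , ≤-trans (≤-reflexive (ℕₚ.*-comm c (n DivMod./ c))) (DivMod.m/n*n≤m n c)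
    , ≤-trans (≤-reflexive (DivMod.m≡m%n+[m/n]*n n c)) (≤-trans (ℕₚ.+-monoˡ-≤ (n DivMod./ c * c)
        (ℕₚ.<⇒≤ (DivMod.m%n<n n c))) (≤-reflexive (ℕₚ.*-comm (suc (n DivMod./ c)) c)))
    where
    instance
      c-nonZero = >-nonZero 1≤c
  choose-depth : ∀ g r → g ≡ 840 * (q * q) → r ≡ 14 * q → ∃[ N ] (∀ n → N ≤ n → Parameters q n)
  choose-depth g r g≡ r≡ =
    let A = 16 * square (g * r) + 2
        d = 3 * A
        W = 2 * loss d + 16 * (defect d * (g * g)) + 1
    in 420 * (q * q) * W , λ n N≤n →
      let w , W≤w , lower , upper = divide (420 * (q * q)) W n (*-mono-≤ (s≤s (z≤n {419})) (*-mono-≤ 1≤q 1≤q)) N≤n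
      in choose-window g r d W n g≡ r≡ (powers-diverge A) ≤-refl w W≤w lower upper

-- The strategy as a function of Maker's moves

-- A strategy is given Maker's moves only, so Breaker's earlier replies are recomputed. The third
-- component is the latest reply.
State : Set
State = List Pt × List Pt × List Pt

advance : Levels → State → Move → State
advance ls (M , B , _) m = let new = reply ls (length m) (M ++ m) B in M ++ m , B ++ new , new

history : Levels → List Move → State
history ls = foldl (advance ls) ([] , [] , [])

strategy : Levels → BreakerStrategy
strategy ls ms = proj₂ (proj₂ (history ls ms))

concat-∷ʳ : ∀ (xss : List (List Pt)) xs → concat (xss ++ xs ∷ []) ≡ concat xss ++ xs
concat-∷ʳ xss xs = trans (sym (concat-++ xss (xs ∷ []))) (cong (concat xss ++_) (++-identityʳ xs))

module _ (ls : Levels) (τ : MakerStrategy) where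
  private
    σ = strategy ls
    ms = λ k → proj₁ (play τ σ k)
    bs = λ k → proj₂ (play τ σ k)
    move = λ k → τ (bs k)
    M = λ k → concat (ms k)
    B = λ k → concat (bs k)

  history-∷ʳ : ∀ k → history ls (ms k ++ move k ∷ []) ≡ advance ls (history ls (ms k)) (move k)
  history-∷ʳ k = foldl-++ (advance ls) ([] , [] , []) (ms k) (move k ∷ [])

  history-claims : ∀ k → proj₁ (history ls (ms k)) ≡ M k × proj₁ (proj₂ (history ls (ms k))) ≡ B k
  reply-now : ∀ k → σ (ms k ++ move k ∷ []) ≡ reply ls (length (move k)) (M (suc k)) (B k)

  history-claims zero = refl , refl
  history-claims (suc k) =
    trans (cong proj₁ (history-∷ʳ k)) (trans (cong (_++ move k) (proj₁ (history-claims k)))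
        (sym (concat-∷ʳ (ms k) (move k))))
    , trans (cong (λ s → proj₁ (proj₂ s)) (history-∷ʳ k))
        (trans (cong₂ _++_ (proj₂ (history-claims k)) (sym (cong (λ s → proj₂ (proj₂ s)) (history-∷ʳ k))))
            (sym (concat-∷ʳ (bs k) _)))
  reply-now k = trans (cong (λ s → proj₂ (proj₂ s)) (history-∷ʳ k))
    (cong₂ (reply ls (length (move k)))
      (trans (cong (_++ move k) (proj₁ (history-claims k))) (sym (concat-∷ʳ (ms k) (move k))))
          (proj₂ (history-claims k)))

  game : ∀ {end} → (∀ k → k < end → MakerLegalAt τ σ k) → Game ls end
  game legal = record
    { M = M ; B = B ; move = move ; M-zero = refl ; B-zero = refl
    ; M-suc = λ k → concat-∷ʳ (ms k) (move k)
    ; B-suc = λ k → trans (concat-∷ʳ (bs k) _) (cong (B k ++_) (reply-now k))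
    ; legal = legal }

  breaker-legal : ∀ k → length (move k) ≡ suc k → BreakerLegalAt τ σ k
  breaker-legal k len = subst (LegalMove (suc k) (concat (ms k) ++ move k ++ concat (bs k))) (sym (reply-now k))
    ( trans (reply-length ls (length (move k)) (M (suc k)) (B k)) len
    , proj₁ fresh
    , subst (λ C → All (_∉ C) (reply ls (length (move k)) (M (suc k)) (B k)))
        (trans (cong (_++ B k) (concat-∷ʳ (ms k) (move k))) (++-assoc (M k) (move k) (B k))) (proj₂ fresh))
    where
    fresh = reply-fresh ls (length (move k)) (M (suc k)) (B k)

-- From a rational `δ` to an integer bound, and the theorem

open import Data.Integer using (+_)
open import Data.Rational as ℚ using (ℚ; 0ℚ; 1ℚ; _/_)

unnormalised-bound : ∀ δ k n → (+ suc k / 1) ℚ.< (1ℚ ℚ.- δ) ℚ.* (+ n / 1) →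
  ℚᵘ.mkℚᵘ (+ suc k) 0 ℚᵘ.< (ℚᵘ.1ℚᵘ ℚᵘ.- ℚ.toℚᵘ δ) ℚᵘ.* ℚᵘ.mkℚᵘ (+ n) 0
unnormalised-bound δ k n lt =
  ℚᵘₚ.<-respˡ-≃ (ℚₚ.toℚᵘ-fromℚᵘ (ℚᵘ.mkℚᵘ (+ suc k) 0)) (ℚᵘₚ.<-respʳ-≃
    (ℚᵘₚ.≃-trans (ℚₚ.toℚᵘ-homo-* (1ℚ ℚ.- δ) (+ n / 1))
      (ℚᵘₚ.*-cong (ℚᵘₚ.≃-trans (ℚₚ.toℚᵘ-homo-+ 1ℚ (ℚ.- δ)) (ℚᵘₚ.+-congʳ ℚᵘ.1ℚᵘ (ℚₚ.toℚᵘ-homo‿- δ)))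
        (ℚₚ.toℚᵘ-fromℚᵘ (ℚᵘ.mkℚᵘ (+ n) 0))))
    (ℚₚ.toℚᵘ-mono-< lt))

-- `q` is the denominator of `δ`. As `δ ≥ 1 / q`, the time is at most `(1 - 1 / q) n`, written here
-- without division.
time-bound : ∀ δ → 0ℚ ℚ.< δ → ∃[ q ] 1 ≤ q × (∀ k n → (+ suc k / 1) ℚ.< (1ℚ ℚ.- δ) ℚ.* (+ n / 1) →
    q * suc k + n ≤ q * n)
time-bound δ@(ℚ.mkℚ (+ suc p) b _) _ = suc b , s≤s z≤n , λ k n lt → bound k n
    (ℚᵘₚ.drop-*<* (unnormalised-bound δ k n lt))
  where
  simplify : ∀ q p n → (1ℤ ℤ.* q ℤ.+ ℤ.- p ℤ.* 1ℤ) ℤ.* n ℤ.* 1ℤ ℤ.+ p ℤ.* n ≡ q ℤ.* n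
  simplify = ℤ-Ring.solve-∀
  bound : ∀ k n → + suc k ℤ.* + (1 * suc b * 1) ℤ.< (1ℤ ℤ.* + suc b ℤ.+ ℤ.- (+ suc p) ℤ.* 1ℤ) ℤ.* + n ℤ.* 1ℤ →
      suc b * suc k + n ≤ suc b * n
  bound k n lt = ℕₚ.<⇒≤ (≤-trans (s≤s (≤-trans (ℕₚ.+-monoʳ-≤ (suc b * suc k) (m≤m+n n (p * n)))
      (≤-reflexive (cong (_+ suc p * n) (reorder (suc b) (suc k)))))) strict)
    where
    reorder : ∀ q k → q * k ≡ k * (1 * q * 1)
    reorder = ℕ-Ring.solve-∀
    strict : suc k * (1 * suc b * 1) + suc p * n < suc b * n
    strict = ℤₚ.drop‿+<+ (subst₂ ℤ._<_
      (trans (cong₂ ℤ._+_ (sym (ℤₚ.pos-* (suc k) (1 * suc b * 1))) (sym (ℤₚ.pos-* (suc p) n)))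
          (sym (ℤₚ.pos-+ (suc k * (1 * suc b * 1)) (suc p * n))))
      (trans (simplify (+ suc b) (+ suc p) (+ n)) (sym (ℤₚ.pos-* (suc b) n)))
      (ℤₚ.+-monoˡ-< (+ suc p ℤ.* + n) lt))
time-bound (ℚ.mkℚ (+ zero) _ _) (ℚ.*<* lt) = contradiction lt (ℤₚ.<-irrefl refl)
time-bound (ℚ.mkℚ ℤ.-[1+ _ ] _ _) (ℚ.*<* ())

theorem1 : (δ : ℚ) → 0ℚ ℚ.< δ →
    ∃[ N ] ((n : ℕ) → N ≤ n →
    ∃[ σ ] ((τ : MakerStrategy) → (k : ℕ) →
    (+ (suc k) / 1) ℚ.< (1ℚ ℚ.- δ) ℚ.* (+ n / 1) →
    ((j : ℕ) → j ≤ k → MakerLegalAt τ σ j) →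
    ((j : ℕ) → j < k → BreakerLegalAt τ σ j) × NoWinAt n τ σ k))
theorem1 δ δ>0 =
  let q , 1≤q , early = time-bound δ δ>0
      N , par = parameters q 1≤q
  in N , λ n N≤n → strategy (Parameters.ls (par n N≤n)) , λ τ k lt legal →
     outcome q 1≤q (par n N≤n) τ k (early k n lt) legal
  where
  outcome : ∀ q → 1 ≤ q → ∀ {n} (par : Parameters q n) τ k → q * suc k + n ≤ q * n →
    let σ = strategy (Parameters.ls par) in
    ((j : ℕ) → j ≤ k → MakerLegalAt τ σ j) → ((j : ℕ) → j < k → BreakerLegalAt τ σ j) × NoWinAt n τ σ k
  outcome q 1≤q {n} par τ k early legal =
    (λ j j<k → breaker-legal ls τ j (proj₁ (legal j (ℕₚ.<⇒≤ j<k))))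
    , subst (λ X → ¬ WinningSegment n X (Game.B g k)) (Game.M-suc g k)
        (no-win-at g 2≤n (λ T T<end → no-high-threat par g T (ℕₚ.<⇒≤ T<end)
            (≤-trans (ℕₚ.<⇒≤ T<end) k<n)) enough k ≤-refl)
    where
    open Parameters par using (ls; high; room)
    g : Game ls (suc k)
    g = game ls τ (λ j j<sk → legal j (ℕₚ.≤-pred j<sk))
    -- Without a high threat an unfilled stretch has at most `2 * high` old points, and the last
    -- move adds at most `suc k`. The slack `n / q` left by `δ` makes room for the former.
    enough : suc (high + high) + suc k ≤ n
    enough = ℕₚ.*-cancelˡ-≤ q {{>-nonZero 1≤q}} (begin
      q * (suc (high + high) + suc k) ≡⟨ ℕₚ.*-distribˡ-+ q (suc (high + high)) (suc k) ⟩
      q * suc (high + high) + q * suc k ≤⟨ ℕₚ.+-monoˡ-≤ (q * suc k) room ⟩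
      n + q * suc k ≡⟨ ℕₚ.+-comm n (q * suc k) ⟩
      q * suc k + n ≤⟨ early ⟩
      q * n ∎)
      where open ℕₚ.≤-Reasoning
    k<n : suc k ≤ n
    k<n = ≤-trans (m≤n+m (suc k) (suc (high + high))) enough
    2≤n : 2 ≤ n
    2≤n = ≤-trans (+-mono-≤ (s≤s (z≤n {high + high})) (s≤s (z≤n {k}))) enough
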